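{- For any $\varepsilon>0$, there exists an algorithm for the problem $BV^{\max}$ that outputs a set $S$ of items having total value at least $1-\varepsilon$ times the optimal value of $BV^{\max}$, such that $$(1-\varepsilon)\,l_k^v\le\sum_{r\in S\cap V_k}v_r^{(k)}\le(1+\varepsilon)\,u_k^v\qquad\text{for all }k\in[m],$$ and the total weight of $S$ is at most $B$. The running time of the algorithm is $$O\!\left(\frac{n^2\,m\,\log^3 m\;\log_{1+\varepsilon}^{3}\!\left(\frac{N v_{\max}}{v_{\min}}\right)}{\varepsilon}\right),$$ where $v_{\min}:=\min\{v_j^{(i)} : i\in[m],\ j\in V_i,\ v_j^{(i)}>0\}$ and $v_{\max}:=\max\{v_j^{(i)} : i\in[m],\ j\in V_i\}$.
   Context: Each item belongs to one of $m$ categories; $V_i$ is the set of all items of category $i\in[m]=\{1,\dots,m\}$. Item $j\in V_i$ has a non-negative weight $w_j^{(i)}$ and a non-negative value $v_j^{(i)}$, and at least one item has positive value. $n=\max_{i\in[m]}|V_i|$, and $N$ is the total number of items. Problem $BV^{\max}$ (max-knapsack with group fairness bounds on value): given the items, a lower bound $l_i^v\ge 0$ and an upper bound $u_i^v\ge l_i^v$ for each category $i\in[m]$, and a knapsack capacity $B$, find a subset $S$ of the items that maximizes the total value, such that the total value of the items of $S$ from category $i$ is between $l_i^v$ and $u_i^v$ for all $i\in[m]$, and the total weight of $S$ is at most $B$. A feasible solution is a subset satisfying all these constraints; the optimal value is the maximum total value of a feasible solution, and the instance is assumed to have one.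
   Formalization: The weights, values, bounds l and u, capacity B and ε are taken to be rational; running time counts unit-cost exact arithmetic steps, and inside the logarithms m and N are read as max(m,2) and max(N,2), so that the bound does not vanish when m = 1 or N = 1. -}

module Defs where

open import Algebra.Definitions.RawSemiring using (_^_)
open import Algebra.Properties.CommutativeMonoid.Sum using (sum)
open import Data.Bool.Base using (Bool; true; false; if_then_else_; _∧_; not)
open import Data.Fin.Base using (Fin; toℕ; fromℕ<)
open import Data.Fin.Subset using (Subset)
open import Data.Integer.Base using (+_; ∣_∣)
open import Data.List.Base using (List; []; _∷_)
open import Data.List.Properties using (≡-dec)
open import Data.Nat.Base as ℕ using (ℕ)
open import Data.Nat.Properties as ℕ using ()
open import Data.Product.Base using (_×_; ∃-syntax)
open import Data.Rational.Base using (ℚ; 0ℚ; 1ℚ; _+_; _*_; _-_; _÷_; _/_; _≤_; _<_; ↥_; ↧ₙ_; ≢-nonZero)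
open import Data.Rational.Properties using (_≟_; _≤?_; +-0-commutativeMonoid; +-*-rawSemiring)
open import Data.Vec.Base using (lookup; tabulate)
open import Data.Vec.Functional using (foldr)
open import Relation.Binary.PropositionalEquality.Core using (_≡_)
open import Relation.Nullary.Decidable.Core using (yes; no; does)

fromℕ : ℕ → ℚ
fromℕ k = + k / 1

infixl 7 _/₀_

-- Total division, with x /₀ 0ℚ = 0ℚ.
_/₀_ : ℚ → ℚ → ℚ
x /₀ y with y ≟ 0ℚ
... | yes _  = 0ℚ
... | no y≢0 = _÷_ x y {{≢-nonZero y≢0}}

infixr 8 _^ᵣ_

_^ᵣ_ : ℚ → ℕ → ℚ
_^ᵣ_ = _^_ +-*-rawSemiring

∑ : ∀ {k} → (Fin k → ℚ) → ℚ
∑ = sum +-0-commutativeMonoid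

-- For 1 < b and 1 ≤ x: log_b x ≤ α, where α = p / q ≥ 0, says x ^ q ≤ b ^ p.
-- A bound by an increasing continuous expression in log_b x is equivalent to
-- the same bound for all rational α ≥ log_b x, so real logarithms are
-- avoided without rounding them.
Log[_]_≤_ : ℚ → ℚ → ℚ → Set
Log[ b ] x ≤ α = (0ℚ ≤ α) × (x ^ᵣ ↧ₙ α ≤ b ^ᵣ ∣ ↥ α ∣)

IsMinimum IsMaximum : (ℚ → Set) → ℚ → Set
IsMinimum P x = P x × (∀ y → P y → x ≤ y)
IsMaximum P x = P x × (∀ y → P y → y ≤ x)

record Instance : Set where
  field
    m        : ℕ
    size     : Fin m → ℕ
    w v      : (i : Fin m) → Fin (size i) → ℚ
    l u      : Fin m → ℚ
    B        : ℚ
    w≥0      : ∀ i j → 0ℚ ≤ w i j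
    v≥0      : ∀ i j → 0ℚ ≤ v i j
    positive : ∃[ i ] ∃[ j ] 0ℚ < v i j
    l≥0      : ∀ i → 0ℚ ≤ l i
    l≤u      : ∀ i → l i ≤ u i

module _ (I : Instance) where
  open Instance I

  maxSize : ℕ
  maxSize = foldr ℕ._⊔_ 0 size

  numItems : ℕ
  numItems = foldr ℕ._+_ 0 size

  Value PositiveValue : ℚ → Set
  Value x         = ∃[ i ] ∃[ j ] v i j ≡ x
  PositiveValue x = Value x × 0ℚ < x

  Selection : Set
  Selection = (i : Fin m) → Subset (size i)

  -- Σ_{j ∈ S ∩ Vᵢ} f i j
  sumOver : ((i : Fin m) → Fin (size i) → ℚ) → Selection → Fin m → ℚ
  sumOver f S i = ∑ (λ j → if lookup (S i) j then f i j else 0ℚ)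

  categoryValue : Selection → Fin m → ℚ
  categoryValue = sumOver v

  totalValue totalWeight : Selection → ℚ
  totalValue  S = ∑ (sumOver v S)
  totalWeight S = ∑ (sumOver w S)

  Feasible : Selection → Set
  Feasible S = (∀ i → l i ≤ categoryValue S i × categoryValue S i ≤ u i)
             × totalWeight S ≤ B

  IsOptimalValue : ℚ → Set
  IsOptimalValue = IsMaximum (λ x → ∃[ S ] (Feasible S × totalValue S ≡ x))

-- The model of computation is a unit-cost random access machine, programmed
-- in a while language.  There are two sorts of data, naturals and rationals;
-- a variable of either sort is an array subscripted by lists of naturals of
-- any length (a scalar is the entry at []).  Every operator, literal, memory
-- read and memory write costs one step.  There is no rounding of rationals.

Var : Set
Var = ℕ

infixl 6 _⊕_ _⊖_ _⊞_ _⊟_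
infixl 7 _⊗_ _⊠_ _⊘_

data NExp : Set where
  lit         : ℕ → NExp
  _⟦_⟧        : Var → List NExp → NExp
  _⊕_ _⊖_ _⊗_ : NExp → NExp → NExp

data QExp : Set where
  lit             : ℚ → QExp
  _⟦_⟧            : Var → List NExp → QExp
  cast            : NExp → QExp
  _⊞_ _⊟_ _⊠_ _⊘_ : QExp → QExp → QExp

data Test : Set where
  _≤ₙ_ : NExp → NExp → Test
  _≤ᵣ_ : QExp → QExp → Test
  neg  : Test → Test
  _&_  : Test → Test → Test

infixr 4 _⨾_

data Cmd : Set where
  skip              : Cmd
  _⟦_⟧≔ₙ_           : Var → List NExp → NExp → Cmd
  _⟦_⟧≔ᵣ_           : Var → List NExp → QExp → Cmd
  _⨾_               : Cmd → Cmd → Cmd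
  if′_then′_else′_  : Test → Cmd → Cmd → Cmd
  while_do′_        : Test → Cmd → Cmd

Memory : Set → Set
Memory A = Var → List ℕ → A

record Store : Set where
  constructor ⟨_,_⟩
  field
    nat : Memory ℕ
    rat : Memory ℚ
open Store public

write : {A : Set} → Memory A → Var → List ℕ → A → Memory A
write μ x ks a y ls =
  if does (y ℕ.≟ x) ∧ does (≡-dec ℕ._≟_ ls ks) then a else μ y ls

module _ (σ : Store) where

  evalN  : NExp → ℕ
  evalNs : List NExp → List ℕ
  evalN (lit k)  = k
  evalN (x ⟦ es ⟧) = nat σ x (evalNs es)
  evalN (d ⊕ e)  = evalN d ℕ.+ evalN e
  evalN (d ⊖ e)  = evalN d ℕ.∸ evalN e
  evalN (d ⊗ e)  = evalN d ℕ.* evalN e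
  evalNs []       = []
  evalNs (e ∷ es) = evalN e ∷ evalNs es

  evalQ : QExp → ℚ
  evalQ (lit q)  = q
  evalQ (x ⟦ es ⟧) = rat σ x (evalNs es)
  evalQ (cast e) = fromℕ (evalN e)
  evalQ (d ⊞ e)  = evalQ d + evalQ e
  evalQ (d ⊟ e)  = evalQ d - evalQ e
  evalQ (d ⊠ e)  = evalQ d * evalQ e
  evalQ (d ⊘ e)  = evalQ d /₀ evalQ e

  evalT : Test → Bool
  evalT (d ≤ₙ e) = does (evalN d ℕ.≤? evalN e)
  evalT (d ≤ᵣ e) = does (evalQ d ≤? evalQ e)
  evalT (neg b)  = not (evalT b)
  evalT (b & c)  = evalT b ∧ evalT c

costN  : NExp → ℕ
costNs : List NExp → ℕ
costN (lit _)  = 1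
costN (x ⟦ es ⟧) = 1 ℕ.+ costNs es
costN (d ⊕ e)  = 1 ℕ.+ costN d ℕ.+ costN e
costN (d ⊖ e)  = 1 ℕ.+ costN d ℕ.+ costN e
costN (d ⊗ e)  = 1 ℕ.+ costN d ℕ.+ costN e
costNs []       = 0
costNs (e ∷ es) = costN e ℕ.+ costNs es

costQ : QExp → ℕ
costQ (lit _)  = 1
costQ (x ⟦ es ⟧) = 1 ℕ.+ costNs es
costQ (cast e) = 1 ℕ.+ costN e
costQ (d ⊞ e)  = 1 ℕ.+ costQ d ℕ.+ costQ e
costQ (d ⊟ e)  = 1 ℕ.+ costQ d ℕ.+ costQ e
costQ (d ⊠ e)  = 1 ℕ.+ costQ d ℕ.+ costQ e
costQ (d ⊘ e)  = 1 ℕ.+ costQ d ℕ.+ costQ e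

costT : Test → ℕ
costT (d ≤ₙ e) = 1 ℕ.+ costN d ℕ.+ costN e
costT (d ≤ᵣ e) = 1 ℕ.+ costQ d ℕ.+ costQ e
costT (neg b)  = 1 ℕ.+ costT b
costT (b & c)  = 1 ℕ.+ costT b ℕ.+ costT c

-- Run c σ τ t: started in σ, the command c halts in τ after t steps.
data Run : Cmd → Store → Store → ℕ → Set where
  run-skip    : ∀ {σ} → Run skip σ σ 0
  run-assignₙ : ∀ {σ x es e} →
               Run (x ⟦ es ⟧≔ₙ e) σ
                   ⟨ write (nat σ) x (evalNs σ es) (evalN σ e) , rat σ ⟩
                   (1 ℕ.+ costNs es ℕ.+ costN e)
  run-assignᵣ : ∀ {σ x es e} →
               Run (x ⟦ es ⟧≔ᵣ e) σ
                   ⟨ nat σ , write (rat σ) x (evalNs σ es) (evalQ σ e) ⟩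
                   (1 ℕ.+ costNs es ℕ.+ costQ e)
  run-seq     : ∀ {c d σ τ υ s t} → Run c σ τ s → Run d τ υ t →
               Run (c ⨾ d) σ υ (s ℕ.+ t)
  run-then    : ∀ {b c d σ τ t} → evalT σ b ≡ true → Run c σ τ t →
               Run (if′ b then′ c else′ d) σ τ (costT b ℕ.+ t)
  run-else    : ∀ {b c d σ τ t} → evalT σ b ≡ false → Run d σ τ t →
               Run (if′ b then′ c else′ d) σ τ (costT b ℕ.+ t)
  run-stop    : ∀ {b c σ} → evalT σ b ≡ false →
               Run (while b do′ c) σ σ (costT b)
  run-repeat  : ∀ {b c σ τ υ s t} → evalT σ b ≡ true →
               Run c σ τ s → Run (while b do′ c) τ υ t →
               Run (while b do′ c) σ υ (costT b ℕ.+ s ℕ.+ t)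

pattern categories = 0
pattern sizes      = 1
pattern chosen     = 2

pattern capacity = 0
pattern lower    = 1
pattern upper    = 2
pattern weight   = 3
pattern value    = 4

at : {A : Set} {k : ℕ} → A → (Fin k → A) → ℕ → A
at {k = k} z f a with a ℕ.<? k
... | yes a<k = f (fromℕ< a<k)
... | no _    = z

-- Categories, and items within a category, are numbered from 0.  All
-- memory not holding input is 0, so initially no item is chosen.
module _ (I : Instance) where
  open Instance I

  inputNat : Memory ℕ
  inputNat categories []       = m
  inputNat sizes      (i ∷ []) = at 0 size i
  inputNat _          _        = 0

  inputRat : Memory ℚ
  inputRat capacity []           = B
  inputRat lower    (i ∷ [])     = at 0ℚ l i
  inputRat upper    (i ∷ [])     = at 0ℚ u i
  inputRat weight   (i ∷ j ∷ []) = at 0ℚ (λ i′ → at 0ℚ (w i′) j) i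
  inputRat value    (i ∷ j ∷ []) = at 0ℚ (λ i′ → at 0ℚ (v i′) j) i
  inputRat _        _            = 0ℚ

  input : Store
  input = ⟨ inputNat , inputRat ⟩

  output : Store → Selection I
  output τ i = tabulate (λ j → does (0 ℕ.<? nat τ chosen (toℕ i ∷ toℕ j ∷ [])))

-- t ≤ C · n² m log₂³ m log³_{1+ε} (N vmax / vmin) / ε.  So that the bound does
-- not vanish for a single category or a single item, m and N are replaced
-- by m ⊔ 2 and N ⊔ 2 inside the logarithms.
TimeBound : ℕ → ℚ → Instance → ℕ → Set
TimeBound C ε I t =
  ∀ vmin vmax → IsMinimum (PositiveValue I) vmin → IsMaximum (Value I) vmax →
  ∀ α β →
  Log[ fromℕ 2 ] fromℕ (m ℕ.⊔ 2) ≤ α →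
  Log[ 1ℚ + ε ] (fromℕ (numItems I ℕ.⊔ 2) * vmax /₀ vmin) ≤ β →
  fromℕ t ≤ fromℕ C * (fromℕ (maxSize I ℕ.^ 2 ℕ.* m) * α ^ᵣ 3 * β ^ᵣ 3 /₀ ε)
  where open Instance I

{-# OPTIONS --safe #-}

-- For ε > 1 the empty selection will do.  For ε ≤ 1, round values to the grid
-- 0, s, ρ s, ρ² s, … where s is the least positive value.  Pad the number of
-- categories to 2 ^ p and the number of items per category to 2 ^ (q + 1), and
-- make the items the leaves of a complete binary tree in which the categories
-- are subtrees.  For every node and every grid point compute the least weight
-- of a selection of items below the node whose value, rounded down at every
-- node, is that grid point: a node combines all pairs of entries of its two
-- children, and at the root of a category the entries violating the (relaxed)
-- bounds are dropped.  Each of the E = p + q + 2 levels costs a factor ρ; with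
-- ρ = 1 + ε / 2E we have ρ ^ E ≤ 1 + ε ≤ ρ ^ 2E, so the errors stay within 1 + ε
-- and the grid has O(E · log_{1+ε} (N vmax / vmin)) points.  Merging takes cubic
-- time in the size of the grid at each of the O(n m) nodes, which is within the
-- bound because E = O(log m · log n) and log³ n = O(n).

module Submission where

open import Data.Bool.Base using (true; false; not; _∧_; if_then_else_)
open import Data.Empty using (⊥-elim)
open import Data.Fin.Base as Fin using (Fin; toℕ; fromℕ<)
import Data.Fin.Properties as Fin
open import Data.Integer.Base as ℤ using (∣_∣) renaming (+_ to posℤ)
import Data.Integer.Properties as ℤ
open import Data.List.Base using (List; []; _∷_)
open import Data.List.Properties using (≡-dec; ∷-injectiveˡ; ∷-injectiveʳ)
open import Data.Nat.Base as ℕ using (ℕ; zero; suc)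
open import Data.Nat.DivMod using (m≡m%n+[m/n]*n; m%n<n)
import Data.Nat.Properties as ℕ
open import Data.Nat.Tactic.RingSolver using () renaming (solve-∀ to ℕ-solve)
open import Data.Product.Base using (_×_; _,_; ∃-syntax; proj₁; proj₂)
open import Data.Rational.Base as ℚ using (ℚ; 0ℚ; 1ℚ; _+_; _*_; _-_; -_; 1/_; _≤_; _<_; ↥_; ↧ₙ_; toℚᵘ; ≢-nonZero; mkℚ)
import Data.Rational.Properties as ℚ
open import Data.Rational.Unnormalised.Base as ℚᵘ using (mkℚᵘ; *≡*; _≃_)
import Data.Rational.Unnormalised.Properties as ℚᵘ
open import Data.Sum.Base using (_⊎_; inj₁; inj₂)
open import Data.Unit.Base using (⊤; tt)
open import Data.Vec.Base using (lookup; tabulate)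
open import Data.Vec.Functional using (foldr)
open import Data.Vec.Properties using (lookup∘tabulate)
open import Function.Base using (_∘_; _$_; id)
open import Relation.Binary.Definitions using (tri<; tri≈; tri>)
open import Relation.Binary.PropositionalEquality
open import Relation.Nullary using (¬_; Dec; yes; no; ¬?; _×-dec_; does)
open import Relation.Nullary.Decidable using (True; toWitness; decidable-stable; dec-true; dec-false; dec⇒maybe)
open import Tactic.RingSolver using (solve-∀)
open import Tactic.RingSolver.Core.AlmostCommutativeRing using (AlmostCommutativeRing; fromCommutativeRing)
open import Defs

-- Rational arithmetic

-- The tables support two inductions in opposite directions. Soundness: a filled entry names filled
-- entries of its children whose costs add up to its own, so following the choices from the root
-- downward yields an actual selection. Completeness: rounding the values of a feasible selection
-- from the leaves to the root gives a candidate entry at every node, and the stored cost of that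
-- entry cannot exceed the weight of the selection. The root takes the largest affordable grid
-- index, hence at least that of any feasible selection. The category test is asymmetric:
-- `l ≤ (1 + ε) · r c` and `r c ≤ u`. A value x rounded to `r c` satisfies r c ≤ x ≤ (1 + ε) · r c;
-- hence feasible selections pass the test, and whatever passes has (1 - ε) · l ≤ x ≤ (1 + ε) · u.
-- Iteration counts of the while loops enter the proof as least numbers at which a guard fails, and
-- every estimate with logarithms is a comparison of exponents of powers.

ℚ-ring : AlmostCommutativeRing _ _
ℚ-ring = fromCommutativeRing ℚ.+-*-commutativeRing (λ x → dec⇒maybe (0ℚ ℚ.≟ x))

0≤+ : ∀ {x y} → 0ℚ ≤ x → 0ℚ ≤ y → 0ℚ ≤ x + y
0≤+ {x} {y} p q = subst (_≤ x + y) (ℚ.+-identityˡ 0ℚ) (ℚ.+-mono-≤ p q)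

*-monoʳ : ∀ {x y z} → 0ℚ ≤ x → y ≤ z → x * y ≤ x * z
*-monoʳ {x} p q = ℚ.*-monoˡ-≤-nonNeg x {{ℚ.nonNegative p}} q

*-monoˡ : ∀ {x y z} → 0ℚ ≤ x → y ≤ z → y * x ≤ z * x
*-monoˡ {x} p q = ℚ.*-monoʳ-≤-nonNeg x {{ℚ.nonNegative p}} q

0≤* : ∀ {x y} → 0ℚ ≤ x → 0ℚ ≤ y → 0ℚ ≤ x * y
0≤* {x} {y} p q = subst (_≤ x * y) (ℚ.*-zeroʳ x) (*-monoʳ p q)

0<* : ∀ {x y} → 0ℚ < x → 0ℚ < y → 0ℚ < x * y
0<* {x} {y} p q = subst (_< x * y) (ℚ.*-zeroʳ x) (ℚ.*-monoʳ-<-pos x {{ℚ.positive p}} q)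

*-mono-≤ : ∀ {a b c d} → 0ℚ ≤ a → 0ℚ ≤ c → a ≤ b → c ≤ d → a * c ≤ b * d
*-mono-≤ 0≤a 0≤c a≤b c≤d = ℚ.≤-trans (*-monoʳ 0≤a c≤d) (*-monoˡ (ℚ.≤-trans 0≤c c≤d) a≤b)

*-cancelʳ : ∀ {x y z} → 0ℚ < x → y * x ≤ z * x → y ≤ z
*-cancelʳ {x} p = ℚ.*-cancelʳ-≤-pos x {{ℚ.positive p}}

0≤1 : 0ℚ ≤ 1ℚ
0≤1 = ℚ.nonNegative⁻¹ 1ℚ

0<1 : 0ℚ < 1ℚ
0<1 = ℚ.positive⁻¹ 1ℚ

<⇒≢0 : ∀ {y} → 0ℚ < y → y ≢ 0ℚ
<⇒≢0 p refl = ℚ.<-irrefl refl p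

/₀-*-cancel : ∀ x {y} → 0ℚ < y → x /₀ y * y ≡ x
/₀-*-cancel x {y} 0<y with y ℚ.≟ 0ℚ
... | yes y≡0 = ⊥-elim (<⇒≢0 0<y y≡0)
... | no y≢0 = trans (ℚ.*-assoc x (1/ y) y) (trans (cong (x *_) (ℚ.*-inverseˡ y)) (ℚ.*-identityʳ x))
  where instance _ = ≢-nonZero y≢0

0≤/₀ : ∀ {x y} → 0ℚ ≤ x → 0ℚ < y → 0ℚ ≤ x /₀ y
0≤/₀ {x} {y} 0≤x 0<y = *-cancelʳ 0<y (subst₂ _≤_ (sym (ℚ.*-zeroˡ y)) (sym (/₀-*-cancel x 0<y)) 0≤x)

0</₀ : ∀ {x y} → 0ℚ < x → 0ℚ < y → 0ℚ < x /₀ y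
0</₀ {x} {y} 0<x 0<y = ℚ.*-cancelʳ-<-nonNeg y {{ℚ.nonNegative (ℚ.<⇒≤ 0<y)}}
  (subst₂ _<_ (sym (ℚ.*-zeroˡ y)) (sym (/₀-*-cancel x 0<y)) 0<x)

*≤⇒≤/₀ : ∀ {x y z} → 0ℚ < y → z * y ≤ x → z ≤ x /₀ y
*≤⇒≤/₀ {x} {y} {z} 0<y p = *-cancelʳ 0<y (subst (z * y ≤_) (sym (/₀-*-cancel x 0<y)) p)

fromℕ-toℚᵘ : ∀ k → toℚᵘ (fromℕ k) ≃ mkℚᵘ (posℤ k) 0
fromℕ-toℚᵘ k = ℚ.toℚᵘ-fromℚᵘ (mkℚᵘ (posℤ k) 0)

fromℕ-+ : ∀ a b → fromℕ (a ℕ.+ b) ≡ fromℕ a + fromℕ b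
fromℕ-+ a b = ℚ.toℚᵘ-injective (begin
  toℚᵘ (fromℕ (a ℕ.+ b)) ≈⟨ fromℕ-toℚᵘ (a ℕ.+ b) ⟩
  mkℚᵘ (posℤ (a ℕ.+ b)) 0   ≈⟨ *≡* (cong (ℤ._* posℤ 1) (cong₂ ℤ._+_ (sym (ℤ.*-identityʳ (posℤ a))) (sym (ℤ.*-identityʳ (posℤ b))))) ⟩
  mkℚᵘ (posℤ a) 0 ℚᵘ.+ mkℚᵘ (posℤ b) 0 ≈⟨ ℚᵘ.+-cong (ℚᵘ.≃-sym (fromℕ-toℚᵘ a)) (ℚᵘ.≃-sym (fromℕ-toℚᵘ b)) ⟩
  toℚᵘ (fromℕ a) ℚᵘ.+ toℚᵘ (fromℕ b) ≈⟨ ℚ.toℚᵘ-homo-+ (fromℕ a) (fromℕ b) ⟨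
  toℚᵘ (fromℕ a + fromℕ b) ∎)
  where open ℚᵘ.≃-Reasoning

fromℕ-* : ∀ a b → fromℕ (a ℕ.* b) ≡ fromℕ a * fromℕ b
fromℕ-* a b = ℚ.toℚᵘ-injective (begin
  toℚᵘ (fromℕ (a ℕ.* b)) ≈⟨ fromℕ-toℚᵘ (a ℕ.* b) ⟩
  mkℚᵘ (posℤ (a ℕ.* b)) 0   ≈⟨ *≡* (cong (ℤ._* posℤ 1) (ℤ.pos-* a b)) ⟩
  mkℚᵘ (posℤ a) 0 ℚᵘ.* mkℚᵘ (posℤ b) 0 ≈⟨ ℚᵘ.*-cong (ℚᵘ.≃-sym (fromℕ-toℚᵘ a)) (ℚᵘ.≃-sym (fromℕ-toℚᵘ b)) ⟩
  toℚᵘ (fromℕ a) ℚᵘ.* toℚᵘ (fromℕ b) ≈⟨ ℚ.toℚᵘ-homo-* (fromℕ a) (fromℕ b) ⟨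
  toℚᵘ (fromℕ a * fromℕ b) ∎)
  where open ℚᵘ.≃-Reasoning

0≤fromℕ : ∀ k → 0ℚ ≤ fromℕ k
0≤fromℕ k = ℚ.nonNegative⁻¹ (fromℕ k) {{ℚ.normalize-nonNeg k 1}}

0<fromℕ : ∀ k .{{_ : ℕ.NonZero k}} → 0ℚ < fromℕ k
0<fromℕ k = ℚ.positive⁻¹ (fromℕ k) {{ℚ.normalize-pos k 1}}

fromℕ-mono : ∀ {a b} → a ℕ.≤ b → fromℕ a ≤ fromℕ b
fromℕ-mono {a} {b} a≤b = subst₂ _≤_ (ℚ.+-identityʳ (fromℕ a))
  (trans (sym (fromℕ-+ a (b ℕ.∸ a))) (cong fromℕ (ℕ.m+[n∸m]≡n a≤b)))
  (ℚ.+-monoʳ-≤ (fromℕ a) (0≤fromℕ (b ℕ.∸ a)))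

fromℕ-suc : ∀ k → fromℕ (suc k) ≡ 1ℚ + fromℕ k
fromℕ-suc = fromℕ-+ 1

-- Recovers `α` from the exponents `↧ₙ α` and `∣ ↥ α ∣` in which `Log[_]_≤_` is written;
-- non-negativity lets the absolute value be dropped.
*-↧ₙ : ∀ {x} → 0ℚ ≤ x → x * fromℕ (↧ₙ x) ≡ fromℕ ∣ ↥ x ∣
*-↧ₙ {x@(mkℚ _ _ _)} 0≤x = ℚ.toℚᵘ-injective (begin
  toℚᵘ (x * fromℕ d) ≈⟨ ℚ.toℚᵘ-homo-* x (fromℕ d) ⟩
  toℚᵘ x ℚᵘ.* toℚᵘ (fromℕ d) ≈⟨ ℚᵘ.*-cong {toℚᵘ x} ℚᵘ.≃-refl (fromℕ-toℚᵘ d) ⟩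
  toℚᵘ x ℚᵘ.* mkℚᵘ (posℤ d) 0 ≈⟨ *≡* eq ⟩
  mkℚᵘ (posℤ ∣ ↥ x ∣) 0 ≈⟨ fromℕ-toℚᵘ ∣ ↥ x ∣ ⟨
  toℚᵘ (fromℕ ∣ ↥ x ∣) ∎)
  where
  open ℚᵘ.≃-Reasoning
  d = ↧ₙ x
  n≥0 : posℤ ∣ ↥ x ∣ ≡ ↥ x
  n≥0 = ℤ.0≤i⇒+∣i∣≡i (ℤ.nonNegative⁻¹ (↥ x) {{ℚ.nonNegative 0≤x}})
  eq : (↥ x ℤ.* posℤ d) ℤ.* posℤ 1 ≡ posℤ ∣ ↥ x ∣ ℤ.* (posℤ (d ℕ.* 1))
  eq = trans (ℤ.*-identityʳ (↥ x ℤ.* posℤ d)) (cong₂ ℤ._*_ (sym n≥0) (cong posℤ (sym (ℕ.*-identityʳ d))))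

archimedean : ∀ x → ∃[ n ] x ≤ fromℕ n
archimedean x with ℚ.≤-total x 0ℚ
... | inj₁ x≤0 = 0 , x≤0
-- The numerator already bounds x, the denominator being at least 1.
... | inj₂ 0≤x = ∣ ↥ x ∣ , subst₂ _≤_ (ℚ.*-identityʳ x) (*-↧ₙ 0≤x) (*-monoʳ 0≤x (fromℕ-mono {1} {↧ₙ x} (ℕ.s≤s ℕ.z≤n)))

-- Powers and Bernoulli inequalities

0≤^ : ∀ {x} n → 0ℚ ≤ x → 0ℚ ≤ x ^ᵣ n
0≤^ zero _ = 0≤1
0≤^ (suc n) 0≤x = 0≤* 0≤x (0≤^ n 0≤x)

0<^ : ∀ {x} n → 0ℚ < x → 0ℚ < x ^ᵣ n
0<^ zero _ = 0<1
0<^ (suc n) 0<x = 0<* 0<x (0<^ n 0<x)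

^-+ : ∀ x m n → x ^ᵣ (m ℕ.+ n) ≡ x ^ᵣ m * x ^ᵣ n
^-+ x zero n = sym (ℚ.*-identityˡ _)
^-+ x (suc m) n = trans (cong (x *_) (^-+ x m n)) (sym (ℚ.*-assoc x (x ^ᵣ m) (x ^ᵣ n)))

^-^ : ∀ x m n → (x ^ᵣ m) ^ᵣ n ≡ x ^ᵣ (n ℕ.* m)
^-^ x m zero = refl
^-^ x m (suc n) = trans (cong (x ^ᵣ m *_) (^-^ x m n)) (sym (^-+ x m (n ℕ.* m)))

^-monoˡ : ∀ {x y} n → 0ℚ ≤ x → x ≤ y → x ^ᵣ n ≤ y ^ᵣ n
^-monoˡ zero _ _ = ℚ.≤-refl
^-monoˡ (suc n) 0≤x x≤y = *-mono-≤ 0≤x (0≤^ n 0≤x) x≤y (^-monoˡ n 0≤x x≤y)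

1≤^ : ∀ {x} n → 1ℚ ≤ x → 1ℚ ≤ x ^ᵣ n
1≤^ zero _ = ℚ.≤-refl
1≤^ {x} (suc n) 1≤x = *-mono-≤ 0≤1 0≤1 1≤x (1≤^ n 1≤x)

^-monoʳ : ∀ {x m n} → 1ℚ ≤ x → m ℕ.≤ n → x ^ᵣ m ≤ x ^ᵣ n
^-monoʳ {x} {m} {n} 1≤x m≤n = subst₂ _≤_ (ℚ.*-identityʳ (x ^ᵣ m))
  (trans (sym (^-+ x m (n ℕ.∸ m))) (cong (x ^ᵣ_) (ℕ.m+[n∸m]≡n m≤n)))
  (*-monoʳ (0≤^ m (ℚ.≤-trans 0≤1 1≤x)) (1≤^ (n ℕ.∸ m) 1≤x))

x<x*y : ∀ {x y} → 0ℚ < x → 1ℚ < y → x < y * x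
x<x*y {x} {y} 0<x 1<y = subst (_< y * x) (ℚ.*-identityˡ x) (ℚ.*-monoˡ-<-pos x {{ℚ.positive 0<x}} 1<y)

-- By contraposition: for n < m, x ^ m is at least x · x ^ n > x ^ n. This stands in for taking
-- logarithms.
^-cancelʳ : ∀ {x} m n → 1ℚ < x → x ^ᵣ m ≤ x ^ᵣ n → m ℕ.≤ n
^-cancelʳ {x} m n 1<x p with m ℕ.≤? n
... | yes m≤n = m≤n
... | no m≰n = ⊥-elim (ℚ.<-irrefl refl (ℚ.<-≤-trans
        (x<x*y (0<^ n (ℚ.<-trans 0<1 1<x)) 1<x)
        (ℚ.≤-trans (^-monoʳ {x} {suc n} (ℚ.<⇒≤ 1<x) (ℕ.≰⇒> m≰n)) p)))

private
  bernoulli-step : ∀ x k → (1ℚ + x) * (1ℚ + k * x) ≡ (1ℚ + (1ℚ + k) * x) + k * (x * x)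
  bernoulli-step = solve-∀ ℚ-ring

  bernoulli′-step : ∀ x k y → ((1ℚ + x) * y) * (1ℚ - (1ℚ + k) * x) + y * ((1ℚ + k) * (x * x)) ≡ y * (1ℚ - k * x)
  bernoulli′-step = solve-∀ ℚ-ring

x≤x+y : ∀ {x y} → 0ℚ ≤ y → x ≤ x + y
x≤x+y {x} {y} 0≤y = subst (_≤ x + y) (ℚ.+-identityʳ x) (ℚ.+-monoʳ-≤ x 0≤y)

bernoulli : ∀ {x} n → 0ℚ ≤ x → 1ℚ + fromℕ n * x ≤ (1ℚ + x) ^ᵣ n
bernoulli {x} zero 0≤x = ℚ.≤-reflexive (trans (cong (1ℚ +_) (ℚ.*-zeroˡ x)) (ℚ.+-identityʳ 1ℚ))
bernoulli {x} (suc n) 0≤x = begin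
  1ℚ + fromℕ (suc n) * x ≡⟨ cong (λ k → 1ℚ + k * x) (fromℕ-suc n) ⟩
  1ℚ + (1ℚ + fromℕ n) * x ≤⟨ x≤x+y (0≤* (0≤fromℕ n) (0≤* 0≤x 0≤x)) ⟩
  (1ℚ + (1ℚ + fromℕ n) * x) + fromℕ n * (x * x) ≡⟨ bernoulli-step x (fromℕ n) ⟨
  (1ℚ + x) * (1ℚ + fromℕ n * x) ≤⟨ *-monoʳ (0≤+ 0≤1 0≤x) (bernoulli n 0≤x) ⟩
  (1ℚ + x) ^ᵣ suc n ∎
  where open ℚ.≤-Reasoning

-- The upper companion (1 + x) ^ n ≤ 1 / (1 - n x), multiplied out so that the sign of 1 - n x does
-- not matter. It limits the accumulated rounding error.
bernoulli′ : ∀ {x} n → 0ℚ ≤ x → (1ℚ + x) ^ᵣ n * (1ℚ - fromℕ n * x) ≤ 1ℚ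
bernoulli′ {x} zero 0≤x = ℚ.≤-reflexive (trans (cong (λ z → 1ℚ * (1ℚ - z)) (ℚ.*-zeroˡ x)) refl)
bernoulli′ {x} (suc n) 0≤x = begin
  y′ * (1ℚ - fromℕ (suc n) * x) ≡⟨ cong (λ k → y′ * (1ℚ - k * x)) (fromℕ-suc n) ⟩
  y′ * (1ℚ - (1ℚ + fromℕ n) * x) ≤⟨ x≤x+y (0≤* (0≤^ n 0≤1+x) (0≤* (0≤+ 0≤1 (0≤fromℕ n)) (0≤* 0≤x 0≤x))) ⟩
  _ ≡⟨ bernoulli′-step x (fromℕ n) y ⟩
  y * (1ℚ - fromℕ n * x) ≤⟨ bernoulli′ n 0≤x ⟩
  1ℚ ∎
  where
  open ℚ.≤-Reasoning
  0≤1+x = 0≤+ 0≤1 0≤x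
  y = (1ℚ + x) ^ᵣ n
  y′ = (1ℚ + x) ^ᵣ suc n

-- Correctness and running time of commands

-- Tests read as propositions: taking a branch then supplies its mathematical content, and
-- `Candidate` below is `Holds` of `candidate` by computation.
Holds : Store → Test → Set
Holds σ (d ≤ₙ e) = evalN σ d ℕ.≤ evalN σ e
Holds σ (d ≤ᵣ e) = evalQ σ d ≤ evalQ σ e
Holds σ (neg b)  = ¬ Holds σ b
Holds σ (b & c)  = Holds σ b × Holds σ c

holds? : ∀ σ b → Dec (Holds σ b)
holds? σ (d ≤ₙ e) = evalN σ d ℕ.≤? evalN σ e
holds? σ (d ≤ᵣ e) = evalQ σ d ℚ.≤? evalQ σ e
holds? σ (neg b)  = ¬? (holds? σ b)
holds? σ (b & c)  = holds? σ b ×-dec holds? σ c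

evalT-does : ∀ σ b → evalT σ b ≡ does (holds? σ b)
evalT-does σ (d ≤ₙ e) = refl
evalT-does σ (d ≤ᵣ e) = refl
evalT-does σ (neg b)  = cong not (evalT-does σ b)
evalT-does σ (b & c)  = cong₂ _∧_ (evalT-does σ b) (evalT-does σ c)

holds⇒true : ∀ {σ} b → Holds σ b → evalT σ b ≡ true
holds⇒true {σ} b h with holds? σ b | evalT-does σ b
... | yes _ | eq = eq
... | no ¬h | _  = ⊥-elim (¬h h)

¬holds⇒false : ∀ {σ} b → ¬ Holds σ b → evalT σ b ≡ false
¬holds⇒false {σ} b ¬h with holds? σ b | evalT-does σ b
... | yes h | _  = ⊥-elim (¬h h)
... | no _  | eq = eq

write-hit : ∀ {A : Set} (μ : Memory A) x ks a → write μ x ks a x ks ≡ a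
write-hit μ x ks a = cong₂ (λ p q → if p ∧ q then a else μ x ks)
  (dec-true (x ℕ.≟ x) refl) (dec-true (≡-dec ℕ._≟_ ks ks) refl)

write-miss : ∀ {A : Set} (μ : Memory A) x {ks ls} a → ls ≢ ks → write μ x ks a x ls ≡ μ x ls
write-miss μ x {ks} {ls} a ls≢ks = cong₂ (λ p q → if p ∧ q then a else μ x ls)
  (dec-true (x ℕ.≟ x) refl) (dec-false (≡-dec ℕ._≟_ ls ks) ls≢ks)

-- A total-correctness triple for one start state. Time is an upper bound, so that branches of
-- different cost can share it.
Exec : Cmd → Store → (Store → Set) → ℕ → Set
Exec c σ Q T = ∃[ τ ] ∃[ t ] (Run c σ τ t × Q τ × t ℕ.≤ T)

exec-weaken : ∀ {c σ Q Q′ S T} → Exec c σ Q S → (∀ {τ} → Q τ → Q′ τ) → S ℕ.≤ T → Exec c σ Q′ T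
exec-weaken (τ , t , r , q , t≤S) f S≤T = τ , t , r , f q , ℕ.≤-trans t≤S S≤T

exec-skip : ∀ {σ Q} → Q σ → Exec skip σ Q 0
exec-skip {σ} q = σ , 0 , run-skip , q , ℕ.z≤n

assignedₙ : Store → Var → List NExp → NExp → Store
assignedₙ σ x es e = ⟨ write (nat σ) x (evalNs σ es) (evalN σ e) , rat σ ⟩

assignedᵣ : Store → Var → List NExp → QExp → Store
assignedᵣ σ x es e = ⟨ nat σ , write (rat σ) x (evalNs σ es) (evalQ σ e) ⟩

exec-assignₙ : ∀ {σ x es e Q} → Q (assignedₙ σ x es e) → Exec (x ⟦ es ⟧≔ₙ e) σ Q (1 ℕ.+ costNs es ℕ.+ costN e)
exec-assignₙ q = _ , _ , run-assignₙ , q , ℕ.≤-refl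

exec-assignᵣ : ∀ {σ x es e Q} → Q (assignedᵣ σ x es e) → Exec (x ⟦ es ⟧≔ᵣ e) σ Q (1 ℕ.+ costNs es ℕ.+ costQ e)
exec-assignᵣ q = _ , _ , run-assignᵣ , q , ℕ.≤-refl

exec-seq : ∀ {c d σ P Q S T} → Exec c σ P S → (∀ τ → P τ → Exec d τ Q T) → Exec (c ⨾ d) σ Q (S ℕ.+ T)
exec-seq (τ , s , r , p , s≤S) f with f τ p
... | υ , t , r′ , q , t≤T = υ , _ , run-seq r r′ , q , ℕ.+-mono-≤ s≤S t≤T

exec-assignₙ-seq : ∀ {σ x es e d Q T} → Exec d (assignedₙ σ x es e) Q T →
                   Exec ((x ⟦ es ⟧≔ₙ e) ⨾ d) σ Q (1 ℕ.+ costNs es ℕ.+ costN e ℕ.+ T)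
exec-assignₙ-seq (τ , t , r , q , t≤T) = τ , _ , run-seq run-assignₙ r , q , ℕ.+-monoʳ-≤ _ t≤T

exec-assignᵣ-seq : ∀ {σ x es e d Q T} → Exec d (assignedᵣ σ x es e) Q T →
                   Exec ((x ⟦ es ⟧≔ᵣ e) ⨾ d) σ Q (1 ℕ.+ costNs es ℕ.+ costQ e ℕ.+ T)
exec-assignᵣ-seq (τ , t , r , q , t≤T) = τ , _ , run-seq run-assignᵣ r , q , ℕ.+-monoʳ-≤ _ t≤T

exec-if : ∀ {b c d σ Q T} → (Holds σ b → Exec c σ Q T) → (¬ Holds σ b → Exec d σ Q T) →
          Exec (if′ b then′ c else′ d) σ Q (costT b ℕ.+ T)
exec-if {b} {σ = σ} f g with holds? σ b
... | yes h with f h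
...   | τ , t , r , q , t≤T = τ , _ , run-then (holds⇒true b h) r , q , ℕ.+-monoʳ-≤ (costT b) t≤T
exec-if {b} {σ = σ} f g | no ¬h with g ¬h
...   | τ , t , r , q , t≤T = τ , _ , run-else (¬holds⇒false b ¬h) r , q , ℕ.+-monoʳ-≤ (costT b) t≤T

-- The invariant counts iterations and their number n is fixed in advance: the guard holds before n
-- and fails at n. Termination needs no further argument.
exec-while : ∀ {b c} (Inv′ : ℕ → Store → Set) n T →
             (∀ k σ → k ℕ.< n → Inv′ k σ → Holds σ b × Exec c σ (Inv′ (suc k)) T) →
             (∀ σ → Inv′ n σ → ¬ Holds σ b) →
             ∀ {σ} → Inv′ 0 σ → Exec (while b do′ c) σ (Inv′ n) (n ℕ.* (costT b ℕ.+ T) ℕ.+ costT b)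
exec-while {b} {c} Inv′ n T step stop {σ} j = go 0 n refl σ j
  where
  go : ∀ k r → k ℕ.+ r ≡ n → ∀ σ → Inv′ k σ → Exec (while b do′ c) σ (Inv′ n) (r ℕ.* (costT b ℕ.+ T) ℕ.+ costT b)
  go k zero eq σ j rewrite trans (sym (ℕ.+-identityʳ k)) eq =
    σ , _ , run-stop (¬holds⇒false b (stop σ j)) , j , ℕ.≤-refl
  go k (suc r) eq σ j with step k σ (subst (k ℕ.<_) eq (ℕ.m<m+n k (ℕ.s≤s ℕ.z≤n))) j
  ... | h , τ , s , run , j′ , s≤T with go (suc k) r (trans (sym (ℕ.+-suc k r)) eq) τ j′
  ...   | υ , t , run′ , jn , t≤ =
    υ , _ , run-repeat (holds⇒true b h) run run′ , jn ,
    subst (costT b ℕ.+ s ℕ.+ t ℕ.≤_) (sym (ℕ.+-assoc (costT b ℕ.+ T) (r ℕ.* (costT b ℕ.+ T)) (costT b)))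
      (ℕ.+-mono-≤ (ℕ.+-monoʳ-≤ (costT b) s≤T) t≤)

for : Var → NExp → Cmd → Cmd
for x e c = (x ⟦ [] ⟧≔ₙ lit 0) ⨾ (while (neg (e ≤ₙ (x ⟦ [] ⟧))) do′ (c ⨾ (x ⟦ [] ⟧≔ₙ (x ⟦ [] ⟧ ⊕ lit 1))))

set : Store → Var → ℕ → Store
set σ x k = ⟨ write (nat σ) x [] k , rat σ ⟩

-- A round adds 3 + `costN e` for the test and 4 for the increment; the initial assignment (2) and
-- the last test are paid once.
forTime : NExp → ℕ → ℕ → ℕ
forTime e n T = n ℕ.* (T ℕ.+ (7 ℕ.+ costN e)) ℕ.+ (5 ℕ.+ costN e)

-- The bound `e` is evaluated anew in every round, hence `bound`. The body is to establish the
-- invariant in the store whose counter is already increased, which changes nothing for an invariant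
-- that does not read `x`.
exec-for : ∀ x e c (Inv : ℕ → Store → Set) n T →
           (∀ k σ → Inv k σ → evalN σ e ≡ n) →
           (∀ k σ → k ℕ.< n → Inv k σ → nat σ x [] ≡ k →
              Exec c σ (λ τ → nat τ x [] ≡ k × Inv (suc k) (set τ x (suc k))) T) →
           ∀ {σ} → Inv 0 (set σ x 0) → Exec (for x e c) σ (Inv n) (forTime e n T)
exec-for x e c Inv n T bound body {σ} start =
  exec-weaken
    (exec-seq {c = x ⟦ [] ⟧≔ₙ (lit 0)} {P = Inv′ 0} (exec-assignₙ (start , write-hit (nat σ) x [] 0))
      (λ τ j → exec-while Inv′ n (T ℕ.+ 4) step (λ υ j → λ ¬≤ → ¬≤ (ℕ.≤-reflexive (trans (bound n υ (proj₁ j)) (sym (proj₂ j))))) j))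
    proj₁ (ℕ.≤-reflexive (time n T (costN e)))
  where
  Inv′ : ℕ → Store → Set
  Inv′ k σ = Inv k σ × nat σ x [] ≡ k

  step : ∀ k σ → k ℕ.< n → Inv′ k σ →
         ¬ (evalN σ e ℕ.≤ nat σ x []) × Exec (c ⨾ (x ⟦ [] ⟧≔ₙ (x ⟦ [] ⟧ ⊕ lit 1))) σ (Inv′ (suc k)) (T ℕ.+ 4)
  step k σ k<n (inv , eq) =
    (λ le → ℕ.<⇒≱ k<n (subst₂ ℕ._≤_ (bound k σ inv) eq le)) ,
    exec-seq (body k σ k<n inv eq) λ where
      τ (eq′ , inv′) → exec-assignₙ
        (subst (λ i → Inv (suc k) (set τ x i)) (sym (suc-eq eq′)) inv′ , trans (write-hit (nat τ) x [] _) (suc-eq eq′))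
    where
    suc-eq : ∀ {i} → i ≡ k → i ℕ.+ 1 ≡ suc k
    suc-eq refl = ℕ.+-comm k 1

  time : ∀ n T c → 2 ℕ.+ (n ℕ.* (suc (suc (c ℕ.+ 1)) ℕ.+ (T ℕ.+ 4)) ℕ.+ suc (suc (c ℕ.+ 1)))
         ≡ n ℕ.* (T ℕ.+ (7 ℕ.+ c)) ℕ.+ (5 ℕ.+ c)
  time = ℕ-solve

-- The program

-- rows and columns are the numbers of categories and of items per category,
-- rounded up to powers of two; leaves = rows · columns.  Nodes are numbered as
-- in a heap: the root is 1, the children of x are 2x and 2x + 1.
pattern category    = 3
pattern item        = 4
pattern breadth     = 5
pattern rows        = 6
pattern columns     = 7
pattern levels      = 8
pattern gridSize    = 9
pattern node        = 10
pattern left        = 11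
pattern right       = 12
pattern merged      = 13
pattern reachable   = 14
pattern leftChoice  = 15
pattern rightChoice = 16
pattern entry       = 17
pattern best        = 18
pattern leaves      = 19

pattern least      = 5
pattern total      = 6
pattern ratio      = 7
pattern grid       = 8
pattern cost       = 9
pattern leafValue  = 10
pattern leafWeight = 11

infix 25 !_

!_ : Var → NExp
! x = x ⟦ [] ⟧

measure : Cmd
measure = for category (! categories)
  (if′ (! breadth ≤ₙ (sizes ⟦ ! category ∷ [] ⟧))
   then′ (breadth ⟦ [] ⟧≔ₙ (sizes ⟦ ! category ∷ [] ⟧))
   else′ skip)

-- Every doubling adds a level to the tree, so `levels` is obtained by counting.
double : Var → Var → Cmd
double bound x = while (neg (! bound ≤ₙ ! x)) do′
  ((x ⟦ [] ⟧≔ₙ (lit 2 ⊗ ! x)) ⨾ (levels ⟦ [] ⟧≔ₙ (! levels ⊕ lit 1)))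

-- columns starts at 2, so that the root of a category is never a leaf.
shape : Cmd
shape = (rows ⟦ [] ⟧≔ₙ lit 1) ⨾ (columns ⟦ [] ⟧≔ₙ lit 2) ⨾ (levels ⟦ [] ⟧≔ₙ lit 2) ⨾
  double categories rows ⨾ double breadth columns ⨾ (leaves ⟦ [] ⟧≔ₙ (! rows ⊗ ! columns))

leafIndex : NExp
leafIndex = (! rows ⊕ ! category) ⊗ ! columns ⊕ ! item

load : Cmd
load = for category (! rows) (for item (! columns)
  ((leafValue ⟦ leafIndex ∷ [] ⟧≔ᵣ (value ⟦ ! category ∷ ! item ∷ [] ⟧)) ⨾
   (leafWeight ⟦ leafIndex ∷ [] ⟧≔ᵣ (weight ⟦ ! category ∷ ! item ∷ [] ⟧))))

-- `least` = 0ℚ means that no positive value has been seen; therefore a positive value replaces it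
-- unless 0 < `least` ≤ value.
scan : Cmd
scan = (total ⟦ [] ⟧≔ᵣ lit 0ℚ) ⨾ (least ⟦ [] ⟧≔ᵣ lit 0ℚ) ⨾ for node (! leaves)
  ((total ⟦ [] ⟧≔ᵣ ((total ⟦ [] ⟧) ⊞ (leafValue ⟦ ! leaves ⊕ ! node ∷ [] ⟧))) ⨾
   (if′ neg ((leafValue ⟦ ! leaves ⊕ ! node ∷ [] ⟧) ≤ᵣ lit 0ℚ) &
        neg (neg ((least ⟦ [] ⟧) ≤ᵣ lit 0ℚ) & ((least ⟦ [] ⟧) ≤ᵣ (leafValue ⟦ ! leaves ⊕ ! node ∷ [] ⟧)))
    then′ (least ⟦ [] ⟧≔ᵣ (leafValue ⟦ ! leaves ⊕ ! node ∷ [] ⟧))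
    else′ skip))

-- The loop stops at the first power above `total`. That power sits at index `gridSize` itself, a
-- sentinel outside the range of all later loops.
makeGrid : ℚ → Cmd
makeGrid ε = (ratio ⟦ [] ⟧≔ᵣ (lit 1ℚ ⊞ lit ε ⊘ cast (lit 2 ⊗ ! levels))) ⨾
  (grid ⟦ lit 0 ∷ [] ⟧≔ᵣ lit 0ℚ) ⨾ (grid ⟦ lit 1 ∷ [] ⟧≔ᵣ (least ⟦ [] ⟧)) ⨾ (gridSize ⟦ [] ⟧≔ₙ lit 1) ⨾
  (while ((grid ⟦ ! gridSize ∷ [] ⟧) ≤ᵣ (total ⟦ [] ⟧)) do′
    ((grid ⟦ ! gridSize ⊕ lit 1 ∷ [] ⟧≔ᵣ ((ratio ⟦ [] ⟧) ⊠ (grid ⟦ ! gridSize ∷ [] ⟧))) ⨾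
     (gridSize ⟦ [] ⟧≔ₙ (! gridSize ⊕ lit 1))))

-- An item is entered only at grid indices ≥ 1: index 0 at a leaf means that the
-- item is not chosen.
enterLeaves : Cmd
enterLeaves = for item (! leaves) ((node ⟦ [] ⟧≔ₙ (! leaves ⊕ ! item)) ⨾
  (reachable ⟦ ! node ∷ lit 0 ∷ [] ⟧≔ₙ lit 1) ⨾ (cost ⟦ ! node ∷ lit 0 ∷ [] ⟧≔ᵣ lit 0ℚ) ⨾
  for merged (! gridSize)
   (if′ (lit 1 ≤ₙ ! merged) & (((grid ⟦ ! merged ∷ [] ⟧) ≤ᵣ (leafValue ⟦ ! node ∷ [] ⟧)) &
        ((leafValue ⟦ ! node ∷ [] ⟧) ≤ᵣ ((ratio ⟦ [] ⟧) ⊠ (grid ⟦ ! merged ∷ [] ⟧))))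
    then′ ((reachable ⟦ ! node ∷ ! merged ∷ [] ⟧≔ₙ lit 1) ⨾
           (cost ⟦ ! node ∷ ! merged ∷ [] ⟧≔ᵣ (leafWeight ⟦ ! node ∷ [] ⟧)))
    else′ skip))

sumOfGrid sumOfCosts : QExp
sumOfGrid  = (grid ⟦ ! left ∷ [] ⟧) ⊞ (grid ⟦ ! right ∷ [] ⟧)
sumOfCosts = (cost ⟦ lit 2 ⊗ ! node ∷ ! left ∷ [] ⟧) ⊞ (cost ⟦ lit 2 ⊗ ! node ⊕ lit 1 ∷ ! right ∷ [] ⟧)

-- The nodes rows ≤ x < 2 · rows are the roots of the categories.
fits : ℚ → Test
fits ε = neg (((! rows ≤ₙ ! node) & ((! node ⊕ lit 1) ≤ₙ (lit 2 ⊗ ! rows))) &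
  neg (((lower ⟦ ! node ⊖ ! rows ∷ [] ⟧) ≤ᵣ (lit (1ℚ + ε) ⊠ (grid ⟦ ! merged ∷ [] ⟧))) &
       ((grid ⟦ ! merged ∷ [] ⟧) ≤ᵣ (upper ⟦ ! node ⊖ ! rows ∷ [] ⟧))))

-- Every grid point within a factor ρ below the sum is accepted. Trying all triples replaces a
-- search for the rounded sum; this is where the cube of the grid size comes from.
candidate : ℚ → Test
candidate ε = (lit 1 ≤ₙ (reachable ⟦ lit 2 ⊗ ! node ∷ ! left ∷ [] ⟧)) &
  ((lit 1 ≤ₙ (reachable ⟦ lit 2 ⊗ ! node ⊕ lit 1 ∷ ! right ∷ [] ⟧)) &
  (((grid ⟦ ! merged ∷ [] ⟧) ≤ᵣ sumOfGrid) &
  ((sumOfGrid ≤ᵣ ((ratio ⟦ [] ⟧) ⊠ (grid ⟦ ! merged ∷ [] ⟧))) &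
  fits ε)))

improvable : Test
improvable = neg ((lit 1 ≤ₙ (reachable ⟦ ! node ∷ ! merged ∷ [] ⟧)) &
                  ((cost ⟦ ! node ∷ ! merged ∷ [] ⟧) ≤ᵣ sumOfCosts))

improve : ℚ → Cmd
improve ε = if′ candidate ε & improvable
  then′ ((reachable ⟦ ! node ∷ ! merged ∷ [] ⟧≔ₙ lit 1) ⨾
         (cost ⟦ ! node ∷ ! merged ∷ [] ⟧≔ᵣ sumOfCosts) ⨾
         (leftChoice ⟦ ! node ∷ ! merged ∷ [] ⟧≔ₙ ! left) ⨾
         (rightChoice ⟦ ! node ∷ ! merged ∷ [] ⟧≔ₙ ! right))
  else′ skip

merge : ℚ → Cmd
merge ε = for left (! gridSize) (for right (! gridSize) (for merged (! gridSize) (improve ε)))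

-- Heap numbers are visited in decreasing order, so both children are finished before their parent.
mergeAll : ℚ → Cmd
mergeAll ε = for item (! leaves ⊖ lit 1)
  ((node ⟦ [] ⟧≔ₙ (! leaves ⊖ (! item ⊕ lit 1))) ⨾ merge ε)

-- Indices increase and later ones overwrite earlier ones, so the largest affordable index survives.
select : Cmd
select = (best ⟦ [] ⟧≔ₙ lit 0) ⨾ for merged (! gridSize)
  (if′ (lit 1 ≤ₙ (reachable ⟦ lit 1 ∷ ! merged ∷ [] ⟧)) & ((cost ⟦ lit 1 ∷ ! merged ∷ [] ⟧) ≤ᵣ (capacity ⟦ [] ⟧))
   then′ (best ⟦ [] ⟧≔ₙ ! merged)
   else′ skip)

descend : Cmd
descend = (entry ⟦ lit 1 ∷ [] ⟧≔ₙ ! best) ⨾ for item (! leaves ⊖ lit 1)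
  ((node ⟦ [] ⟧≔ₙ (! item ⊕ lit 1)) ⨾
   (entry ⟦ lit 2 ⊗ ! node ∷ [] ⟧≔ₙ (leftChoice ⟦ ! node ∷ (entry ⟦ ! node ∷ [] ⟧) ∷ [] ⟧)) ⨾
   (entry ⟦ lit 2 ⊗ ! node ⊕ lit 1 ∷ [] ⟧≔ₙ (rightChoice ⟦ ! node ∷ (entry ⟦ ! node ∷ [] ⟧) ∷ [] ⟧)))

unload : Cmd
unload = for category (! rows) (for item (! columns)
  (chosen ⟦ ! category ∷ ! item ∷ [] ⟧≔ₙ (entry ⟦ leafIndex ∷ [] ⟧)))

solve algorithm : ℚ → Cmd
solve ε     = enterLeaves ⨾ mergeAll ε ⨾ select ⨾ descend ⨾ unload
algorithm ε = measure ⨾ shape ⨾ load ⨾ scan ⨾ makeGrid ε ⨾ solve ε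

-- Views of a store.  After a write to a variable outside a view, the view is
-- definitionally unchanged, so an invariant that fixes it is preserved for free.
record Inputs : Set where
  constructor mkInputs
  field
    m₀ : ℕ
    size₀ : ℕ → ℕ
    cap : ℚ
    lo up : ℕ → ℚ
    wt vl : ℕ → ℕ → ℚ

inputs : Store → Inputs
inputs σ = mkInputs (nat σ categories []) (λ i → nat σ sizes (i ∷ []))
  (rat σ capacity []) (λ i → rat σ lower (i ∷ [])) (λ i → rat σ upper (i ∷ []))
  (λ i j → rat σ weight (i ∷ j ∷ [])) (λ i j → rat σ value (i ∷ j ∷ []))

record Shape : Set where
  constructor mkShape
  field
    ins : Inputs
    M P E : ℕ
    L : ℕ
  open Inputs ins public

shapeOf : Store → Shape
shapeOf σ = mkShape (inputs σ) (nat σ rows []) (nat σ columns []) (nat σ levels []) (nat σ leaves [])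

record Leaves : Set where
  constructor mkLeaves
  field
    shp : Shape
    lv lw : ℕ → ℚ
  open Shape shp public

leavesOf : Store → Leaves
leavesOf σ = mkLeaves (shapeOf σ) (λ y → rat σ leafValue (y ∷ [])) (λ y → rat σ leafWeight (y ∷ []))

record Grid : Set where
  constructor mkGrid
  field
    lvs : Leaves
    ρ : ℚ
    K : ℕ
    r : ℕ → ℚ
  open Leaves lvs public

gridOf : Store → Grid
gridOf σ = mkGrid (leavesOf σ) (rat σ ratio []) (nat σ gridSize []) (λ k → rat σ grid (k ∷ []))

-- ok x c ≥ 1 if grid index c is attained at node x; then co x c is the least
-- weight found, and lc x c, rc x c are the indices chosen at the children.
record Tables : Set where
  constructor mkTables
  field
    ok : ℕ → ℕ → ℕ
    co : ℕ → ℕ → ℚ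
    lc rc : ℕ → ℕ → ℕ

tablesOf : Store → Tables
tablesOf σ = mkTables (λ x c → nat σ reachable (x ∷ c ∷ [])) (λ x c → rat σ cost (x ∷ c ∷ []))
  (λ x c → nat σ leftChoice (x ∷ c ∷ [])) (λ x c → nat σ rightChoice (x ∷ c ∷ []))

-- What a correct table must satisfy

module Spec (ε : ℚ) (G : Grid) where
  open Grid G

  InCategory : ℕ → Set
  InCategory x = M ℕ.≤ x × x ℕ.+ 1 ℕ.≤ 2 ℕ.* M

  -- An implication written with negations and conjunctions, to agree with the test language;
  -- decidability of the bounds recovers them later.
  Fits : ℕ → ℕ → Set
  Fits x c = ¬ (InCategory x × ¬ (lo (x ℕ.∸ M) ≤ (1ℚ + ε) * r c × r c ≤ up (x ℕ.∸ M)))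

  Candidate : Tables → ℕ → ℕ → ℕ → ℕ → Set
  Candidate t x a b c = 1 ℕ.≤ ok (2 ℕ.* x) a × 1 ℕ.≤ ok (2 ℕ.* x ℕ.+ 1) b ×
    r c ≤ r a + r b × r a + r b ≤ ρ * r c × Fits x c
    where open Tables t

  SoundAt : Tables → ℕ → Set
  SoundAt t x = ∀ c → 1 ℕ.≤ ok x c → Candidate t x (lc x c) (rc x c) c ×
    co x c ≡ co (2 ℕ.* x) (lc x c) + co (2 ℕ.* x ℕ.+ 1) (rc x c)
    where open Tables t

  Within : Tables → ℕ → ℕ → ℚ → Set
  Within t x c q = 1 ℕ.≤ Tables.ok t x c × Tables.co t x c ≤ q

  -- D holds of the triples (a , b , c) that the merging loops have already treated.
  CompleteOn : (ℕ → ℕ → ℕ → Set) → Tables → ℕ → Set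
  CompleteOn D t x = ∀ a b c → a ℕ.< K → b ℕ.< K → c ℕ.< K → D a b c → Candidate t x a b c →
    Within t x c (co (2 ℕ.* x) a + co (2 ℕ.* x ℕ.+ 1) b)
    where open Tables t

  CompleteAt : Tables → ℕ → Set
  CompleteAt = CompleteOn (λ _ _ _ → ⊤)

-- Merging the tables of two children

-- Tables are functions, so their agreement is expressed pointwise.
SameEntry : Tables → Tables → ℕ → ℕ → Set
SameEntry t t′ x c = ok t′ x c ≡ ok t x c × co t′ x c ≡ co t x c × lc t′ x c ≡ lc t x c × rc t′ x c ≡ rc t x c
  where open Tables

SameRow : Tables → Tables → ℕ → Set
SameRow t t′ x = ∀ c → SameEntry t t′ x c

sameEntry-trans : ∀ {t t′ t″ x c} → SameEntry t t′ x c → SameEntry t′ t″ x c → SameEntry t t″ x c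
sameEntry-trans (a , b , c , d) (a′ , b′ , c′ , d′) = trans a′ a , trans b′ b , trans c′ c , trans d′ d

sameEntry-sym : ∀ {t t′ x c} → SameEntry t t′ x c → SameEntry t′ t x c
sameEntry-sym (a , b , c , d) = sym a , sym b , sym c , sym d

record Improved (t t′ : Tables) (x a b c : ℕ) : Set where
  open Tables
  field
    ok≡ : ok t′ x c ≡ 1
    co≡ : co t′ x c ≡ co t (2 ℕ.* x) a + co t (2 ℕ.* x ℕ.+ 1) b
    lc≡ : lc t′ x c ≡ a
    rc≡ : rc t′ x c ≡ b
    others : ∀ y d → ¬ (y ≡ x × d ≡ c) → SameEntry t t′ y d

-- Node 0 would be its own left child; heap numbers start at 1.
2x≢x : ∀ {x} → 1 ℕ.≤ x → 2 ℕ.* x ≢ x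
2x≢x {suc x} _ eq = ℕ.m≢1+n+m (suc x) {x} (trans (sym eq) (cong (λ z → suc x ℕ.+ z) (ℕ.+-identityʳ (suc x))))

2x+1≢x : ∀ {x} → 2 ℕ.* x ℕ.+ 1 ≢ x
2x+1≢x {x} eq = ℕ.<-irrefl (sym eq) (subst (x ℕ.<_) (ℕ.+-comm 1 (2 ℕ.* x)) (ℕ.s≤s (ℕ.m≤m+n x (x ℕ.+ 0))))

2m<2n⇒2m+1<2n : ∀ {m n} → m ℕ.< n → 2 ℕ.* m ℕ.+ 1 ℕ.< 2 ℕ.* n
2m<2n⇒2m+1<2n {m} {n} m<n = begin-strict
  2 ℕ.* m ℕ.+ 1 <⟨ ℕ.+-monoʳ-< (2 ℕ.* m) (ℕ.n<1+n 1) ⟩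
  2 ℕ.* m ℕ.+ 2 ≡⟨ ℕ.+-comm _ 2 ⟩
  2 ℕ.+ 2 ℕ.* m ≡⟨ ℕ.*-suc 2 m ⟨
  2 ℕ.* suc m ≤⟨ ℕ.*-monoʳ-≤ 2 m<n ⟩
  2 ℕ.* n ∎
  where open ℕ.≤-Reasoning

module _ (ε : ℚ) (G : Grid) where
  open Grid G using (K)
  open Spec ε G

  candidate-resp : ∀ {t t′ x a b c} → SameRow t t′ (2 ℕ.* x) → SameRow t t′ (2 ℕ.* x ℕ.+ 1) →
                   Candidate t x a b c → Candidate t′ x a b c
  candidate-resp {a = a} {b} s₁ s₂ (h₁ , h₂ , h) =
    subst (1 ℕ.≤_) (sym (proj₁ (s₁ a))) h₁ , subst (1 ℕ.≤_) (sym (proj₁ (s₂ b))) h₂ , h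

  soundAt-resp : ∀ {t t′ x} → SameRow t t′ x → SameRow t t′ (2 ℕ.* x) → SameRow t t′ (2 ℕ.* x ℕ.+ 1) →
                 SoundAt t x → SoundAt t′ x
  soundAt-resp {t} {t′} {x} s s₁ s₂ sound c h with s c
  ... | e₁ , e₂ , e₃ , e₄ with sound c (subst (1 ℕ.≤_) e₁ h)
  ...   | cand , eq rewrite e₃ | e₄ =
    candidate-resp {t} {t′} s₁ s₂ cand ,
    trans e₂ (trans eq (sym (cong₂ _+_ (proj₁ (proj₂ (s₁ _))) (proj₁ (proj₂ (s₂ _))))))

  completeOn-resp : ∀ {D t t′ x} → SameRow t t′ x → SameRow t t′ (2 ℕ.* x) → SameRow t t′ (2 ℕ.* x ℕ.+ 1) →
                    CompleteOn D t x → CompleteOn D t′ x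
  completeOn-resp {D} {t} {t′} {x} s s₁ s₂ comp a b c a< b< c< d cand
    with comp a b c a< b< c< d (candidate-resp {t′} {t} (λ e → sameEntry-sym {t} {t′} (s₁ e)) (λ e → sameEntry-sym {t} {t′} (s₂ e)) cand)
  ... | h , le = subst (1 ℕ.≤_) (sym (proj₁ (s c))) h ,
    subst₂ _≤_ (sym (proj₁ (proj₂ (s c)))) (sym (cong₂ _+_ (proj₁ (proj₂ (s₁ a))) (proj₁ (proj₂ (s₂ b))))) le

  module _ {t t′ : Tables} {x a b c : ℕ} (1≤x : 1 ℕ.≤ x) (imp : Improved t t′ x a b c)
           (cand : Candidate t x a b c) where
    open Improved imp
    open Tables

    private
      row₁ : SameRow t t′ (2 ℕ.* x)
      row₁ d = others (2 ℕ.* x) d (λ p → 2x≢x 1≤x (proj₁ p))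

      row₂ : SameRow t t′ (2 ℕ.* x ℕ.+ 1)
      row₂ d = others (2 ℕ.* x ℕ.+ 1) d (λ p → 2x+1≢x {x} (proj₁ p))

    -- A write to row x leaves the rows of both children alone, so old entries stay justified, and
    -- the new one is justified by `cand`.
    improved-sound : SoundAt t x → SoundAt t′ x
    improved-sound sound d h with d ℕ.≟ c
    ... | yes refl rewrite lc≡ | rc≡ = candidate-resp {t} {t′} row₁ row₂ cand ,
      trans co≡ (sym (cong₂ _+_ (proj₁ (proj₂ (row₁ a))) (proj₁ (proj₂ (row₂ b)))))
    ... | no d≢c with others x d (λ p → d≢c (proj₂ p))
    ...   | e₁ , e₂ , e₃ , e₄ with sound d (subst (1 ℕ.≤_) e₁ h)
    ...     | cand′ , eq rewrite e₃ | e₄ = candidate-resp {t} {t′} row₁ row₂ cand′ ,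
      trans e₂ (trans eq (sym (cong₂ _+_ (proj₁ (proj₂ (row₁ _))) (proj₁ (proj₂ (row₂ _))))))

    -- An overwritten entry can only have become cheaper: `better` excludes that it was filled at no
    -- greater cost. Triples treated earlier therefore stay dominated.
    improved-complete : ∀ {D D′ : ℕ → ℕ → ℕ → Set} →
      (∀ {a′ b′ c′} → D′ a′ b′ c′ → D a′ b′ c′ ⊎ (a′ ≡ a × b′ ≡ b × c′ ≡ c)) →
      ¬ Within t x c (co t (2 ℕ.* x) a + co t (2 ℕ.* x ℕ.+ 1) b) →
      CompleteOn D t x → CompleteOn D′ t′ x
    improved-complete grow better comp a′ b′ c′ a< b< c< d cand′
      rewrite proj₁ (proj₂ (row₁ a′)) | proj₁ (proj₂ (row₂ b′)) with c′ ℕ.≟ c | grow d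
    ... | no c′≢c | inj₂ (_ , _ , c′≡c) = ⊥-elim (c′≢c c′≡c)
    ... | yes refl | inj₂ (refl , refl , _) = subst (1 ℕ.≤_) (sym ok≡) ℕ.≤-refl , ℚ.≤-reflexive co≡
    ... | no c′≢c | inj₁ d′ with others x c′ (λ p → c′≢c (proj₂ p)) | comp a′ b′ c′ a< b< c< d′ (back cand′)
      where back = candidate-resp {t′} {t} (λ e → sameEntry-sym {t} {t′} (row₁ e)) (λ e → sameEntry-sym {t} {t′} (row₂ e))
    ...   | e₁ , e₂ , _ | h , le = subst (1 ℕ.≤_) (sym e₁) h , subst (_≤ _) (sym e₂) le
    improved-complete grow better comp a′ b′ c′ a< b< c< d cand′
      | yes refl | inj₁ d′ with comp a′ b′ c′ a< b< c< d′ (back cand′)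
      where back = candidate-resp {t′} {t} (λ e → sameEntry-sym {t} {t′} (row₁ e)) (λ e → sameEntry-sym {t} {t′} (row₂ e))
    ...   | h , le with ℚ.≤-total (co t (2 ℕ.* x) a + co t (2 ℕ.* x ℕ.+ 1) b) (co t x c)
    ...     | inj₁ new≤ = subst (1 ℕ.≤_) (sym ok≡) ℕ.≤-refl , subst (_≤ co t (2 ℕ.* x) a′ + co t (2 ℕ.* x ℕ.+ 1) b′) (sym co≡) (ℚ.≤-trans new≤ le)
    ...     | inj₂ ≤new = ⊥-elim (better (h , ≤new))

pair-injective : ∀ {y x d c : ℕ} → y ∷ d ∷ [] ≡ x ∷ c ∷ [] → y ≡ x × d ≡ c
pair-injective eq = ∷-injectiveˡ eq , ∷-injectiveˡ (∷-injectiveʳ eq)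

-- Lexicographic order: the pairs that a double loop has treated when its counters stand at i and j.
Before : ℕ → ℕ → ℕ → ℕ → Set
Before i j i′ j′ = i′ ℕ.< i ⊎ (i′ ≡ i × j′ ℕ.< j)

before-suc : ∀ {i j i′ j′} → Before i (suc j) i′ j′ → Before i j i′ j′ ⊎ (i′ ≡ i × j′ ≡ j)
before-suc (inj₁ p) = inj₁ (inj₁ p)
before-suc (inj₂ (p , j<)) with ℕ.m<1+n⇒m<n∨m≡n j<
... | inj₁ q = inj₁ (inj₂ (p , q))
... | inj₂ q = inj₂ (p , q)

before-irrefl : ∀ {i j i′ j′} → i′ ≡ i × j′ ≡ j → ¬ Before i j i′ j′
before-irrefl (refl , refl) (inj₁ i<i) = ℕ.<-irrefl refl i<i
before-irrefl (refl , refl) (inj₂ (_ , j<j)) = ℕ.<-irrefl refl j<j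

before-row : ∀ {i j i′ j′} → j′ ℕ.< j → i′ ℕ.< suc i → Before i j i′ j′
before-row j< i< with ℕ.m<1+n⇒m<n∨m≡n i<
... | inj₁ p = inj₁ p
... | inj₂ p = inj₂ (p , j<)

before-start : ∀ {i i′ j′} → Before i 0 i′ j′ → i′ ℕ.< i
before-start (inj₁ p) = p

Candidates : Set₁
Candidates = ℕ → ℕ → ℕ → Set


module _ (ε : ℚ) (G : Grid) (t₀ : Tables) (x : ℕ) (1≤x : 1 ℕ.≤ x) (k : ℕ) where
  open Grid G using (K)
  open Spec ε G

  record MergingView (D : Candidates) (g : Grid) (n i : ℕ) (t : Tables) : Set where
    constructor mkMerging
    field
      grid≡ : g ≡ G
      node≡ : n ≡ x
      -- The counter of the enclosing loop over the nodes, which its body has to preserve.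
      item≡ : i ≡ k
      frame : ∀ y → y ≢ x → SameRow t₀ t y
      sound : SoundAt t x
      complete : CompleteOn D t x

  Merging : Candidates → Store → Set
  Merging D σ = MergingView D (gridOf σ) (nat σ node []) (nat σ item []) (tablesOf σ)

  merging-weaken : ∀ {D D′ : Candidates} {g n i t} →
    (∀ {a b c} → a ℕ.< K → b ℕ.< K → c ℕ.< K → D′ a b c → D a b c) → MergingView D g n i t → MergingView D′ g n i t
  merging-weaken f (mkMerging g n i s so co) =
    mkMerging g n i s so λ a b c a< b< c< d → co a b c a< b< c< (f a< b< c< d)

  -- `grow` says that D′ exceeds D by the current triple at most, so one proof serves the innermost
  -- loop whatever the outer loops have done.
  exec-improve : ∀ {σ a b c} {D D′ : Candidates} →
    (∀ {a′ b′ c′} → D′ a′ b′ c′ → D a′ b′ c′ ⊎ (a′ ≡ a × b′ ≡ b × c′ ≡ c)) →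
    a ℕ.< K → b ℕ.< K → c ℕ.< K →
    Merging D σ → nat σ left [] ≡ a → nat σ right [] ≡ b → nat σ merged [] ≡ c →
    Exec (improve ε) σ (λ τ → nat τ merged [] ≡ c × Merging D′ τ × nat τ left [] ≡ a × nat τ right [] ≡ b) 150
  exec-improve {σ} {a} {b} {c} {D} {D′} grow a<K b<K c<K (mkMerging refl refl refl same sound comp) refl refl refl =
    exec-weaken (exec-if
      (λ where
        (cand , better) → exec-assignₙ-seq (exec-assignᵣ-seq (exec-assignₙ-seq (exec-assignₙ {σ₃} (refl , mkMerging refl refl refl
          (λ y y≢x d → sameEntry-trans {t₀} {t} {t′} (same y y≢x d) (others y d (λ p → y≢x (proj₁ p))))
          (improved-sound ε G {t} {t′} 1≤x imp cand sound)
          (improved-complete ε G {t} {t′} 1≤x imp cand grow better comp) , refl , refl)))))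
      (λ ¬both → exec-weaken (exec-skip {Q = Q} (refl , mkMerging refl refl refl same sound (keep ¬both) , refl , refl)) id ℕ.z≤n))
      -- 150 is a generous round bound; the actual cost is a closed numeral and the comparison is
      -- computed.
      id (ℕ.≤ᵇ⇒≤ _ _ _)
    where
    t = tablesOf σ
    σ₁ = assignedₙ σ reachable (! node ∷ ! merged ∷ []) (lit 1)
    σ₂ = assignedᵣ σ₁ cost (! node ∷ ! merged ∷ []) sumOfCosts
    σ₃ = assignedₙ σ₂ leftChoice (! node ∷ ! merged ∷ []) (! left)
    Q = λ τ → nat τ merged [] ≡ c × Merging D′ τ × nat τ left [] ≡ a × nat τ right [] ≡ b
    σ₄ = assignedₙ σ₃ rightChoice (! node ∷ ! merged ∷ []) (! right)
    t′ = tablesOf σ₄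
    others : ∀ y d → ¬ (y ≡ x × d ≡ c) → SameEntry t t′ y d
    others y d ne =
      write-miss (nat σ) reachable 1 ne′ , write-miss (rat σ) cost (evalQ σ sumOfCosts) ne′ ,
      write-miss (nat σ) leftChoice a ne′ , write-miss (nat σ) rightChoice b ne′
      where ne′ = ne ∘ pair-injective
    imp : Improved t t′ x a b c
    imp = record
      { ok≡ = write-hit (nat σ) reachable (x ∷ c ∷ []) 1
      ; co≡ = write-hit (rat σ) cost (x ∷ c ∷ []) (evalQ σ sumOfCosts)
      ; lc≡ = write-hit (nat σ) leftChoice (x ∷ c ∷ []) a
      ; rc≡ = write-hit (nat σ) rightChoice (x ∷ c ∷ []) b
      ; others = others }
    keep : ¬ Holds σ (candidate ε & improvable) → CompleteOn D′ t x
    keep ¬h a′ b′ c′ a< b< c< d cand with grow d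
    ... | inj₁ d′ = comp a′ b′ c′ a< b< c< d′ cand
    ... | inj₂ (refl , refl , refl) =
      -- With `cand` at hand, the failed conjunction leaves a double negation of `Within`, which is
      -- decidable.
      decidable-stable (holds? σ ((lit 1 ≤ₙ (reachable ⟦ ! node ∷ ! merged ∷ [] ⟧)) &
                  ((cost ⟦ ! node ∷ ! merged ∷ [] ⟧) ≤ᵣ sumOfCosts))) (λ better → ¬h (cand , better))

  Done₁ : ℕ → Candidates
  Done₁ a a′ b′ c′ = a′ ℕ.< a

  Done₂ : ℕ → ℕ → Candidates
  Done₂ a b a′ b′ c′ = Before a b a′ b′

  Done₃ : ℕ → ℕ → ℕ → Candidates
  Done₃ a b c a′ b′ c′ = Done₂ a b a′ b′ c′ ⊎ (a′ ≡ a × b′ ≡ b × c′ ℕ.< c)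

  sizeTest : ∀ {D g n i t} → MergingView D g n i t → Grid.K g ≡ K
  sizeTest (mkMerging refl _ _ _ _ _) = refl

  mergeTime : ℕ
  mergeTime = forTime (! gridSize) K (forTime (! gridSize) K (forTime (! gridSize) K 150))

  -- Row x is empty at the start, so soundness is vacuous there, and completeness is claimed for no
  -- triple yet.
  exec-merge : ∀ {σ} → gridOf σ ≡ G → nat σ node [] ≡ x → nat σ item [] ≡ k →
    (∀ y → SameRow t₀ (tablesOf σ) y) → (∀ c → Tables.ok t₀ x c ≡ 0) →
    Exec (merge ε) σ (Merging (Done₁ K)) mergeTime
  exec-merge {σ} g n i same empty =
    exec-for left (! gridSize) _ (λ a → Merging (Done₁ a)) K _ (λ _ _ → sizeTest)
      (λ a σ a<K inv eqa → exec-weaken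
        (exec-for right (! gridSize) _ (λ b σ → Merging (Done₂ a b) σ × nat σ left [] ≡ a) K _ (λ _ _ → sizeTest ∘ proj₁)
          (λ b σ b<K (inv , eqa) eqb → exec-weaken
            (exec-for merged (! gridSize) _ (λ c σ → Merging (Done₃ a b c) σ × nat σ left [] ≡ a × nat σ right [] ≡ b) K 150
              (λ _ _ → sizeTest ∘ proj₁)
              (λ c σ c<K (inv , eqa , eqb) eqc → exec-improve grow₃ a<K b<K c<K inv eqa eqb eqc)
              (merging-weaken (λ _ _ _ → λ { (inj₁ d) → d }) inv , eqa , eqb))
            (λ { (inv , eqa , eqb) → eqb , merging-weaken start₂ inv , eqa }) ℕ.≤-refl)
          (merging-weaken (λ _ _ _ → before-start) inv , eqa))
        (λ { (inv , eqa) → eqa , merging-weaken start₁ inv }) ℕ.≤-refl)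
      (mkMerging g n i (λ y _ → same y)
       (λ c h → ⊥-elim (ℕ.<⇒≱ h (ℕ.≤-reflexive (trans (proj₁ (same x c)) (empty c)))))
       λ _ _ _ _ _ _ ())
    where
    grow₃ : ∀ {a b c a′ b′ c′} → Done₃ a b (suc c) a′ b′ c′ → Done₃ a b c a′ b′ c′ ⊎ (a′ ≡ a × b′ ≡ b × c′ ≡ c)
    grow₃ (inj₁ d) = inj₁ (inj₁ d)
    grow₃ (inj₂ (p , q , c<)) with ℕ.m<1+n⇒m<n∨m≡n c<
    ... | inj₁ c< = inj₁ (inj₂ (p , q , c<))
    ... | inj₂ c≡ = inj₂ (p , q , c≡)
    start₂ : ∀ {a b a′ b′ c′} → a′ ℕ.< K → b′ ℕ.< K → c′ ℕ.< K → Done₂ a (suc b) a′ b′ c′ → Done₃ a b K a′ b′ c′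
    start₂ _ _ c<K d with before-suc d
    ... | inj₁ d′ = inj₁ d′
    ... | inj₂ (p , q) = inj₂ (p , q , c<K)
    start₁ : ∀ {a a′ b′ c′} → a′ ℕ.< K → b′ ℕ.< K → c′ ℕ.< K → Done₁ (suc a) a′ b′ c′ → Done₂ a K a′ b′ c′
    start₁ _ b<K _ = before-row b<K

m≤2m : ∀ m → m ℕ.≤ 2 ℕ.* m
m≤2m m = ℕ.m≤m+n m (m ℕ.+ 0)

m≤2m+1 : ∀ m → m ℕ.≤ 2 ℕ.* m ℕ.+ 1
m≤2m+1 m = ℕ.≤-trans (m≤2m m) (ℕ.m≤m+n (2 ℕ.* m) 1)

module _ (ε : ℚ) (G : Grid) (t₀ : Tables) where
  open Grid G using (K; L)
  open Spec ε G

  -- After k rounds the finished inner nodes are those with L - k ≤ x < L; sums are used to avoid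
  -- truncated subtraction.
  record SolvedFrom (k : ℕ) (g : Grid) (t : Tables) : Set where
    constructor mkSolved
    field
      grid≡  : g ≡ G
      frame  : ∀ y → L ℕ.≤ y → SameRow t₀ t y
      empty  : ∀ y c → y ℕ.+ k ℕ.< L → Tables.ok t y c ≡ 0
      solved : ∀ x → x ℕ.< L → L ℕ.≤ x ℕ.+ k → SoundAt t x × CompleteAt t x

  stepTime mergeAllTime : ℕ
  stepTime     = 6 ℕ.+ forTime (! gridSize) K (forTime (! gridSize) K (forTime (! gridSize) K 150))
  mergeAllTime = forTime (! leaves ⊖ lit 1) (L ℕ.∸ 1) stepTime

  exec-mergeAll : ∀ {σ} → gridOf σ ≡ G → (∀ y → SameRow t₀ (tablesOf σ) y) →
    (∀ y c → y ℕ.< L → Tables.ok t₀ y c ≡ 0) →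
    Exec (mergeAll ε) σ (λ τ → SolvedFrom (L ℕ.∸ 1) (gridOf τ) (tablesOf τ)) mergeAllTime
  exec-mergeAll {σ} g same empty =
    exec-for item (! leaves ⊖ lit 1) _ (λ k σ → SolvedFrom k (gridOf σ) (tablesOf σ)) (L ℕ.∸ 1) stepTime
      (λ { k σ (mkSolved refl _ _ _) → refl }) step
      (mkSolved g (λ y _ → same y) (λ y c y<L → trans (proj₁ (same y c)) (empty y c (subst (ℕ._< L) (ℕ.+-identityʳ y) y<L)))
        λ x x<L L≤x → ⊥-elim (ℕ.<⇒≱ x<L (subst (L ℕ.≤_) (ℕ.+-identityʳ x) L≤x)))
    where
    step : ∀ k σ → k ℕ.< L ℕ.∸ 1 → SolvedFrom k (gridOf σ) (tablesOf σ) → nat σ item [] ≡ k →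
      Exec ((node ⟦ [] ⟧≔ₙ (! leaves ⊖ (! item ⊕ lit 1))) ⨾ merge ε) σ
        (λ τ → nat τ item [] ≡ k × SolvedFrom (suc k) (gridOf τ) (tablesOf τ)) stepTime
    step k σ k<L-1 (mkSolved refl frame empty solved) refl = exec-assignₙ-seq
      (exec-weaken (exec-merge ε G (tablesOf σ) x 1≤x k refl refl refl (λ y c → refl , refl , refl , refl)
        (λ c → empty x c (ℕ.≤-reflexive (trans (sym (ℕ.+-suc x k)) x+1+k≡L))))
        (λ {τ} → post {τ}) ℕ.≤-refl)
      where
      x = L ℕ.∸ (k ℕ.+ 1)
      1+k<L : suc k ℕ.< L
      1+k<L = ℕ.≤-trans (ℕ.s≤s k<L-1) (ℕ.≤-reflexive (ℕ.m+[n∸m]≡n {1} {L} (ℕ.≤-trans (ℕ.s≤s ℕ.z≤n) (ℕ.≤-trans k<L-1 (ℕ.m∸n≤m L 1)))))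
      x+1+k≡L : x ℕ.+ suc k ≡ L
      x+1+k≡L = trans (cong (x ℕ.+_) (ℕ.+-comm 1 k)) (ℕ.m∸n+n≡m (subst (ℕ._≤ L) (ℕ.+-comm 1 k) (ℕ.<⇒≤ 1+k<L)))
      1≤x : 1 ℕ.≤ x
      1≤x = ℕ.m<n⇒0<n∸m (subst (ℕ._< L) (ℕ.+-comm 1 k) 1+k<L)
      post : ∀ {τ} → Merging ε G (tablesOf σ) x 1≤x k (Done₁ ε G (tablesOf σ) x 1≤x k K) τ →
        nat τ item [] ≡ k × SolvedFrom (suc k) (gridOf τ) (tablesOf τ)
      post {τ} (mkMerging g n i fr so co) = i , mkSolved g
        (λ y L≤y c → sameEntry-trans {t₀} {tablesOf σ} {tablesOf τ} (frame y L≤y c)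
           (fr y (λ y≡x → ℕ.<⇒≱ x<L (subst (L ℕ.≤_) y≡x L≤y)) c))
        (λ y c y+1+k<L → trans (proj₁ (fr y (λ y≡x → ℕ.<-irrefl (trans (cong (ℕ._+ suc k) y≡x) x+1+k≡L) y+1+k<L) c))
           (empty y c (ℕ.≤-trans (ℕ.s≤s (ℕ.+-monoʳ-≤ y (ℕ.n≤1+n k))) y+1+k<L)))
        local
        where
        x<L : x ℕ.< L
        x<L = ℕ.≤-trans (ℕ.m<m+n x (ℕ.s≤s ℕ.z≤n)) (ℕ.≤-reflexive x+1+k≡L)
        local : ∀ y → y ℕ.< L → L ℕ.≤ y ℕ.+ suc k → SoundAt (tablesOf τ) y × CompleteAt (tablesOf τ) y
        local y y<L L≤ with y ℕ.≟ x
        ... | yes refl = so , λ a b c a< b< c< _ → co a b c a< b< c< a<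
        -- A node finished earlier has a larger number than x, and so have its children: the merge
        -- at x touches none of these three rows.
        ... | no y≢x = soundAt-resp ε G {tablesOf σ} {tablesOf τ} s₀ s₁ s₂ (proj₁ old) ,
                       completeOn-resp ε G {λ _ _ _ → ⊤} {tablesOf σ} {tablesOf τ} s₀ s₁ s₂ (proj₂ old)
          where
          x<y : x ℕ.< y
          x<y = ℕ.≤∧≢⇒< (ℕ.+-cancelʳ-≤ (suc k) x y (ℕ.≤-trans (ℕ.≤-reflexive x+1+k≡L) L≤)) (≢-sym y≢x)
          old = solved y y<L (ℕ.≤-trans (ℕ.≤-reflexive (sym x+1+k≡L)) (subst (ℕ._≤ y ℕ.+ k) (sym (ℕ.+-suc x k)) (ℕ.+-monoˡ-≤ k x<y)))
          s₀ = fr y y≢x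
          s₁ = fr (2 ℕ.* y) (λ eq → ℕ.<⇒≢ (ℕ.<-≤-trans x<y (m≤2m y)) (sym eq))
          s₂ = fr (2 ℕ.* y ℕ.+ 1) (λ eq → ℕ.<⇒≢ (ℕ.<-≤-trans x<y (m≤2m+1 y)) (sym eq))

-- Tables of the leaves

module _ (G : Grid) where
  open Grid G using (K; L; lv; lw; r; ρ)

  Rounded : ℕ → ℕ → Set
  Rounded y c = 1 ℕ.≤ c × r c ≤ lv y × lv y ≤ ρ * r c

  LeafSound : Tables → ℕ → Set
  LeafSound t y = ∀ c → 1 ℕ.≤ ok y c → (c ≡ 0 × co y c ≡ 0ℚ) ⊎ (Rounded y c × co y c ≡ lw y)
    where open Tables t

  LeafComplete : Tables → ℕ → ℕ → Set
  LeafComplete t y k = 1 ℕ.≤ ok y 0 × (∀ c → c ℕ.< k → Rounded y c → 1 ℕ.≤ ok y c)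
    where open Tables t

  leaf-resp : ∀ {t t′ y k} → SameRow t t′ y → LeafSound t y × LeafComplete t y k → LeafSound t′ y × LeafComplete t′ y k
  leaf-resp {t} {t′} {y} {k} same (sound , ok₀ , complete) =
    sound′ , ok-resp 0 ok₀ , λ c c<k rounded → ok-resp c (complete c c<k rounded)
    where
    ok-resp : ∀ c → 1 ℕ.≤ Tables.ok t y c → 1 ℕ.≤ Tables.ok t′ y c
    ok-resp c = subst (1 ℕ.≤_) (sym (proj₁ (same c)))
    sound′ : LeafSound t′ y
    sound′ c h with same c
    ... | e₁ , e₂ , _ with sound c (subst (1 ℕ.≤_) e₁ h)
    ...   | inj₁ (p , q) = inj₁ (p , trans e₂ q)
    ...   | inj₂ (p , q) = inj₂ (p , trans e₂ q)

  module _ (t₀ : Tables) (y i : ℕ) where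

    record Filling (k : ℕ) (g : Grid) (n it : ℕ) (t : Tables) : Set where
      constructor mkFilling
      field
        grid≡ : g ≡ G
        node≡ : n ≡ y
        item≡ : it ≡ i
        frame : ∀ x → x ≢ y → SameRow t₀ t x
        sound : LeafSound t y
        complete : LeafComplete t y k

    FillingIn : ℕ → Store → Set
    FillingIn k σ = Filling k (gridOf σ) (nat σ node []) (nat σ item []) (tablesOf σ)

    enterTest : Test
    enterTest = (lit 1 ≤ₙ ! merged) & (((grid ⟦ ! merged ∷ [] ⟧) ≤ᵣ (leafValue ⟦ ! node ∷ [] ⟧)) &
        ((leafValue ⟦ ! node ∷ [] ⟧) ≤ᵣ ((ratio ⟦ [] ⟧) ⊠ (grid ⟦ ! merged ∷ [] ⟧))))

    exec-enter : ∀ k σ → k ℕ.< K → FillingIn k σ → nat σ merged [] ≡ k →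
      Exec (if′ enterTest
            then′ ((reachable ⟦ ! node ∷ ! merged ∷ [] ⟧≔ₙ lit 1) ⨾
                   (cost ⟦ ! node ∷ ! merged ∷ [] ⟧≔ᵣ (leafWeight ⟦ ! node ∷ [] ⟧)))
            else′ skip) σ (λ τ → nat τ merged [] ≡ k × FillingIn (suc k) τ) 40
    exec-enter k σ k<K (mkFilling refl refl refl frame sound (ok₀ , complete)) refl =
      exec-weaken (exec-if
        (λ rounded → exec-assignₙ-seq (exec-assignᵣ {σ₁} (refl , mkFilling refl refl refl
          (λ x x≢y c → sameEntry-trans {t₀} {t} {t′} (frame x x≢y c) (others x c (x≢y ∘ proj₁)))
          (sound′ rounded) (ok-mono ok₀ , complete′))))
        (λ ¬rounded → exec-weaken (exec-skip {Q = Q} (refl , mkFilling refl refl refl frame sound (ok₀ , keep ¬rounded))) id ℕ.z≤n))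
        id (ℕ.≤ᵇ⇒≤ _ _ _)
      where
      Q : Store → Set
      Q τ = nat τ merged [] ≡ k × FillingIn (suc k) τ
      σ₁ = assignedₙ σ reachable (! node ∷ ! merged ∷ []) (lit 1)
      σ₂ = assignedᵣ σ₁ cost (! node ∷ ! merged ∷ []) (leafWeight ⟦ ! node ∷ [] ⟧)
      t = tablesOf σ
      t′ = tablesOf σ₂
      open Tables
      others : ∀ x c → ¬ (x ≡ y × c ≡ k) → SameEntry t t′ x c
      others x c ne = write-miss (nat σ) reachable 1 (ne ∘ pair-injective) ,
        write-miss (rat σ) cost (lw y) (ne ∘ pair-injective) , refl , refl
      ok-new : 1 ℕ.≤ ok t′ y k
      ok-new = ℕ.≤-reflexive (sym (write-hit (nat σ) reachable (y ∷ k ∷ []) 1))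
      ok-mono : ∀ {c} → 1 ℕ.≤ ok t y c → 1 ℕ.≤ ok t′ y c
      ok-mono {c} h with c ℕ.≟ k
      ... | yes refl = ok-new
      ... | no c≢k = subst (1 ℕ.≤_) (sym (proj₁ (others y c (c≢k ∘ proj₂)))) h
      sound′ : Rounded y k → LeafSound t′ y
      sound′ rounded c h with c ℕ.≟ k
      ... | yes refl = inj₂ (rounded , write-hit (rat σ) cost (y ∷ k ∷ []) (lw y))
      ... | no c≢k with others y c (c≢k ∘ proj₂)
      ...   | e₁ , e₂ , _ with sound c (subst (1 ℕ.≤_) e₁ h)
      ...     | inj₁ (p , q) = inj₁ (p , trans e₂ q)
      ...     | inj₂ (p , q) = inj₂ (p , trans e₂ q)
      complete′ : ∀ c → c ℕ.< suc k → Rounded y c → 1 ℕ.≤ ok t′ y c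
      complete′ c c< rounded with ℕ.m<1+n⇒m<n∨m≡n c<
      ... | inj₁ c<k = ok-mono (complete c c<k rounded)
      ... | inj₂ refl = ok-new
      keep : ¬ Rounded y k → ∀ c → c ℕ.< suc k → Rounded y c → 1 ℕ.≤ ok t y c
      keep ¬rounded c c< rounded with ℕ.m<1+n⇒m<n∨m≡n c<
      ... | inj₁ c<k = complete c c<k rounded
      ... | inj₂ refl = ⊥-elim (¬rounded rounded)

  record FilledTo (k : ℕ) (g : Grid) (t : Tables) : Set where
    constructor mkFilled
    field
      grid≡  : g ≡ G
      empty  : ∀ y c → y ℕ.< L ⊎ L ℕ.+ k ℕ.≤ y → Tables.ok t y c ≡ 0
      filled : ∀ y → L ℕ.≤ y → y ℕ.< L ℕ.+ k → LeafSound t y × LeafComplete t y K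

  enterStepTime enterTime : ℕ
  enterStepTime = 4 ℕ.+ (4 ℕ.+ (4 ℕ.+ forTime (! gridSize) K 40))
  enterTime = forTime (! leaves) L enterStepTime

  exec-enterLeaves : ∀ {σ} → gridOf σ ≡ G → (∀ y c → Tables.ok (tablesOf σ) y c ≡ 0) →
    Exec enterLeaves σ (λ τ → FilledTo L (gridOf τ) (tablesOf τ)) enterTime
  exec-enterLeaves {σ} g empty =
    exec-for item (! leaves) _ (λ k σ → FilledTo k (gridOf σ) (tablesOf σ)) L enterStepTime
      (λ { k σ (mkFilled refl _ _) → refl }) step
      (mkFilled g (λ y c _ → empty y c) (λ y L≤y y<L → ⊥-elim (ℕ.<⇒≱ y<L (subst (ℕ._≤ y) (sym (ℕ.+-identityʳ L)) L≤y))))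
    where
    step : ∀ k σ → k ℕ.< L → FilledTo k (gridOf σ) (tablesOf σ) → nat σ item [] ≡ k →
      Exec _ σ (λ τ → nat τ item [] ≡ k × FilledTo (suc k) (gridOf τ) (tablesOf τ)) enterStepTime
    step k σ k<L (mkFilled refl empty filled) refl =
      exec-assignₙ-seq (exec-assignₙ-seq (exec-assignᵣ-seq
        (exec-weaken
          (exec-for merged (! gridSize) _ (FillingIn t y k) K 40
            (λ k σ inv → cong Grid.K (Filling.grid≡ inv))
            (exec-enter t y k)
            (mkFilling refl refl refl
              (λ x x≢y c → others x c (x≢y ∘ proj₁))
              sound
              (subst (1 ℕ.≤_) (sym (write-hit (nat σ) reachable (y ∷ 0 ∷ []) 1)) ℕ.≤-refl , λ _ ())))
          (λ {τ} → post {τ}) ℕ.≤-refl)))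
      where
      y = L ℕ.+ k
      t = tablesOf σ
      σ₁ = assignedₙ σ node [] (! leaves ⊕ ! item)
      σ₂ = assignedₙ σ₁ reachable (! node ∷ lit 0 ∷ []) (lit 1)
      σ₃ = assignedᵣ σ₂ cost (! node ∷ lit 0 ∷ []) (lit 0ℚ)
      t′ = tablesOf σ₃
      others : ∀ x c → ¬ (x ≡ y × c ≡ 0) → SameEntry t t′ x c
      others x c ne = write-miss (nat σ) reachable 1 (ne ∘ pair-injective) ,
        write-miss (rat σ) cost 0ℚ (ne ∘ pair-injective) , refl , refl
      sound : LeafSound t′ y
      sound zero _ = inj₁ (refl , write-hit (rat σ) cost (y ∷ 0 ∷ []) 0ℚ)
      sound (suc c) h = ⊥-elim (ℕ.<⇒≱ h (ℕ.≤-reflexive (trans (proj₁ (others y (suc c) (λ { (_ , ()) }))) (empty y (suc c) (inj₂ ℕ.≤-refl)))))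
      post : ∀ {τ} → FillingIn t y k K τ → nat τ item [] ≡ k × FilledTo (suc k) (gridOf τ) (tablesOf τ)
      post {τ} (mkFilling g n i fr so co) = i , mkFilled g
        (λ x c out → trans (proj₁ (fr x (outside out) c)) (empty x c (weaken out)))
        (λ x L≤x x< → done x L≤x (ℕ.m<1+n⇒m<n∨m≡n (subst (x ℕ.<_) (ℕ.+-suc L k) x<)))
        where
        outside : ∀ {x} → x ℕ.< L ⊎ L ℕ.+ suc k ℕ.≤ x → x ≢ y
        outside (inj₁ x<L) refl = ℕ.<⇒≱ x<L (ℕ.m≤m+n L k)
        outside (inj₂ L+k<x) refl = ℕ.<-irrefl refl (subst (ℕ._≤ y) (ℕ.+-suc L k) L+k<x)
        weaken : ∀ {x} → x ℕ.< L ⊎ L ℕ.+ suc k ℕ.≤ x → x ℕ.< L ⊎ L ℕ.+ k ℕ.≤ x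
        weaken (inj₁ p) = inj₁ p
        weaken (inj₂ p) = inj₂ (ℕ.≤-trans (ℕ.+-monoʳ-≤ L (ℕ.n≤1+n k)) p)
        done : ∀ x → L ℕ.≤ x → x ℕ.< L ℕ.+ k ⊎ x ≡ L ℕ.+ k → LeafSound (tablesOf τ) x × LeafComplete (tablesOf τ) x K
        done x L≤x (inj₂ refl) = so , co
        done x L≤x (inj₁ x<y) = leaf-resp {t} {tablesOf τ} (fr x (ℕ.<⇒≢ x<y)) (filled x L≤x x<y)

-- Reading the input

-- The least-number principle supplies the iteration counts required by `exec-while`: the first k at
-- which the guard fails.
minimal : ∀ {P : ℕ → Set} → (∀ n → Dec (P n)) → ∀ {N} → P N → ∃[ n ] (P n × (∀ k → k ℕ.< n → ¬ P k))
minimal P? {zero} p = 0 , p , λ _ ()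
minimal {P} P? {suc N} p with P? 0
... | yes p₀ = 0 , p₀ , λ _ ()
... | no ¬p₀ with minimal {P ∘ suc} (P? ∘ suc) p
...   | n , pn , below = suc n , pn , λ { zero _ → ¬p₀ ; (suc k) (ℕ.s≤s k<n) → below k k<n }

-- Carried through all phases before the tables are filled, since a nonzero flag in `reachable` is
-- what marks an entry as valid.
Fresh : Store → Set
Fresh σ = ∀ y c → nat σ reachable (y ∷ c ∷ []) ≡ 0

module _ (I : Inputs) where
  open Inputs I

  record Measured (k N : ℕ) (i : Inputs) (n : ℕ) : Set where
    constructor mkMeasured
    field
      inputs≡ : i ≡ I
      sizes≤ : ∀ i → i ℕ.< k → size₀ i ℕ.≤ n
      ≤bound : n ℕ.≤ N

  exec-measure : ∀ {N σ} → inputs σ ≡ I → Fresh σ → nat σ breadth [] ≡ 0 → (∀ i → i ℕ.< m₀ → size₀ i ℕ.≤ N) →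
    Exec measure σ (λ τ → Measured m₀ N (inputs τ) (nat τ breadth []) × Fresh τ) (forTime (! categories) m₀ 15)
  exec-measure {N} {σ} i fresh b bounded =
    exec-for category (! categories) _ (λ k σ → Measured k N (inputs σ) (nat σ breadth []) × Fresh σ) m₀ 15
      (λ k σ inv → cong Inputs.m₀ (Measured.inputs≡ (proj₁ inv))) step
      (mkMeasured i (λ _ ()) (ℕ.≤-trans (ℕ.≤-reflexive b) ℕ.z≤n) , fresh)
    where
    step : ∀ k σ → k ℕ.< m₀ → Measured k N (inputs σ) (nat σ breadth []) × Fresh σ → nat σ category [] ≡ k →
      Exec _ σ (λ τ → nat τ category [] ≡ k × Measured (suc k) N (inputs τ) (nat τ breadth []) × Fresh τ) 15
    step k σ k<m (mkMeasured refl s≤ ≤N , fresh) refl = exec-weaken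
      (exec-if
        (λ b≤s → exec-assignₙ {σ} (refl , mkMeasured refl
          (λ i i< → larger b≤s i (ℕ.m<1+n⇒m<n∨m≡n i<)) (bounded k k<m) , fresh))
        (λ b≰s → exec-weaken (exec-skip {Q = Q} (refl , mkMeasured refl
          (λ i i< → same b≰s i (ℕ.m<1+n⇒m<n∨m≡n i<)) ≤N , fresh)) id ℕ.z≤n))
      id (ℕ.≤ᵇ⇒≤ _ _ _)
      where
      Q : Store → Set
      Q τ = nat τ category [] ≡ k × Measured (suc k) N (inputs τ) (nat τ breadth []) × Fresh τ
      larger : nat σ breadth [] ℕ.≤ size₀ k → ∀ i → i ℕ.< k ⊎ i ≡ k → size₀ i ℕ.≤ size₀ k
      larger b≤s i (inj₁ i<k) = ℕ.≤-trans (s≤ i i<k) b≤s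
      larger b≤s i (inj₂ refl) = ℕ.≤-refl
      same : ¬ (nat σ breadth [] ℕ.≤ size₀ k) → ∀ i → i ℕ.< k ⊎ i ≡ k → size₀ i ℕ.≤ nat σ breadth []
      same b≰s i (inj₁ i<k) = s≤ i i<k
      same b≰s i (inj₂ refl) = ℕ.≰⇒≥ b≰s

  shapeTime : ℕ → ℕ → ℕ
  shapeTime p q = 2 ℕ.+ (2 ℕ.+ (2 ℕ.+ ((p ℕ.* 12 ℕ.+ 4) ℕ.+ ((q ℕ.* 12 ℕ.+ 4) ℕ.+ 4))))

  exec-shape : ∀ {n p q σ} → inputs σ ≡ I → Fresh σ → nat σ breadth [] ≡ n →
    m₀ ℕ.≤ 2 ℕ.^ p → (∀ k → k ℕ.< p → ¬ m₀ ℕ.≤ 2 ℕ.^ k) →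
    n ℕ.≤ 2 ℕ.^ suc q → (∀ k → k ℕ.< q → ¬ n ℕ.≤ 2 ℕ.^ suc k) →
    Exec shape σ (λ τ → shapeOf τ ≡ mkShape I (2 ℕ.^ p) (2 ℕ.^ suc q) (2 ℕ.+ p ℕ.+ q) (2 ℕ.^ p ℕ.* 2 ℕ.^ suc q) × Fresh τ)
      (shapeTime p q)
  exec-shape {n} {p} {q} {σ} i fresh b m≤ m≰ n≤ n≰ =
    exec-assignₙ-seq (exec-assignₙ-seq (exec-assignₙ-seq (exec-seq
      (exec-while Rows p 8 stepRows (λ { σ (refl , _ , c , _) ¬le → ¬le (subst (m₀ ℕ.≤_) (sym c) m≤) }) (i , b , refl , refl , refl , fresh)) λ τ rows →
      exec-seq (exec-while Columns q 8 stepColumns (λ { σ (refl , refl , _ , d , _) ¬le → ¬le (subst (nat σ breadth [] ℕ.≤_) (sym d) n≤) })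
         (start {τ} rows)) λ { τ (refl , refl , e₁ , e₂ , e₃ , fresh) → exec-assignₙ {τ} (shape≡ τ e₁ e₂ e₃ , fresh) })))
    where
    Rows Columns : ℕ → Store → Set
    Rows k σ = inputs σ ≡ I × nat σ breadth [] ≡ n × nat σ rows [] ≡ 2 ℕ.^ k × nat σ columns [] ≡ 2 × nat σ levels [] ≡ 2 ℕ.+ k × Fresh σ
    Columns k σ = inputs σ ≡ I × nat σ breadth [] ≡ n × nat σ rows [] ≡ 2 ℕ.^ p × nat σ columns [] ≡ 2 ℕ.^ suc k × nat σ levels [] ≡ 2 ℕ.+ p ℕ.+ k × Fresh σ

    start : ∀ {τ} → Rows p τ → Columns 0 τ
    start (a , b , c , d , e , f) = a , b , c , d , trans e (sym (ℕ.+-identityʳ (2 ℕ.+ p))) , f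

    shape≡ : ∀ τ → nat τ rows [] ≡ 2 ℕ.^ p → nat τ columns [] ≡ 2 ℕ.^ suc q → nat τ levels [] ≡ 2 ℕ.+ p ℕ.+ q →
      mkShape (inputs τ) (nat τ rows []) (nat τ columns []) (nat τ levels []) (nat τ rows [] ℕ.* nat τ columns []) ≡
      mkShape (inputs τ) (2 ℕ.^ p) (2 ℕ.^ suc q) (2 ℕ.+ p ℕ.+ q) (2 ℕ.^ p ℕ.* 2 ℕ.^ suc q)
    shape≡ τ e₁ e₂ e₃ rewrite e₁ | e₂ | e₃ = refl

    stepRows : ∀ k σ → k ℕ.< p → Rows k σ → Holds σ (neg (! categories ≤ₙ ! rows)) ×
      Exec ((rows ⟦ [] ⟧≔ₙ (lit 2 ⊗ ! rows)) ⨾ (levels ⟦ [] ⟧≔ₙ (! levels ⊕ lit 1))) σ (Rows (suc k)) 8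
    stepRows k σ k<p (refl , b , c , d , e , f) =
      (λ le → m≰ k k<p (subst (m₀ ℕ.≤_) c le)) ,
      exec-assignₙ-seq (exec-assignₙ {assignedₙ σ rows [] (lit 2 ⊗ ! rows)} (refl , b , cong (2 ℕ.*_) c , d ,
        trans (ℕ.+-comm (nat σ levels []) 1) (trans (cong suc e) (sym (ℕ.+-suc 2 k))) , f))

    stepColumns : ∀ k σ → k ℕ.< q → Columns k σ → Holds σ (neg (! breadth ≤ₙ ! columns)) ×
      Exec ((columns ⟦ [] ⟧≔ₙ (lit 2 ⊗ ! columns)) ⨾ (levels ⟦ [] ⟧≔ₙ (! levels ⊕ lit 1))) σ (Columns (suc k)) 8
    stepColumns k σ k<q (refl , refl , c , d , e , f) =
      (λ le → n≰ k k<q (subst (nat σ breadth [] ℕ.≤_) d le)) ,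
      exec-assignₙ-seq (exec-assignₙ {assignedₙ σ columns [] (lit 2 ⊗ ! columns)} (refl , refl , c , cong (2 ℕ.*_) d ,
        trans (ℕ.+-comm (nat σ levels []) 1) (trans (cong suc e) (sym (ℕ.+-suc (2 ℕ.+ p) k))) , f))

flat-< : ∀ M P {i i′ j} j′ → j ℕ.< P → i ℕ.< i′ → (M ℕ.+ i) ℕ.* P ℕ.+ j ℕ.< (M ℕ.+ i′) ℕ.* P ℕ.+ j′
flat-< M P {i} {i′} {j} j′ j<P i<i′ = begin-strict
  (M ℕ.+ i) ℕ.* P ℕ.+ j <⟨ ℕ.+-monoʳ-< ((M ℕ.+ i) ℕ.* P) j<P ⟩
  (M ℕ.+ i) ℕ.* P ℕ.+ P ≡⟨ ℕ.+-comm _ P ⟩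
  suc (M ℕ.+ i) ℕ.* P   ≤⟨ ℕ.*-monoˡ-≤ P (ℕ.+-monoʳ-< M i<i′) ⟩
  (M ℕ.+ i′) ℕ.* P      ≤⟨ ℕ.m≤m+n _ j′ ⟩
  (M ℕ.+ i′) ℕ.* P ℕ.+ j′ ∎
  where open ℕ.≤-Reasoning

-- Uniqueness of quotient and remainder modulo P. It keeps the leaves of distinct items apart.
flat-injective : ∀ M P {i i′ j j′} → j ℕ.< P → j′ ℕ.< P →
  (M ℕ.+ i) ℕ.* P ℕ.+ j ≡ (M ℕ.+ i′) ℕ.* P ℕ.+ j′ → i ≡ i′ × j ≡ j′
flat-injective M P {i} {i′} {j} {j′} j<P j′<P eq with ℕ.<-cmp i i′
... | tri< i<i′ _ _ = ⊥-elim (ℕ.<⇒≢ (flat-< M P j′ j<P i<i′) eq)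
... | tri≈ _ refl _ = refl , ℕ.+-cancelˡ-≡ ((M ℕ.+ i) ℕ.* P) j j′ eq
... | tri> _ _ i′<i = ⊥-elim (ℕ.<⇒≢ (flat-< M P j j′<P i′<i) (sym eq))

module _ (S : Shape) where
  open Shape S

  LoadedAt : Leaves → ℕ → ℕ → Set
  LoadedAt V i j = lv ((M ℕ.+ i) ℕ.* P ℕ.+ j) ≡ vl i j × lw ((M ℕ.+ i) ℕ.* P ℕ.+ j) ≡ wt i j
    where open Leaves V using (lv; lw)

  record Loaded (D : ℕ → ℕ → Set) (V : Leaves) : Set where
    constructor mkLoaded
    field
      shape≡ : Leaves.shp V ≡ S
      loaded : ∀ i j → j ℕ.< P → D i j → LoadedAt V i j

  loadTime : ℕ
  loadTime = forTime (! rows) M (forTime (! columns) P 22)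

  exec-load : ∀ {σ} → shapeOf σ ≡ S → Fresh σ →
    Exec load σ (λ τ → Loaded (λ i j → i ℕ.< M) (leavesOf τ) × Fresh τ) loadTime
  exec-load {σ} s fresh =
    exec-for category (! rows) _ (λ k σ → Loaded (λ i j → i ℕ.< k) (leavesOf σ) × Fresh σ) M (forTime (! columns) P 22)
      (λ k σ inv → cong Shape.M (Loaded.shape≡ (proj₁ inv)))
      (λ { k σ k<M (mkLoaded s loaded , fresh) refl → exec-weaken
        (exec-for item (! columns) _ (λ j τ → nat τ category [] ≡ k × Loaded (Before k j) (leavesOf τ) × Fresh τ) P 22
          (λ j σ inv → cong Shape.P (Loaded.shape≡ (proj₁ (proj₂ inv)))) (step k)
          (refl , mkLoaded s (λ i j j<P b → loaded i j j<P (before-start b)) , fresh))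
        (λ { (c , mkLoaded s loaded , fresh) → c , mkLoaded s (λ i j j<P i< → loaded i j j<P (before-row j<P i<)) , fresh })
        ℕ.≤-refl })
      (mkLoaded s (λ _ _ _ ()) , fresh)
    where
    step : ∀ k j σ → j ℕ.< P → nat σ category [] ≡ k × Loaded (Before k j) (leavesOf σ) × Fresh σ → nat σ item [] ≡ j →
      Exec _ σ (λ τ → nat τ item [] ≡ j × nat τ category [] ≡ k × Loaded (Before k (suc j)) (leavesOf τ) × Fresh τ) 22
    step k j σ j<P (refl , mkLoaded refl loaded , fresh) refl =
      exec-assignᵣ-seq (exec-assignᵣ {σ₁} (refl , refl , mkLoaded refl next , fresh))
      where
      σ₁ = assignedᵣ σ leafValue (leafIndex ∷ []) (value ⟦ ! category ∷ ! item ∷ [] ⟧)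
      σ₂ = assignedᵣ σ₁ leafWeight (leafIndex ∷ []) (weight ⟦ ! category ∷ ! item ∷ [] ⟧)
      next : ∀ i′ j′ → j′ ℕ.< P → Before k (suc j) i′ j′ → LoadedAt (leavesOf σ₂) i′ j′
      next i′ j′ j′<P b with before-suc b
      ... | inj₂ (refl , refl) =
        write-hit (rat σ) leafValue ((M ℕ.+ k) ℕ.* P ℕ.+ j ∷ []) (vl k j) ,
        write-hit (rat σ) leafWeight ((M ℕ.+ k) ℕ.* P ℕ.+ j ∷ []) (wt k j)
      ... | inj₁ b′ =
        trans (write-miss (rat σ) leafValue (vl k j) ne) (proj₁ (loaded i′ j′ j′<P b′)) ,
        trans (write-miss (rat σ) leafWeight (wt k j) ne) (proj₂ (loaded i′ j′ j′<P b′))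
        where
        ne : (M ℕ.+ i′) ℕ.* P ℕ.+ j′ ∷ [] ≢ (M ℕ.+ k) ℕ.* P ℕ.+ j ∷ []
        ne eq = before-irrefl (flat-injective M P j′<P j<P (∷-injectiveˡ eq)) b′

-- Smallest positive value, total value and grid

rsum : ℕ → (ℕ → ℚ) → ℚ
rsum zero f = 0ℚ
rsum (suc n) f = rsum n f + f n

-- Allows s = 0ℚ while no f k is positive: `attained` is guarded, and `below` delivers 0 < s as soon
-- as a positive value occurs.
record LeastPositive (n : ℕ) (f : ℕ → ℚ) (s : ℚ) : Set where
  constructor mkLeast
  field
    s≥0 : 0ℚ ≤ s
    attained : 0ℚ < s → ∃[ k ] (k ℕ.< n × f k ≡ s)
    below : ∀ k → k ℕ.< n → 0ℚ < f k → 0ℚ < s × s ≤ f k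

module _ (V : Leaves) where
  open Leaves V

  leafValues : ℕ → ℚ
  leafValues t = lv (L ℕ.+ t)

  record Scanned (k : ℕ) (V′ : Leaves) (tot s : ℚ) : Set where
    constructor mkScanned
    field
      leaves≡ : V′ ≡ V
      total≡ : tot ≡ rsum k leafValues
      least-positive : LeastPositive k leafValues s

  ScannedIn : ℕ → Store → Set
  ScannedIn k σ = Scanned k (leavesOf σ) (rat σ total []) (rat σ least []) × Fresh σ

  scanTime : ℕ
  scanTime = 2 ℕ.+ (2 ℕ.+ forTime (! leaves) L 40)

  exec-scan : ∀ {σ} → leavesOf σ ≡ V → Fresh σ → Exec scan σ (ScannedIn L) scanTime
  exec-scan {σ} v fresh = exec-assignᵣ-seq (exec-assignᵣ-seq
    (exec-for node (! leaves) _ ScannedIn L 40 (λ k σ inv → cong Leaves.L (Scanned.leaves≡ (proj₁ inv))) step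
      (mkScanned v refl (mkLeast ℚ.≤-refl (λ 0<0 → ⊥-elim (ℚ.<-irrefl refl 0<0)) (λ _ ())) , fresh)))
    where
    step : ∀ k σ → k ℕ.< L → ScannedIn k σ → nat σ node [] ≡ k →
      Exec _ σ (λ τ → nat τ node [] ≡ k × ScannedIn (suc k) τ) 40
    step k σ k<L (mkScanned refl e (mkLeast s≥0 att below) , fresh) refl = exec-weaken
      (exec-assignᵣ-seq (exec-if {σ = σ₁}
        (λ where (pos , smaller) → exec-assignᵣ {σ₁} (refl , mkScanned refl (cong (_+ leafValues k) e)
                   (mkLeast (ℚ.<⇒≤ (ℚ.≰⇒> pos)) (λ _ → k , ℕ.n<1+n k , refl) (new pos smaller)) , fresh))
        (λ not → exec-weaken (exec-skip {Q = Q} (refl , mkScanned refl (cong (_+ leafValues k) e)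
                   (mkLeast s≥0 (λ 0<s → let j , j<k , eq = att 0<s in j , ℕ.m<n⇒m<1+n j<k , eq) (old not)) , fresh)) id ℕ.z≤n)))
      id (ℕ.≤ᵇ⇒≤ _ _ _)
      where
      σ₁ = assignedᵣ σ total [] ((total ⟦ [] ⟧) ⊞ (leafValue ⟦ ! leaves ⊕ ! node ∷ [] ⟧))
      Q : Store → Set
      Q τ = nat τ node [] ≡ k × ScannedIn (suc k) τ
      s = rat σ least []
      new : ¬ leafValues k ≤ 0ℚ → ¬ (¬ s ≤ 0ℚ × s ≤ leafValues k) → ∀ j → j ℕ.< suc k → 0ℚ < leafValues j →
        0ℚ < leafValues k × leafValues k ≤ leafValues j
      new pos smaller j j< 0<f with ℕ.m<1+n⇒m<n∨m≡n j<
      ... | inj₂ refl = 0<f , ℚ.≤-refl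
      ... | inj₁ j<k with below j j<k 0<f
      ...   | 0<s , s≤ = ℚ.≰⇒> pos , ℚ.≤-trans ((ℚ.<⇒≤ ∘ ℚ.≰⇒>) (λ s≤k → smaller ((λ s≤0 → ℚ.<-irrefl refl (ℚ.<-≤-trans 0<s s≤0)) , s≤k))) s≤
      old : ¬ (¬ leafValues k ≤ 0ℚ × ¬ (¬ s ≤ 0ℚ × s ≤ leafValues k)) → ∀ j → j ℕ.< suc k → 0ℚ < leafValues j →
        0ℚ < s × s ≤ leafValues j
      old not j j< 0<f with ℕ.m<1+n⇒m<n∨m≡n j<
      ... | inj₁ j<k = below j j<k 0<f
      ... | inj₂ refl with decidable-stable
              (holds? σ (neg ((least ⟦ [] ⟧) ≤ᵣ lit 0ℚ) & ((least ⟦ [] ⟧) ≤ᵣ (leafValue ⟦ ! leaves ⊕ ! node ∷ [] ⟧))))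
              (λ ¬both → not ((λ f≤0 → ℚ.<-irrefl refl (ℚ.<-≤-trans 0<f f≤0)) , ¬both))
      ...   | ¬s≤0 , s≤f = ℚ.≰⇒> ¬s≤0 , s≤f

  module _ (ε s tot : ℚ) (k₀ : ℕ) where

    δ ρ₀ : ℚ
    δ = ε /₀ fromℕ (2 ℕ.* E)
    ρ₀ = 1ℚ + δ

    record Gridded (j : ℕ) (g : Grid) : Set where
      constructor mkGridded
      field
        leaves≡ : Grid.lvs g ≡ V
        ratio≡  : Grid.ρ g ≡ ρ₀
        size≡   : Grid.K g ≡ suc j
        origin  : Grid.r g 0 ≡ 0ℚ
        powers  : ∀ k → k ℕ.≤ j → Grid.r g (suc k) ≡ ρ₀ ^ᵣ k * s

    gridTime : ℕ
    gridTime = 8 ℕ.+ (3 ℕ.+ (4 ℕ.+ (2 ℕ.+ (k₀ ℕ.* 17 ℕ.+ 4))))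

    exec-makeGrid : ∀ {σ} → leavesOf σ ≡ V → Fresh σ → rat σ total [] ≡ tot → rat σ least [] ≡ s →
      tot < ρ₀ ^ᵣ k₀ * s → (∀ k → k ℕ.< k₀ → ¬ tot < ρ₀ ^ᵣ k * s) →
      Exec (makeGrid ε) σ (λ τ → Gridded k₀ (gridOf τ) × Fresh τ) gridTime
    exec-makeGrid {σ} v fresh refl refl top below =
      exec-assignᵣ-seq (exec-assignᵣ-seq (exec-assignᵣ-seq (exec-assignₙ-seq
        (exec-weaken (exec-while Inv k₀ 13 step stop (start v)) (λ inv → proj₂ inv , proj₂ (proj₁ inv)) ℕ.≤-refl))))
      where
      Inv : ℕ → Store → Set
      Inv j τ = (rat τ total [] ≡ tot × Fresh τ) × Gridded j (gridOf τ)
      σ₁ = assignedᵣ σ ratio [] (lit 1ℚ ⊞ lit ε ⊘ cast (lit 2 ⊗ ! levels))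
      σ₂ = assignedᵣ σ₁ grid (lit 0 ∷ []) (lit 0ℚ)
      σ₃ = assignedᵣ σ₂ grid (lit 1 ∷ []) (least ⟦ [] ⟧)
      σ₄ = assignedₙ σ₃ gridSize [] (lit 1)
      start : leavesOf σ ≡ V → Inv 0 σ₄
      start refl = (refl , fresh) , mkGridded refl refl refl refl
        (λ { zero ℕ.z≤n → sym (ℚ.*-identityˡ s) })
      step : ∀ j τ → j ℕ.< k₀ → Inv j τ → Holds τ ((grid ⟦ ! gridSize ∷ [] ⟧) ≤ᵣ (total ⟦ [] ⟧)) ×
        Exec ((grid ⟦ ! gridSize ⊕ lit 1 ∷ [] ⟧≔ᵣ ((ratio ⟦ [] ⟧) ⊠ (grid ⟦ ! gridSize ∷ [] ⟧))) ⨾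
              (gridSize ⟦ [] ⟧≔ₙ (! gridSize ⊕ lit 1))) τ (Inv (suc j)) 13
      step j τ j<k₀ ((t , fresh) , mkGridded l ra si o pw) =
        subst₂ _≤_ (sym top≡) (sym t) (ℚ.≮⇒≥ (below j j<k₀)) ,
        exec-weaken
          (exec-assignᵣ-seq (exec-assignₙ {assignedᵣ τ grid (! gridSize ⊕ lit 1 ∷ []) ((ratio ⟦ [] ⟧) ⊠ (grid ⟦ ! gridSize ∷ [] ⟧))} {Q = Inv (suc j)}
            ((t , fresh) , mkGridded l ra size′ (trans (miss 0 (λ ())) o) powers′)))
          id (ℕ.≤ᵇ⇒≤ _ _ _)
        where
        K = nat τ gridSize []
        top≡ : rat τ grid (K ∷ []) ≡ ρ₀ ^ᵣ j * s
        top≡ = trans (cong (λ z → rat τ grid (z ∷ [])) si) (pw j ℕ.≤-refl)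
        size′ : K ℕ.+ 1 ≡ suc (suc j)
        size′ = trans (ℕ.+-comm K 1) (cong suc si)
        new = rat τ ratio [] * rat τ grid (K ∷ [])
        r′ : ℕ → ℚ
        r′ k = write (rat τ) grid (K ℕ.+ 1 ∷ []) new grid (k ∷ [])
        miss : ∀ k → k ≢ suc (suc j) → r′ k ≡ rat τ grid (k ∷ [])
        miss k ne = write-miss (rat τ) grid {K ℕ.+ 1 ∷ []} new (λ eq → ne (trans (∷-injectiveˡ eq) size′))
        powers′ : ∀ k → k ℕ.≤ suc j → r′ (suc k) ≡ ρ₀ ^ᵣ k * s
        powers′ k k≤ with ℕ.m≤n⇒m<n∨m≡n k≤
        ... | inj₁ k< = trans (miss (suc k) (λ eq → ℕ.<⇒≢ k< (ℕ.suc-injective eq))) (pw k (ℕ.s≤s⁻¹ k<))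
        ... | inj₂ refl = begin
          r′ (suc (suc j)) ≡⟨ cong r′ size′ ⟨
          r′ (K ℕ.+ 1) ≡⟨ write-hit (rat τ) grid (K ℕ.+ 1 ∷ []) new ⟩
          rat τ ratio [] * rat τ grid (K ∷ []) ≡⟨ cong₂ _*_ ra top≡ ⟩
          ρ₀ * (ρ₀ ^ᵣ j * s) ≡⟨ ℚ.*-assoc ρ₀ (ρ₀ ^ᵣ j) s ⟨
          ρ₀ ^ᵣ suc j * s ∎
          where open ≡-Reasoning
      stop : ∀ τ → Inv k₀ τ → ¬ Holds τ ((grid ⟦ ! gridSize ∷ [] ⟧) ≤ᵣ (total ⟦ [] ⟧))
      stop τ ((t , _) , mkGridded l ra si o pw) le = ℚ.<-irrefl refl (ℚ.<-≤-trans top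
        (subst₂ _≤_ (trans (cong (λ z → rat τ grid (z ∷ [])) si) (pw k₀ ℕ.≤-refl)) t le))

-- Selecting and extracting a solution

module _ (G : Grid) (t : Tables) where
  open Grid G
  open Tables t

  Affordable : ℕ → Set
  Affordable c = 1 ℕ.≤ ok 1 c × co 1 c ≤ cap

  record Selected (k : ℕ) (g : Grid) (t′ : Tables) (b : ℕ) : Set where
    constructor mkSelected
    field
      grid≡ : g ≡ G
      tables≡ : t′ ≡ t
      -- Conditional on some affordable c, because the initial index 0 need not be affordable.
      largest : ∀ c → c ℕ.< k → Affordable c → c ℕ.≤ b × b ℕ.< K × Affordable b

  SelectedIn : ℕ → Store → Set
  SelectedIn k σ = Selected k (gridOf σ) (tablesOf σ) (nat σ best [])

  selectTime : ℕ
  selectTime = 2 ℕ.+ forTime (! gridSize) K 20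

  exec-select : ∀ {σ} → gridOf σ ≡ G → tablesOf σ ≡ t → Exec select σ (SelectedIn K) selectTime
  exec-select {σ} g ts = exec-assignₙ-seq
    (exec-for merged (! gridSize) _ SelectedIn K 20 (λ k σ inv → cong Grid.K (Selected.grid≡ inv)) step
      (mkSelected g ts (λ _ ())))
    where
    step : ∀ k σ → k ℕ.< K → SelectedIn k σ → nat σ merged [] ≡ k →
      Exec _ σ (λ τ → nat τ merged [] ≡ k × SelectedIn (suc k) τ) 20
    step k σ k<K (mkSelected refl refl largest) refl = exec-weaken
      (exec-if
        (λ afford → exec-assignₙ {σ} (refl , mkSelected refl refl (λ c c< _ → ℕ.s≤s⁻¹ c< , k<K , afford)))
        (λ ¬afford → exec-weaken (exec-skip {Q = Q} (refl , mkSelected refl refl (keep ¬afford))) id ℕ.z≤n))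
      id (ℕ.≤ᵇ⇒≤ _ _ _)
      where
      Q : Store → Set
      Q τ = nat τ merged [] ≡ k × SelectedIn (suc k) τ
      keep : ¬ Affordable k → ∀ c → c ℕ.< suc k → Affordable c → c ℕ.≤ nat σ best [] × nat σ best [] ℕ.< K × Affordable (nat σ best [])
      keep ¬afford c c< afford with ℕ.m<1+n⇒m<n∨m≡n c<
      ... | inj₁ c<k = largest c c<k afford
      ... | inj₂ refl = ⊥-elim (¬afford afford)

  record Descended (k b : ℕ) (g : Grid) (t′ : Tables) (e : ℕ → ℕ) : Set where
    constructor mkDescended
    field
      grid≡ : g ≡ G
      tables≡ : t′ ≡ t
      root : e 1 ≡ b
      children : ∀ x → 1 ℕ.≤ x → x ℕ.≤ k → e (2 ℕ.* x) ≡ lc x (e x) × e (2 ℕ.* x ℕ.+ 1) ≡ rc x (e x)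

  entryOf : Store → ℕ → ℕ
  entryOf σ y = nat σ entry (y ∷ [])

  DescendedIn : ℕ → ℕ → Store → Set
  DescendedIn b k σ = Descended k b (gridOf σ) (tablesOf σ) (entryOf σ)

  descendTime : ℕ
  descendTime = 3 ℕ.+ forTime (! leaves ⊖ lit 1) (L ℕ.∸ 1) 23

  exec-descend : ∀ {σ b} → gridOf σ ≡ G → tablesOf σ ≡ t → nat σ best [] ≡ b →
    Exec descend σ (DescendedIn b (L ℕ.∸ 1)) descendTime
  exec-descend {σ} {b} g ts b≡ = exec-assignₙ-seq
    (exec-for item (! leaves ⊖ lit 1) _ (DescendedIn b) (L ℕ.∸ 1) 23
      (λ k σ inv → cong (λ g → Grid.L g ℕ.∸ 1) (Descended.grid≡ inv)) step
      (mkDescended g ts (trans (write-hit (nat σ) entry (1 ∷ []) (nat σ best [])) b≡)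
        (λ x 1≤x x≤0 → ⊥-elim (ℕ.<⇒≱ 1≤x x≤0))))
    where
    step : ∀ k σ → k ℕ.< L ℕ.∸ 1 → DescendedIn b k σ → nat σ item [] ≡ k →
      Exec _ σ (λ τ → nat τ item [] ≡ k × DescendedIn b (suc k) τ) 23
    step k σ _ (mkDescended refl refl root children) refl =
      exec-weaken (exec-assignₙ-seq (exec-assignₙ-seq (exec-assignₙ {σ₂} (refl , mkDescended refl refl
        (trans (other 1 (ℕ.<⇒≢ (ℕ.≤-trans (ℕ.s≤s 1≤x) x<2x)) (ℕ.<⇒≢ (ℕ.≤-trans (ℕ.s≤s 1≤x) (ℕ.≤-trans x<2x (ℕ.m≤m+n (2 ℕ.* x) 1))))) root)
        next))))
        id (ℕ.≤ᵇ⇒≤ _ _ _)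
      where
      σ₁ = assignedₙ σ node [] (! item ⊕ lit 1)
      σ₂ = assignedₙ σ₁ entry (lit 2 ⊗ ! node ∷ []) (leftChoice ⟦ ! node ∷ (entry ⟦ ! node ∷ [] ⟧) ∷ [] ⟧)
      σ₃ = assignedₙ σ₂ entry (lit 2 ⊗ ! node ⊕ lit 1 ∷ []) (rightChoice ⟦ ! node ∷ (entry ⟦ ! node ∷ [] ⟧) ∷ [] ⟧)
      x = k ℕ.+ 1
      1≤x : 1 ℕ.≤ x
      1≤x = ℕ.m≤n+m 1 k
      x<2x : x ℕ.< 2 ℕ.* x
      x<2x = ℕ.m<m+n x (subst (0 ℕ.<_) (sym (ℕ.+-identityʳ x)) 1≤x)
      e = entryOf σ
      e₂ = entryOf σ₂
      e₃ = entryOf σ₃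
      miss₂ : ∀ y → y ≢ 2 ℕ.* x → e₂ y ≡ e y
      miss₂ y ne = write-miss (nat σ) entry {2 ℕ.* x ∷ []} _ (ne ∘ ∷-injectiveˡ)
      miss₃ : ∀ y → y ≢ 2 ℕ.* x ℕ.+ 1 → e₃ y ≡ e₂ y
      miss₃ y ne = write-miss (nat σ₂) entry {2 ℕ.* x ℕ.+ 1 ∷ []} _ (ne ∘ ∷-injectiveˡ)
      other : ∀ y → y ≢ 2 ℕ.* x → y ≢ 2 ℕ.* x ℕ.+ 1 → e₃ y ≡ e y
      other y ne ne′ = trans (miss₃ y ne′) (miss₂ y ne)
      2x≢2x+1 : 2 ℕ.* x ≢ 2 ℕ.* x ℕ.+ 1
      2x≢2x+1 = ℕ.<⇒≢ (ℕ.m<m+n (2 ℕ.* x) (ℕ.s≤s ℕ.z≤n))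
      x≢2x = ℕ.<⇒≢ x<2x
      x≢2x+1 = ℕ.<⇒≢ (ℕ.≤-trans x<2x (ℕ.m≤m+n (2 ℕ.* x) 1))
      next : ∀ y → 1 ℕ.≤ y → y ℕ.≤ suc k → e₃ (2 ℕ.* y) ≡ lc y (e₃ y) × e₃ (2 ℕ.* y ℕ.+ 1) ≡ rc y (e₃ y)
      next y 1≤y y≤ with ℕ.m≤n⇒m<n∨m≡n (subst (y ℕ.≤_) (ℕ.+-comm 1 k) y≤)
      ... | inj₂ refl =
        trans (miss₃ (2 ℕ.* x) 2x≢2x+1) (trans (write-hit (nat σ) entry (2 ℕ.* x ∷ []) _) (cong (lc x) (sym (other x x≢2x x≢2x+1)))) ,
        trans (write-hit (nat σ₂) entry (2 ℕ.* x ℕ.+ 1 ∷ []) _) (cong (rc x) (sym (miss₃ x x≢2x+1)))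
      ... | inj₁ y<x with children y 1≤y (ℕ.s≤s⁻¹ (subst (y ℕ.<_) (ℕ.+-comm k 1) y<x))
      ...   | l , r = trans (other (2 ℕ.* y) (ℕ.<⇒≢ 2y<2x) (ℕ.<⇒≢ (ℕ.≤-trans 2y<2x (ℕ.m≤m+n (2 ℕ.* x) 1)))) (trans l (cong (lc y) (sym same))) ,
                    trans (other (2 ℕ.* y ℕ.+ 1) (ℕ.<⇒≢ 2y+1<2x) (ℕ.<⇒≢ (ℕ.+-monoˡ-< 1 2y<2x))) (trans r (cong (rc y) (sym same)))
        where
        2y<2x : 2 ℕ.* y ℕ.< 2 ℕ.* x
        2y<2x = ℕ.*-monoʳ-< 2 y<x
        2y+1<2x : 2 ℕ.* y ℕ.+ 1 ℕ.< 2 ℕ.* x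
        2y+1<2x = 2m<2n⇒2m+1<2n y<x
        same : e₃ y ≡ e y
        same = other y (ℕ.<⇒≢ (ℕ.<-trans y<x x<2x)) (ℕ.<⇒≢ (ℕ.<-≤-trans (ℕ.<-trans y<x x<2x) (ℕ.m≤m+n (2 ℕ.* x) 1)))

module _ (S : Shape) (e : ℕ → ℕ) where
  open Shape S

  record Unloaded (D : ℕ → ℕ → Set) (s : Shape) (e′ : ℕ → ℕ) (ch : ℕ → ℕ → ℕ) : Set where
    constructor mkUnloaded
    field
      shape≡ : s ≡ S
      entries≡ : e′ ≡ e
      unloaded : ∀ i j → j ℕ.< P → D i j → ch i j ≡ e ((M ℕ.+ i) ℕ.* P ℕ.+ j)

  chosenOf : Store → ℕ → ℕ → ℕ
  chosenOf σ i j = nat σ chosen (i ∷ j ∷ [])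

  UnloadedIn : (ℕ → ℕ → Set) → Store → Set
  UnloadedIn D σ = Unloaded D (shapeOf σ) (λ y → nat σ entry (y ∷ [])) (chosenOf σ)

  unloadTime : ℕ
  unloadTime = forTime (! rows) M (forTime (! columns) P 11)

  exec-unload : ∀ {σ} → shapeOf σ ≡ S → (λ y → nat σ entry (y ∷ [])) ≡ e →
    Exec unload σ (UnloadedIn (λ i j → i ℕ.< M)) unloadTime
  exec-unload {σ} s en =
    exec-for category (! rows) _ (λ k → UnloadedIn (λ i j → i ℕ.< k)) M (forTime (! columns) P 11)
      (λ k σ inv → cong Shape.M (Unloaded.shape≡ inv))
      (λ { k σ k<M (mkUnloaded s en loaded) refl → exec-weaken
        (exec-for item (! columns) _ (λ j τ → nat τ category [] ≡ k × UnloadedIn (Before k j) τ) P 11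
          (λ j σ inv → cong Shape.P (Unloaded.shape≡ (proj₂ inv))) (step k)
          (refl , mkUnloaded s en (λ i j j<P b → loaded i j j<P (before-start b))))
        (λ { (c , mkUnloaded s en loaded) → c , mkUnloaded s en (λ i j j<P i< → loaded i j j<P (before-row j<P i<)) })
        ℕ.≤-refl })
      (mkUnloaded s en (λ _ _ _ ()))
    where
    step : ∀ k j σ → j ℕ.< P → nat σ category [] ≡ k × UnloadedIn (Before k j) σ → nat σ item [] ≡ j →
      Exec _ σ (λ τ → nat τ item [] ≡ j × nat τ category [] ≡ k × UnloadedIn (Before k (suc j)) τ) 11
    step k j σ j<P (refl , mkUnloaded refl refl loaded) refl =
      exec-assignₙ {σ} (refl , refl , mkUnloaded refl refl next)
      where
      σ₁ = assignedₙ σ chosen (! category ∷ ! item ∷ []) (entry ⟦ leafIndex ∷ [] ⟧)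
      next : ∀ i′ j′ → j′ ℕ.< P → Before k (suc j) i′ j′ → chosenOf σ₁ i′ j′ ≡ e ((M ℕ.+ i′) ℕ.* P ℕ.+ j′)
      next i′ j′ j′<P b with before-suc b
      ... | inj₂ (refl , refl) = write-hit (nat σ) chosen (k ∷ j ∷ []) _
      ... | inj₁ b′ = trans (write-miss (nat σ) chosen _ (λ eq → before-irrefl (pair-injective eq) b′)) (loaded i′ j′ j′<P b′)

-- Rounding errors along the tree

-- In heap numbering these are exactly the nodes at depth l.
record AtLevel (l x : ℕ) : Set where
  constructor _,_
  field
    from : 2 ℕ.^ l ℕ.≤ x
    to   : x ℕ.< 2 ℕ.^ suc l

atLevel-left : ∀ {l x} → AtLevel l x → AtLevel (suc l) (2 ℕ.* x)
atLevel-left (p , q) = ℕ.*-monoʳ-≤ 2 p , ℕ.*-monoʳ-< 2 q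

atLevel-right : ∀ {l x} → AtLevel l x → AtLevel (suc l) (2 ℕ.* x ℕ.+ 1)
atLevel-right {l} {x} (p , q) = ℕ.≤-trans (ℕ.*-monoʳ-≤ 2 p) (ℕ.m≤m+n (2 ℕ.* x) 1) , 2m<2n⇒2m+1<2n q

halve : ∀ x → ∃[ y ] (x ≡ 2 ℕ.* y ⊎ x ≡ 2 ℕ.* y ℕ.+ 1)
halve zero = 0 , inj₁ refl
halve (suc x) with halve x
... | y , inj₁ refl = y , inj₂ (ℕ.+-comm 1 (2 ℕ.* y))
... | y , inj₂ refl = suc y , inj₁ (trans (cong suc (ℕ.+-comm (2 ℕ.* y) 1)) (sym (ℕ.*-suc 2 y)))

atLevel-unleft : ∀ {l y} → AtLevel (suc l) (2 ℕ.* y) → AtLevel l y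
atLevel-unleft {l} {y} (p , q) = ℕ.*-cancelˡ-≤ 2 p , ℕ.*-cancelˡ-< 2 y (2 ℕ.^ suc l) q

atLevel-unright : ∀ {l y} → AtLevel (suc l) (2 ℕ.* y ℕ.+ 1) → AtLevel l y
atLevel-unright {l} {y} (p , q) = ℕ.s≤s⁻¹ (ℕ.*-cancelˡ-< 2 (2 ℕ.^ l) (suc y) (begin-strict
    2 ℕ.^ suc l ≤⟨ p ⟩
    2 ℕ.* y ℕ.+ 1 <⟨ 2m<2n⇒2m+1<2n (ℕ.n<1+n y) ⟩
    2 ℕ.* suc y ∎)) ,
  ℕ.*-cancelˡ-< 2 y (2 ℕ.^ suc l) (ℕ.≤-<-trans (ℕ.m≤m+n (2 ℕ.* y) 1) q)
  where open ℕ.≤-Reasoning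

atLevel-unique : ∀ {k l x} → AtLevel k x → AtLevel l x → k ≡ l
atLevel-unique {k} {l} (p , q) (p′ , q′) with ℕ.<-cmp k l
... | tri< k<l _ _ = ⊥-elim (ℕ.<⇒≱ q (ℕ.≤-trans (ℕ.^-monoʳ-≤ 2 k<l) p′))
... | tri≈ _ eq _ = eq
... | tri> _ _ l<k = ⊥-elim (ℕ.<⇒≱ q′ (ℕ.≤-trans (ℕ.^-monoʳ-≤ 2 l<k) p))

atLevel-≥1 : ∀ {l x} → AtLevel l x → 1 ℕ.≤ x
atLevel-≥1 {l} (p , _) = ℕ.≤-trans (ℕ.m^n>0 2 l) p

atLevel-< : ∀ {l d x} → AtLevel l x → x ℕ.< 2 ℕ.^ (l ℕ.+ suc d)
atLevel-< {l} {d} (_ , q) = ℕ.<-≤-trans q (ℕ.^-monoʳ-≤ 2 (subst (suc l ℕ.≤_) (sym (ℕ.+-suc l d)) (ℕ.s≤s (ℕ.m≤m+n l d))))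

-- Summation over the descendants d levels below x, by the same recursion along which the tables are
-- merged.
tsum : ℕ → ℕ → (ℕ → ℚ) → ℚ
tsum zero x f = f x
tsum (suc d) x f = tsum d (2 ℕ.* x) f + tsum d (2 ℕ.* x ℕ.+ 1) f

0≤tsum : ∀ d x {f} → (∀ y → 0ℚ ≤ f y) → 0ℚ ≤ tsum d x f
0≤tsum zero x f≥0 = f≥0 x
0≤tsum (suc d) x f≥0 = 0≤+ (0≤tsum d _ f≥0) (0≤tsum d _ f≥0)

y≤x+y : ∀ {x y} → 0ℚ ≤ x → y ≤ x + y
y≤x+y {x} {y} 0≤x = subst (y ≤_) (ℚ.+-comm y x) (x≤x+y 0≤x)

record GridLaws (G : Grid) (s tot : ℚ) (k₀ : ℕ) : Set where
  open Grid G
  field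
    size≡  : K ≡ suc k₀
    origin : r 0 ≡ 0ℚ
    powers : ∀ k → k ℕ.≤ k₀ → r (suc k) ≡ ρ ^ᵣ k * s
    1<ρ    : 1ℚ < ρ
    0<s    : 0ℚ < s
    top    : tot < ρ ^ᵣ k₀ * s

  0<ρ : 0ℚ < ρ
  0<ρ = ℚ.<-trans 0<1 1<ρ

  -- The grid jumps from 0 to s, so it cannot round numbers strictly in between. Sums of grid points
  -- never fall into this gap, nor do item values, s being the least positive one.
  grid-positive : ∀ {c} → c ℕ.< K → r c ≡ 0ℚ ⊎ s ≤ r c
  grid-positive {zero} _ = inj₁ origin
  grid-positive {suc c} c<K = inj₂ (subst₂ _≤_ (ℚ.*-identityˡ s)
    (sym (powers c (ℕ.<⇒≤ (ℕ.s≤s⁻¹ (subst (suc c ℕ.<_) size≡ c<K)))))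
    (*-monoˡ (ℚ.<⇒≤ 0<s) (1≤^ c (ℚ.<⇒≤ 1<ρ))))

  0≤grid : ∀ {c} → c ℕ.< K → 0ℚ ≤ r c
  0≤grid c<K with grid-positive c<K
  ... | inj₁ eq = ℚ.≤-reflexive (sym eq)
  ... | inj₂ s≤ = ℚ.≤-trans (ℚ.<⇒≤ 0<s) s≤

  -- The least exponent with z below its power is a successor, since s ≤ z; the power just before it
  -- is the rounding. Index 0 belongs to the point 0, so exponent k has index k + 1.
  round-down-positive : ∀ z → s ≤ z → z ≤ tot → ∃[ c ] (c ℕ.< K × 1 ℕ.≤ c × r c ≤ z × z ≤ ρ * r c)
  round-down-positive z s≤z z≤tot with minimal (λ k → z ℚ.<? ρ ^ᵣ k * s) {k₀} (ℚ.≤-<-trans z≤tot top)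
  ... | zero , z< , _ = ⊥-elim (ℚ.<-irrefl refl (ℚ.<-≤-trans z< (subst (_≤ z) (sym (ℚ.*-identityˡ s)) s≤z)))
  ... | suc k , z< , below = suc k , subst (suc k ℕ.<_) (sym size≡) (ℕ.s≤s k<k₀) , ℕ.s≤s ℕ.z≤n ,
    subst (_≤ z) (sym rk) (ℚ.≮⇒≥ (below k (ℕ.n<1+n k))) ,
    ℚ.<⇒≤ (subst (z <_) (trans (ℚ.*-assoc ρ (ρ ^ᵣ k) s) (cong (ρ *_) (sym rk))) z<)
    where
    k<k₀ : k ℕ.< k₀
    k<k₀ = ℕ.≮⇒≥ (λ k₀< → below k₀ k₀< (ℚ.≤-<-trans z≤tot top))
    rk = powers k (ℕ.<⇒≤ k<k₀)

  round-down : ∀ z → z ≡ 0ℚ ⊎ s ≤ z → z ≤ tot → ∃[ c ] (c ℕ.< K × r c ≤ z × z ≤ ρ * r c)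
  round-down z (inj₁ z≡0) _ = 0 , subst (0 ℕ.<_) (sym size≡) (ℕ.s≤s ℕ.z≤n) ,
    ℚ.≤-reflexive (trans origin (sym z≡0)) , ℚ.≤-reflexive (trans z≡0 (trans (sym (ℚ.*-zeroʳ ρ)) (cong (ρ *_) (sym origin))))
  round-down z (inj₂ s≤z) z≤tot with round-down-positive z s≤z z≤tot
  ... | c , c<K , _ , p , q = c , c<K , p , q

module Solution (ε : ℚ) (G : Grid) (t : Tables) (D : ℕ) where
  open Grid G
  open Tables t
  open Spec ε G

  record Solved : Set where
    field
      L≡ : L ≡ 2 ℕ.^ D
      0≤ρ : 0ℚ ≤ ρ
      leaf : ∀ y → AtLevel D y → LeafSound G t y × LeafComplete G t y K
      inner : ∀ x → 1 ℕ.≤ x → x ℕ.< L → SoundAt t x × CompleteAt t x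

  -- At height d the value has been rounded down d + 1 times.
  Near : ℕ → ℚ → ℕ → Set
  Near d v c = r c ≤ v × v ≤ ρ ^ᵣ suc d * r c

  -- Relative errors do not accumulate under addition: both summands share the factor ρ ^ (d + 1),
  -- and rounding the sum costs one more ρ.
  near-merge : ∀ {d v₁ v₂ a b c} → 0ℚ ≤ ρ → Near d v₁ a → Near d v₂ b → r c ≤ r a + r b → r a + r b ≤ ρ * r c → Near (suc d) (v₁ + v₂) c
  near-merge {d} {v₁} {v₂} {a} {b} {c} 0≤ρ (l₁ , u₁) (l₂ , u₂) c≤ ≤c = ℚ.≤-trans c≤ (ℚ.+-mono-≤ l₁ l₂) , (begin
    v₁ + v₂ ≤⟨ ℚ.+-mono-≤ u₁ u₂ ⟩
    ρ ^ᵣ suc d * r a + ρ ^ᵣ suc d * r b ≡⟨ ℚ.*-distribˡ-+ (ρ ^ᵣ suc d) (r a) (r b) ⟨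
    ρ ^ᵣ suc d * (r a + r b) ≤⟨ *-monoʳ (0≤^ (suc d) 0≤ρ) ≤c ⟩
    ρ ^ᵣ suc d * (ρ * r c) ≡⟨ ℚ.*-assoc (ρ ^ᵣ suc d) ρ (r c) ⟨
    ρ ^ᵣ suc d * ρ * r c ≡⟨ cong (_* r c) (ℚ.*-comm (ρ ^ᵣ suc d) ρ) ⟩
    ρ ^ᵣ suc (suc d) * r c ∎)
    where open ℚ.≤-Reasoning

  near-leaf : ∀ {v c} → r c ≤ v → v ≤ ρ * r c → Near 0 v c
  near-leaf {v} {c} p q = p , subst (λ z → v ≤ z * r c) (sym (ℚ.*-identityʳ ρ)) q

  module Descent (solved : Solved) (origin : r 0 ≡ 0ℚ) (e : ℕ → ℕ)
    (children : ∀ x → 1 ℕ.≤ x → x ℕ.< L → e (2 ℕ.* x) ≡ lc x (e x) × e (2 ℕ.* x ℕ.+ 1) ≡ rc x (e x))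
    (root : 1 ℕ.≤ ok 1 (e 1)) where
    open Solved solved

    keepIf : ℕ → ℚ → ℚ
    keepIf zero _ = 0ℚ
    keepIf (suc _) q = q

    outValue outWeight : ℕ → ℚ
    outValue y = keepIf (e y) (lv y)
    outWeight y = keepIf (e y) (lw y)

    node-< : ∀ {l d x} → l ℕ.+ suc d ≡ D → AtLevel l x → x ℕ.< L
    node-< {l} {d} {x} eq at = subst (x ℕ.<_) (trans (cong (2 ℕ.^_) eq) (sym L≡)) (atLevel-< {d = d} at)

    reached-children : ∀ {x} → 1 ℕ.≤ x → x ℕ.< L → 1 ℕ.≤ ok x (e x) →
      1 ℕ.≤ ok (2 ℕ.* x) (e (2 ℕ.* x)) × 1 ℕ.≤ ok (2 ℕ.* x ℕ.+ 1) (e (2 ℕ.* x ℕ.+ 1))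
    reached-children {x} 1≤x x<L h with proj₁ (inner x 1≤x x<L) (e x) h | children x 1≤x x<L
    ... | (h₁ , h₂ , _) , _ | c₁ , c₂ = subst (λ c → 1 ℕ.≤ ok (2 ℕ.* x) c) (sym c₁) h₁ , subst (λ c → 1 ℕ.≤ ok (2 ℕ.* x ℕ.+ 1) c) (sym c₂) h₂

    -- Induction from the root downward: soundness at a parent makes the entries chosen for its
    -- children valid.
    reached : ∀ l d {x} → l ℕ.+ d ≡ D → AtLevel l x → 1 ℕ.≤ ok x (e x)
    reached zero d {x} _ (1≤x , x<2) rewrite ℕ.≤-antisym (ℕ.s≤s⁻¹ x<2) 1≤x = root
    reached (suc l) d {x} eq at with halve x
    ... | y , inj₁ refl = proj₁ (reached-children (atLevel-≥1 aty) (node-< {d = d} eq′ aty) (reached l (suc d) eq′ aty))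
      where aty = atLevel-unleft {l} {y} at
            eq′ = trans (ℕ.+-suc l d) eq
    ... | y , inj₂ refl = proj₂ (reached-children (atLevel-≥1 aty) (node-< {d = d} eq′ aty) (reached l (suc d) eq′ aty))
      where aty = atLevel-unright {l} {y} at
            eq′ = trans (ℕ.+-suc l d) eq

    -- Induction from the leaves upward along the choices. Only values are rounded; weights add up
    -- exactly.
    out-near : ∀ d {l x} → l ℕ.+ d ≡ D → AtLevel l x →
      Near d (tsum d x outValue) (e x) × co x (e x) ≡ tsum d x outWeight
    out-near zero {l} {x} eq at with reached l 0 {x} eq at | trans (sym (ℕ.+-identityʳ l)) eq
    ... | h | refl with e x | proj₁ (leaf x at) (e x) h
    ...   | zero | inj₁ (_ , c≡0) = near-leaf {c = 0} (ℚ.≤-reflexive origin) (ℚ.≤-reflexive (sym (trans (cong (ρ *_) origin) (ℚ.*-zeroʳ ρ)))) , c≡0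
    ...   | zero | inj₂ ((() , _) , _)
    ...   | suc c | inj₂ ((_ , p , q) , c≡) = near-leaf {c = suc c} p q , c≡
    out-near (suc d) {l} {x} eq at with proj₁ (inner x (atLevel-≥1 at) (node-< {d = d} eq at)) (e x) (reached l (suc d) eq at)
                                      | children x (atLevel-≥1 at) (node-< {d = d} eq at)
                                      | out-near d {suc l} {2 ℕ.* x} (trans (sym (ℕ.+-suc l d)) eq) (atLevel-left at)
                                      | out-near d {suc l} {2 ℕ.* x ℕ.+ 1} (trans (sym (ℕ.+-suc l d)) eq) (atLevel-right at)
    ... | (_ , _ , p , q , _) , c≡ | c₁ , c₂ | n₁ , w₁ | n₂ , w₂ rewrite c₁ | c₂ =
      near-merge {d} {c = e x} 0≤ρ n₁ n₂ p q , trans c≡ (cong₂ _+_ w₁ w₂)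

    out-fits : ∀ d {l x} → l ℕ.+ suc d ≡ D → AtLevel l x → Fits x (e x)
    out-fits d {l} {x} eq at with proj₁ (inner x (atLevel-≥1 at) (node-< {d = d} eq at)) (e x) (reached l (suc d) eq at)
    ... | (_ , _ , _ , _ , f) , _ = f

  module Witness (solved : Solved) {s tot : ℚ} {k₀ : ℕ} (laws : GridLaws G s tot k₀) {p q : ℕ} (D≡ : p ℕ.+ suc q ≡ D)
    (M≡ : M ≡ 2 ℕ.^ p) (ρ^ : ρ ^ᵣ suc (suc q) ≤ 1ℚ + ε)
    (v w : ℕ → ℚ) (v≥0 : ∀ y → 0ℚ ≤ v y)
    -- The first case also covers selected items of value 0: the witness leaves them out, which
    -- keeps the value and does not raise the weight.
    (leafwise : ∀ y → AtLevel D y → (v y ≡ 0ℚ × 0ℚ ≤ w y) ⊎ (v y ≡ lv y × w y ≡ lw y × s ≤ lv y))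
    (within : ∀ x → InCategory x → lo (x ℕ.∸ M) ≤ tsum (suc q) x v × tsum (suc q) x v ≤ up (x ℕ.∸ M)) where
    open Solved solved
    open GridLaws laws

    category-height : ∀ {l d x} → l ℕ.+ d ≡ D → AtLevel l x → InCategory x → d ≡ suc q
    category-height {l} {d} {x} eq at (M≤x , x<2M) =
      ℕ.+-cancelˡ-≡ p d (suc q) (trans (trans (cong (ℕ._+ d) (sym l≡p)) eq) (sym D≡))
      where
      l≡p : l ≡ p
      l≡p = atLevel-unique {l} {p} at (subst (ℕ._≤ x) M≡ M≤x , subst₂ ℕ._≤_ (ℕ.+-comm x 1) (cong (2 ℕ.*_) M≡) x<2M)

    near-fits : ∀ {l d x c} → l ℕ.+ d ≡ D → AtLevel l x → c ℕ.< K → Near d (tsum d x v) c → Fits x c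
    near-fits {l} {d} {x} {c} eq at c<K (low , high) (cat , ¬ok) with category-height {l} {d} {x} eq at cat | within x cat
    ... | refl | lo≤ , ≤up = ¬ok (ℚ.≤-trans lo≤ (ℚ.≤-trans high (*-monoˡ (0≤grid c<K) ρ^)) , ℚ.≤-trans low ≤up)

    add-positive : ∀ {a b} → a ℕ.< K → b ℕ.< K → r a + r b ≡ 0ℚ ⊎ s ≤ r a + r b
    add-positive a<K b<K with grid-positive a<K | grid-positive b<K
    ... | inj₁ p | inj₁ q = inj₁ (cong₂ _+_ p q)
    ... | inj₂ p | _      = inj₂ (ℚ.≤-trans p (x≤x+y (0≤grid b<K)))
    ... | inj₁ _ | inj₂ q = inj₂ (ℚ.≤-trans q (y≤x+y (0≤grid a<K)))

    -- The rounded sum of the children's grid points is a candidate, so completeness bounds its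
    -- stored cost by the weight of the given selection. The bound by `tot` keeps every sum inside
    -- the grid.
    witness : ∀ d {l x} → l ℕ.+ d ≡ D → AtLevel l x → tsum d x v ≤ tot →
      ∃[ c ] (c ℕ.< K × Near d (tsum d x v) c × Within t x c (tsum d x w))
    witness zero {l} {x} eq at ≤tot with trans (sym (ℕ.+-identityʳ l)) eq
    ... | refl with leaf x at | leafwise x at
    ...   | sound , (ok₀ , _) | inj₁ (v≡0 , 0≤w) = 0 , subst (0 ℕ.<_) (sym size≡) (ℕ.s≤s ℕ.z≤n) ,
      near-leaf {c = 0} (ℚ.≤-reflexive (trans origin (sym v≡0)))
        (ℚ.≤-reflexive (trans v≡0 (sym (trans (cong (ρ *_) origin) (ℚ.*-zeroʳ ρ))))) ,
      ok₀ , subst (_≤ w x) (sym (free (sound 0 ok₀))) 0≤w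
      where
      free : (0 ≡ 0 × co x 0 ≡ 0ℚ) ⊎ (Rounded G x 0 × co x 0 ≡ lw x) → co x 0 ≡ 0ℚ
      free (inj₁ (_ , eq)) = eq
      free (inj₂ ((() , _) , _))
    ...   | sound , (_ , complete) | inj₂ (v≡ , w≡ , s≤) with round-down-positive (lv x) s≤ (subst (_≤ tot) v≡ ≤tot)
    ...     | c , c<K , 1≤c , p , q′ = c , c<K , near-leaf {c = c} (subst (r c ≤_) (sym v≡) p) (subst (_≤ ρ * r c) (sym v≡) q′) ,
      h , ℚ.≤-reflexive (trans (paid (sound c h)) (sym w≡))
      where
      h = complete c c<K (1≤c , p , q′)
      paid : (c ≡ 0 × co x c ≡ 0ℚ) ⊎ (Rounded G x c × co x c ≡ lw x) → co x c ≡ lw x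
      paid (inj₁ (refl , _)) = ⊥-elim (ℕ.<-irrefl refl 1≤c)
      paid (inj₂ (_ , eq)) = eq
    witness (suc d) {l} {x} eq at ≤tot
      with witness d {suc l} {2 ℕ.* x} (trans (sym (ℕ.+-suc l d)) eq) (atLevel-left at)
             (ℚ.≤-trans (x≤x+y (0≤tsum d (2 ℕ.* x ℕ.+ 1) v≥0)) ≤tot)
         | witness d {suc l} {2 ℕ.* x ℕ.+ 1} (trans (sym (ℕ.+-suc l d)) eq) (atLevel-right at)
             (ℚ.≤-trans (y≤x+y (0≤tsum d (2 ℕ.* x) v≥0)) ≤tot)
    ... | a , a<K , na , oka , wa | b , b<K , nb , okb , wb
      with round-down (r a + r b) (add-positive a<K b<K) (ℚ.≤-trans (ℚ.+-mono-≤ (proj₁ na) (proj₁ nb)) ≤tot)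
    ...   | c , c<K , p′ , q′ = c , c<K , near , proj₁ within-c , ℚ.≤-trans (proj₂ within-c) (ℚ.+-mono-≤ wa wb)
      where
      near : Near (suc d) (tsum (suc d) x v) c
      near = near-merge {d} {a = a} {b} {c} 0≤ρ na nb p′ q′
      x<L : x ℕ.< L
      x<L = subst (x ℕ.<_) (trans (cong (2 ℕ.^_) eq) (sym L≡)) (atLevel-< {d = d} at)
      within-c = proj₂ (inner x (atLevel-≥1 at) x<L) a b c a<K b<K c<K tt
        (oka , okb , p′ , q′ , near-fits {l} {suc d} {x} {c} eq at c<K near)

-- Sums over items as sums over the tree

rsum-cong : ∀ n {f g} → (∀ k → k ℕ.< n → f k ≡ g k) → rsum n f ≡ rsum n g
rsum-cong zero eq = refl
rsum-cong (suc n) eq = cong₂ _+_ (rsum-cong n (λ k k<n → eq k (ℕ.m<n⇒m<1+n k<n))) (eq n (ℕ.n<1+n n))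

rsum-0 : ∀ n {f} → (∀ k → k ℕ.< n → f k ≡ 0ℚ) → rsum n f ≡ 0ℚ
rsum-0 zero eq = refl
rsum-0 (suc n) eq = cong₂ _+_ (rsum-0 n (λ k k<n → eq k (ℕ.m<n⇒m<1+n k<n))) (eq n (ℕ.n<1+n n))

rsum-+ : ∀ m n f → rsum (m ℕ.+ n) f ≡ rsum m f + rsum n (λ k → f (m ℕ.+ k))
rsum-+ m zero f = trans (cong (λ z → rsum z f) (ℕ.+-identityʳ m)) (sym (ℚ.+-identityʳ _))
rsum-+ m (suc n) f = begin
  rsum (m ℕ.+ suc n) f ≡⟨ cong (λ z → rsum z f) (ℕ.+-suc m n) ⟩
  rsum (m ℕ.+ n) f + f (m ℕ.+ n) ≡⟨ cong (_+ f (m ℕ.+ n)) (rsum-+ m n f) ⟩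
  rsum m f + rsum n (λ k → f (m ℕ.+ k)) + f (m ℕ.+ n) ≡⟨ ℚ.+-assoc (rsum m f) _ _ ⟩
  rsum m f + rsum (suc n) (λ k → f (m ℕ.+ k)) ∎
  where open ≡-Reasoning

rsum-front : ∀ n f → rsum (suc n) f ≡ f 0 + rsum n (f ∘ suc)
rsum-front n f = trans (rsum-+ 1 n f) (cong (_+ rsum n (f ∘ suc)) (ℚ.+-identityˡ (f 0)))

rsum-pad : ∀ {m n} f → m ℕ.≤ n → (∀ k → m ℕ.≤ k → f k ≡ 0ℚ) → rsum n f ≡ rsum m f
rsum-pad {m} {n} f m≤n zeros = begin
  rsum n f ≡⟨ cong (λ z → rsum z f) (ℕ.m+[n∸m]≡n m≤n) ⟨
  rsum (m ℕ.+ (n ℕ.∸ m)) f ≡⟨ rsum-+ m (n ℕ.∸ m) f ⟩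
  rsum m f + rsum (n ℕ.∸ m) (λ k → f (m ℕ.+ k)) ≡⟨ cong (rsum m f +_) (rsum-0 (n ℕ.∸ m) (λ k _ → zeros (m ℕ.+ k) (ℕ.m≤m+n m k))) ⟩
  rsum m f + 0ℚ ≡⟨ ℚ.+-identityʳ _ ⟩
  rsum m f ∎
  where open ≡-Reasoning

rsum-∑ : ∀ {n} (f : Fin n → ℚ) g → (∀ i → g (toℕ i) ≡ f i) → rsum n g ≡ ∑ f
rsum-∑ {zero} f g eq = refl
rsum-∑ {suc n} f g eq = trans (rsum-front n g) (cong₂ _+_ (eq Fin.zero) (rsum-∑ (f ∘ Fin.suc) (g ∘ suc) (eq ∘ Fin.suc)))

0≤∑ : ∀ {n} (f : Fin n → ℚ) → (∀ i → 0ℚ ≤ f i) → 0ℚ ≤ ∑ f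
0≤∑ {zero} f _ = ℚ.≤-refl
0≤∑ {suc n} f f≥0 = 0≤+ (f≥0 Fin.zero) (0≤∑ (f ∘ Fin.suc) (f≥0 ∘ Fin.suc))

-- The descendants of x at relative depth d have consecutive heap numbers, from x · 2 ^ d on.
tsum-rsum : ∀ d x f → tsum d x f ≡ rsum (2 ℕ.^ d) (λ k → f (x ℕ.* 2 ℕ.^ d ℕ.+ k))
tsum-rsum zero x f = sym (trans (ℚ.+-identityˡ _) (cong f (trans (ℕ.+-identityʳ _) (ℕ.*-identityʳ x))))
tsum-rsum (suc d) x f = begin
  tsum d (2 ℕ.* x) f + tsum d (2 ℕ.* x ℕ.+ 1) f ≡⟨ cong₂ _+_ (tsum-rsum d (2 ℕ.* x) f) (tsum-rsum d (2 ℕ.* x ℕ.+ 1) f) ⟩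
  rsum n (λ k → f (2 ℕ.* x ℕ.* n ℕ.+ k)) + rsum n (λ k → f ((2 ℕ.* x ℕ.+ 1) ℕ.* n ℕ.+ k))
    ≡⟨ cong₂ _+_ (rsum-cong n (λ k _ → cong (λ z → f (z ℕ.+ k)) doubled)) (rsum-cong n (λ k _ → cong f (shift k))) ⟩
  rsum n (λ k → f (x ℕ.* (2 ℕ.* n) ℕ.+ k)) + rsum n (λ k → f (x ℕ.* (2 ℕ.* n) ℕ.+ (n ℕ.+ k))) ≡⟨ rsum-+ n n (λ k → f (x ℕ.* (2 ℕ.* n) ℕ.+ k)) ⟨
  rsum (n ℕ.+ n) (λ k → f (x ℕ.* (2 ℕ.* n) ℕ.+ k)) ≡⟨ cong (λ z → rsum z (λ k → f (x ℕ.* (2 ℕ.* n) ℕ.+ k))) (cong (n ℕ.+_) (sym (ℕ.+-identityʳ n))) ⟩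
  rsum (2 ℕ.* n) (λ k → f (x ℕ.* (2 ℕ.* n) ℕ.+ k)) ∎
  where
  open ≡-Reasoning
  n = 2 ℕ.^ d
  doubled : 2 ℕ.* x ℕ.* n ≡ x ℕ.* (2 ℕ.* n)
  doubled = trans (cong (ℕ._* n) (ℕ.*-comm 2 x)) (ℕ.*-assoc x 2 n)
  shift : ∀ k → (2 ℕ.* x ℕ.+ 1) ℕ.* n ℕ.+ k ≡ x ℕ.* (2 ℕ.* n) ℕ.+ (n ℕ.+ k)
  shift k = trans (cong (ℕ._+ k) (trans (ℕ.*-distribʳ-+ n (2 ℕ.* x) 1) (cong₂ ℕ._+_ doubled (ℕ.*-identityˡ n)))) (ℕ.+-assoc (x ℕ.* (2 ℕ.* n)) n k)

tsum-tsum : ∀ p q x f → tsum p x (λ y → tsum q y f) ≡ tsum (p ℕ.+ q) x f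
tsum-tsum zero q x f = refl
tsum-tsum (suc p) q x f = cong₂ _+_ (tsum-tsum p q _ f) (tsum-tsum p q _ f)

tsum-mono : ∀ d {l x f g} → AtLevel l x → (∀ y → AtLevel (l ℕ.+ d) y → f y ≤ g y) → tsum d x f ≤ tsum d x g
tsum-mono zero {l} {x} {f} {g} at f≤g = f≤g _ (subst (λ k → AtLevel k x) (sym (ℕ.+-identityʳ l)) at)
tsum-mono (suc d) {l} {x} {f} {g} at f≤g = ℚ.+-mono-≤
  (tsum-mono d (atLevel-left at) (λ y h → f≤g y (subst (λ k → AtLevel k y) (sym (ℕ.+-suc l d)) h)))
  (tsum-mono d (atLevel-right at) (λ y h → f≤g y (subst (λ k → AtLevel k y) (sym (ℕ.+-suc l d)) h)))

at-toℕ : ∀ {A : Set} {k} (z : A) (f : Fin k → A) i → at z f (toℕ i) ≡ f i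
at-toℕ {k = k} z f i with toℕ i ℕ.<? k
... | yes p = cong f (Fin.fromℕ<-toℕ i p)
... | no ¬p = ⊥-elim (¬p (Fin.toℕ<n i))

at-≥ : ∀ {A : Set} {k} (z : A) (f : Fin k → A) {a} → k ℕ.≤ a → at z f a ≡ z
at-≥ {k = k} z f {a} k≤a with a ℕ.<? k
... | yes p = ⊥-elim (ℕ.<⇒≱ p k≤a)
... | no _  = refl

module _ (I : Instance) where
  open Instance I

  PerItem : Set
  PerItem = (i : Fin m) → Fin (size i) → ℚ

  atItem : PerItem → ℕ → ℕ → ℚ
  atItem h i j = at 0ℚ (λ i′ → at 0ℚ (h i′) j) i

  atItem-toℕ : ∀ h i j → atItem h (toℕ i) (toℕ j) ≡ h i j
  atItem-toℕ h i j = trans (at-toℕ 0ℚ _ i) (at-toℕ 0ℚ (h i) j)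

  -- The case is chosen before `h`, so that value and weight at a position are read off for the same
  -- item.
  atItem-cases : ∀ i j → (∃[ i′ ] ∃[ j′ ] (toℕ i′ ≡ i × toℕ j′ ≡ j × (∀ h → atItem h i j ≡ h i′ j′))) ⊎ (∀ h → atItem h i j ≡ 0ℚ)
  atItem-cases i j with i ℕ.<? m
  ... | no _ = inj₂ (λ _ → refl)
  ... | yes i<m with j ℕ.<? size (fromℕ< i<m)
  ...   | no _ = inj₂ (λ _ → refl)
  ...   | yes j<s = inj₁ (fromℕ< i<m , fromℕ< j<s , Fin.toℕ-fromℕ< i<m , Fin.toℕ-fromℕ< j<s , λ _ → refl)

  -- Here q is the full exponent of the number of columns; it is later instantiated by `suc q`.
  module Layout (p q : ℕ) (m≤ : m ℕ.≤ 2 ℕ.^ p) (size≤ : ∀ i → size i ℕ.≤ 2 ℕ.^ q) where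

    M P : ℕ
    M = 2 ℕ.^ p
    P = 2 ℕ.^ q

    flat : ℕ → ℕ → ℕ
    flat i j = (M ℕ.+ i) ℕ.* P ℕ.+ j

    Represents : (ℕ → ℚ) → PerItem → Set
    Represents g h = ∀ i j → i ℕ.< M → j ℕ.< P → g (flat i j) ≡ atItem h i j

    category-sum : ∀ {g h} → Represents g h → ∀ i → tsum q (M ℕ.+ toℕ i) g ≡ ∑ (h i)
    category-sum {g} {h} rep i = begin
      tsum q (M ℕ.+ toℕ i) g ≡⟨ tsum-rsum q (M ℕ.+ toℕ i) g ⟩
      rsum P (λ j → g (flat (toℕ i) j)) ≡⟨ rsum-cong P (λ j j<P → rep (toℕ i) j (ℕ.<-≤-trans (Fin.toℕ<n i) m≤) j<P) ⟩
      rsum P (atItem h (toℕ i)) ≡⟨ rsum-pad (atItem h (toℕ i)) (size≤ i) (λ j s≤j → trans (at-toℕ 0ℚ (λ i′ → at 0ℚ (h i′) j) i) (at-≥ 0ℚ (h i) s≤j)) ⟩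
      rsum (size i) (atItem h (toℕ i)) ≡⟨ rsum-∑ (h i) _ (atItem-toℕ h i) ⟩
      ∑ (h i) ∎
      where open ≡-Reasoning

    empty-category-sum : ∀ {g h} → Represents g h → ∀ i → m ℕ.≤ i → i ℕ.< M → tsum q (M ℕ.+ i) g ≡ 0ℚ
    empty-category-sum {g} {h} rep i m≤i i<M = trans (tsum-rsum q (M ℕ.+ i) g)
      (rsum-0 P (λ j j<P → trans (rep i j i<M j<P) (at-≥ 0ℚ (λ i′ → at 0ℚ (h i′) j) m≤i)))

    total-sum : ∀ {g h} → Represents g h → tsum (p ℕ.+ q) 1 g ≡ ∑ (λ i → ∑ (h i))
    total-sum {g} {h} rep = begin
      tsum (p ℕ.+ q) 1 g ≡⟨ tsum-tsum p q 1 g ⟨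
      tsum p 1 (λ y → tsum q y g) ≡⟨ tsum-rsum p 1 (λ y → tsum q y g) ⟩
      rsum M (λ i → tsum q (1 ℕ.* M ℕ.+ i) g) ≡⟨ rsum-cong M (λ i _ → cong (λ z → tsum q (z ℕ.+ i) g) (ℕ.*-identityˡ M)) ⟩
      rsum M (λ i → tsum q (M ℕ.+ i) g) ≡⟨ rsum-cong M rows-eq ⟩
      rsum M row ≡⟨ rsum-pad row m≤ (λ i m≤i → at-≥ 0ℚ (λ i′ → ∑ (h i′)) m≤i) ⟩
      rsum m row ≡⟨ rsum-∑ _ row (at-toℕ 0ℚ (λ i → ∑ (h i))) ⟩
      ∑ (λ i → ∑ (h i)) ∎
      where
      open ≡-Reasoning
      row : ℕ → ℚ
      row = at 0ℚ (λ i → ∑ (h i))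
      rows-eq : ∀ i → i ℕ.< M → tsum q (M ℕ.+ i) g ≡ row i
      rows-eq i i<M with i ℕ.<? m
      ... | yes i<m = trans (cong (λ z → tsum q (M ℕ.+ z) g) (sym (Fin.toℕ-fromℕ< i<m))) (category-sum {g} {h} rep (fromℕ< i<m))
      ... | no i≮m = empty-category-sum {g} {h} rep i (ℕ.≮⇒≥ i≮m) i<M

    private instance
      P≢0 : ℕ.NonZero P
      P≢0 = ℕ.m^n≢0 2 q

    rowOf columnOf : ℕ → ℕ
    rowOf y = y ℕ./ P ℕ.∸ M
    columnOf y = y ℕ.% P

    column< : ∀ y → columnOf y ℕ.< P
    column< y = m%n<n y P

    MP≡ : 2 ℕ.^ (p ℕ.+ q) ≡ M ℕ.* P
    MP≡ = ℕ.^-distribˡ-+-* 2 p q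

    flat-decode : ∀ y → AtLevel (p ℕ.+ q) y → y ≡ flat (rowOf y) (columnOf y) × rowOf y ℕ.< M
    flat-decode y (≤y , y<) = trans y≡ (cong (λ z → z ℕ.* P ℕ.+ columnOf y) (sym (ℕ.m+[n∸m]≡n M≤))) ,
      ℕ.+-cancelˡ-< M (rowOf y) M (subst (ℕ._< M ℕ.+ M) (sym (ℕ.m+[n∸m]≡n M≤)) <2M)
      where
      y≡ : y ≡ (y ℕ./ P) ℕ.* P ℕ.+ columnOf y
      y≡ = trans (m≡m%n+[m/n]*n y P) (ℕ.+-comm (y ℕ.% P) _)
      M≤ : M ℕ.≤ y ℕ./ P
      M≤ = ℕ.s≤s⁻¹ (ℕ.*-cancelʳ-< P M (suc (y ℕ./ P)) (begin-strict
        M ℕ.* P ≡⟨ MP≡ ⟨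
        2 ℕ.^ (p ℕ.+ q) ≤⟨ ≤y ⟩
        y ≡⟨ y≡ ⟩
        (y ℕ./ P) ℕ.* P ℕ.+ columnOf y <⟨ ℕ.+-monoʳ-< ((y ℕ./ P) ℕ.* P) (column< y) ⟩
        (y ℕ./ P) ℕ.* P ℕ.+ P ≡⟨ ℕ.+-comm _ P ⟩
        suc (y ℕ./ P) ℕ.* P ∎))
        where open ℕ.≤-Reasoning
      <2M : y ℕ./ P ℕ.< M ℕ.+ M
      <2M = ℕ.*-cancelʳ-< P (y ℕ./ P) (M ℕ.+ M) (begin-strict
        (y ℕ./ P) ℕ.* P ≤⟨ ℕ.m≤m+n _ (columnOf y) ⟩
        (y ℕ./ P) ℕ.* P ℕ.+ columnOf y ≡⟨ y≡ ⟨
        y <⟨ y< ⟩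
        2 ℕ.* 2 ℕ.^ (p ℕ.+ q) ≡⟨ cong (2 ℕ.*_) MP≡ ⟩
        2 ℕ.* (M ℕ.* P) ≡⟨ ℕ.*-assoc 2 M P ⟨
        2 ℕ.* M ℕ.* P ≡⟨ cong (λ z → (M ℕ.+ z) ℕ.* P) (ℕ.+-identityʳ M) ⟩
        (M ℕ.+ M) ℕ.* P ∎)
        where open ℕ.≤-Reasoning

    flat-atLevel : ∀ {i j} → i ℕ.< M → j ℕ.< P → AtLevel (p ℕ.+ q) (flat i j)
    flat-atLevel {i} {j} i<M j<P =
      ℕ.≤-trans (ℕ.≤-reflexive MP≡) (ℕ.≤-trans (ℕ.*-monoˡ-≤ P (ℕ.m≤m+n M i)) (ℕ.m≤m+n _ j)) ,
      (begin-strict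
        flat i j <⟨ ℕ.+-monoʳ-< ((M ℕ.+ i) ℕ.* P) j<P ⟩
        (M ℕ.+ i) ℕ.* P ℕ.+ P ≡⟨ ℕ.+-comm _ P ⟩
        suc (M ℕ.+ i) ℕ.* P ≤⟨ ℕ.*-monoˡ-≤ P (ℕ.+-monoʳ-< M i<M) ⟩
        (M ℕ.+ M) ℕ.* P ≡⟨ cong (λ z → (M ℕ.+ z) ℕ.* P) (ℕ.+-identityʳ M) ⟨
        2 ℕ.* M ℕ.* P ≡⟨ ℕ.*-assoc 2 M P ⟩
        2 ℕ.* (M ℕ.* P) ≡⟨ cong (2 ℕ.*_) MP≡ ⟨
        2 ℕ.^ suc (p ℕ.+ q) ∎)
      where open ℕ.≤-Reasoning

    spread : PerItem → ℕ → ℚ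
    spread h y = atItem h (rowOf y) (columnOf y)

    spread-represents : ∀ h → Represents (spread h) h
    spread-represents h i j i<M j<P with flat-decode (flat i j) (flat-atLevel i<M j<P)
    ... | eq , _ with flat-injective M P j<P (column< (flat i j)) eq
    ...   | i≡ , j≡ = cong₂ (atItem h) (sym i≡) (sym j≡)

-- The interface between program and mathematics: correctness of the output is derived from these
-- facts alone, without reference to commands.
record Outcome (ε : ℚ) (G : Grid) (ch : ℕ → ℕ → ℕ) : Set where
  open Grid G
  open Spec ε G
  field
    tables   : Tables
    entries  : ℕ → ℕ
    root     : ℕ
    leaf     : ∀ y → L ℕ.≤ y → y ℕ.< L ℕ.+ L → LeafSound G tables y × LeafComplete G tables y K
    inner    : ∀ x → 1 ℕ.≤ x → x ℕ.< L → SoundAt tables x × CompleteAt tables x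
    largest  : ∀ c → c ℕ.< K → Affordable G tables c → c ℕ.≤ root × root ℕ.< K × Affordable G tables root
    root≡    : entries 1 ≡ root
    children : ∀ x → 1 ℕ.≤ x → x ℕ.< L →
               entries (2 ℕ.* x) ≡ Tables.lc tables x (entries x) × entries (2 ℕ.* x ℕ.+ 1) ≡ Tables.rc tables x (entries x)
    chosen≡  : ∀ i j → i ℕ.< M → j ℕ.< P → ch i j ≡ entries ((M ℕ.+ i) ℕ.* P ℕ.+ j)

module _ (ε : ℚ) (G : Grid) where
  open Grid G using (L; K; M; P; shp)

  solveTime : ℕ
  solveTime =
    forTime (! leaves) L (4 ℕ.+ (4 ℕ.+ (4 ℕ.+ forTime (! gridSize) K 40))) ℕ.+ (
    forTime (! leaves ⊖ lit 1) (L ℕ.∸ 1) (6 ℕ.+ forTime (! gridSize) K (forTime (! gridSize) K (forTime (! gridSize) K 150))) ℕ.+ (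
    (2 ℕ.+ forTime (! gridSize) K 20) ℕ.+ (
    (3 ℕ.+ forTime (! leaves ⊖ lit 1) (L ℕ.∸ 1) 23) ℕ.+
    forTime (! rows) M (forTime (! columns) P 11))))

  exec-solve : ∀ {σ} → gridOf σ ≡ G → Fresh σ →
    Exec (solve ε) σ (λ τ → Outcome ε G (λ i j → nat τ chosen (i ∷ j ∷ []))) solveTime
  exec-solve g fresh =
    exec-seq (exec-enterLeaves G g fresh) λ { σ₁ (mkFilled g₁ empty filled) →
    exec-seq (exec-mergeAll ε G (tablesOf σ₁) g₁ (λ y c → refl , refl , refl , refl) (λ y c y<L → empty y c (inj₁ y<L))) λ { σ₂ (mkSolved g₂ frame _ solved) →
    exec-seq (exec-select G (tablesOf σ₂) g₂ refl) λ { σ₃ (mkSelected g₃ t₃ largest) →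
    exec-seq (exec-descend G (tablesOf σ₂) g₃ t₃ refl) λ { σ₄ (mkDescended g₄ t₄ root children) →
    exec-weaken (exec-unload shp (λ y → nat σ₄ entry (y ∷ [])) {σ₄} (cong Grid.shp g₄) refl)
      (λ { (mkUnloaded _ _ unloaded) → record
        { tables = tablesOf σ₂
        ; entries = λ y → nat σ₄ entry (y ∷ [])
        ; root = nat σ₃ best []
        ; leaf = λ y L≤y y<2L → leaf-resp G {tablesOf σ₁} {tablesOf σ₂} (frame y L≤y) (filled y L≤y y<2L)
        ; inner = λ x 1≤x x<L → solved x x<L (subst (ℕ._≤ x ℕ.+ (L ℕ.∸ 1)) (ℕ.m+[n∸m]≡n {1} (ℕ.≤-trans 1≤x (ℕ.<⇒≤ x<L))) (ℕ.+-monoˡ-≤ (L ℕ.∸ 1) 1≤x))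
        ; largest = largest
        ; root≡ = root
        ; children = λ x 1≤x x<L → children x 1≤x (ℕ.∸-monoˡ-≤ 1 x<L)
        ; chosen≡ = λ i j i<M j<P → unloaded i j j<P i<M
        } })
      ℕ.≤-refl } } } }

-- Correctness of the output

-- (1 - ε) (1 + ε) = 1 - ε² ≤ 1. This turns the factor lost in rounding into the one of the
-- statement.
≤-relax : ∀ {ε x y} → 0ℚ ≤ ε → 0ℚ ≤ 1ℚ - ε → 0ℚ ≤ y → x ≤ (1ℚ + ε) * y → (1ℚ - ε) * x ≤ y
≤-relax {ε} {x} {y} 0≤ε 0≤1-ε 0≤y le = begin
  (1ℚ - ε) * x ≤⟨ *-monoʳ 0≤1-ε le ⟩
  (1ℚ - ε) * ((1ℚ + ε) * y) ≤⟨ x≤x+y (0≤* (0≤* 0≤ε 0≤ε) 0≤y) ⟩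
  (1ℚ - ε) * ((1ℚ + ε) * y) + ε * ε * y ≡⟨ eq ε y ⟩
  y ∎
  where
  open ℚ.≤-Reasoning
  eq : ∀ ε y → (1ℚ - ε) * ((1ℚ + ε) * y) + ε * ε * y ≡ y
  eq = solve-∀ ℚ-ring

module _ (I : Instance) where
  open Instance I

  selected : Selection I → PerItem I → PerItem I
  selected X h i j = if lookup (X i) j then h i j else 0ℚ

  selected≥0 : ∀ X {h} → (∀ i j → 0ℚ ≤ h i j) → ∀ i j → 0ℚ ≤ selected X h i j
  selected≥0 X h≥0 i j with lookup (X i) j
  ... | true = h≥0 i j
  ... | false = ℚ.≤-refl

  read : (ℕ → ℕ → ℕ) → Selection I
  read ch i = tabulate (λ j → does (0 ℕ.<? ch (toℕ i) (toℕ j)))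

  shapeFor : ℕ → ℕ → Shape
  shapeFor p q = mkShape (inputs (input I)) (2 ℕ.^ p) (2 ℕ.^ suc q) (2 ℕ.+ p ℕ.+ q) (2 ℕ.^ p ℕ.* 2 ℕ.^ suc q)

  module Correctness {ε : ℚ} (0≤ε : 0ℚ ≤ ε) (0≤1-ε : 0ℚ ≤ 1ℚ - ε) (p q : ℕ)
    (m≤ : m ℕ.≤ 2 ℕ.^ p) (size≤ : ∀ i → size i ℕ.≤ 2 ℕ.^ suc q)
    (lv lw : ℕ → ℚ) (ρ : ℚ) (K : ℕ) (r : ℕ → ℚ) where

    G : Grid
    G = mkGrid (mkLeaves (shapeFor p q) lv lw) ρ K r

    open Layout I p (suc q) m≤ size≤
    open Spec ε G
    D : ℕ
    D = p ℕ.+ suc q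

    L : ℕ
    L = M ℕ.* P

    module _ (lv-rep : Represents lv v) (lw-rep : Represents lw w) {s : ℚ} {k₀ : ℕ}
      (laws : GridLaws G s (tsum D 1 lv) k₀) (least : ∀ k → k ℕ.< L → 0ℚ < lv (L ℕ.+ k) → s ≤ lv (L ℕ.+ k))
      (ρ^ : ρ ^ᵣ (2 ℕ.+ p ℕ.+ q) ≤ 1ℚ + ε) {ch : ℕ → ℕ → ℕ} (outcome : Outcome ε G ch) where
      open GridLaws laws
      open Outcome outcome
      open Solution ε G tables D
      open Tables tables

      leafLevel : ∀ {y} → AtLevel D y → L ℕ.≤ y × y ℕ.< L ℕ.+ L
      leafLevel {y} (≤y , y<) = subst (ℕ._≤ y) MP≡ ≤y ,
        subst (y ℕ.<_) (trans (cong (2 ℕ.*_) MP≡) (cong (L ℕ.+_) (ℕ.+-identityʳ L))) y<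

      solved : Solved
      solved = record
        { L≡ = sym MP≡
        ; 0≤ρ = ℚ.<⇒≤ 0<ρ
        ; leaf = λ y at → leaf y (proj₁ (leafLevel at)) (proj₂ (leafLevel at))
        ; inner = inner
        }

      private
        root-level : AtLevel 0 1
        root-level = ℕ.≤-refl , ℕ.≤-refl

        category-level : ∀ {i} → i ℕ.< M → AtLevel p (M ℕ.+ i)
        category-level {i} i<M = ℕ.m≤m+n M i , subst (M ℕ.+ i ℕ.<_) (cong (M ℕ.+_) (sym (ℕ.+-identityʳ M))) (ℕ.+-monoʳ-< M i<M)

        toℕ<M : ∀ (k : Fin m) → toℕ k ℕ.< M
        toℕ<M k = ℕ.<-≤-trans (Fin.toℕ<n k) m≤

        in-category : ∀ k → InCategory (M ℕ.+ toℕ k)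
        in-category k = ℕ.m≤m+n M (toℕ k) ,
          subst (ℕ._≤ 2 ℕ.* M) (ℕ.+-comm 1 (M ℕ.+ toℕ k)) (AtLevel.to (category-level (toℕ<M k)))

        ρ^-≤ : ∀ {k} → k ℕ.≤ 2 ℕ.+ p ℕ.+ q → ρ ^ᵣ k ≤ 1ℚ + ε
        ρ^-≤ {k} k≤ = ℚ.≤-trans (^-monoʳ {ρ} {k} {2 ℕ.+ p ℕ.+ q} (ℚ.<⇒≤ 1<ρ) k≤) ρ^

        ρ^category : ρ ^ᵣ suc (suc q) ≤ 1ℚ + ε
        ρ^category = ρ^-≤ {suc (suc q)} (ℕ.s≤s (ℕ.s≤s (ℕ.m≤n+m q p)))

        -- D + 1 = 2 + p + q is the number of roundings from leaf to root, both included; hence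
        -- `levels` starts at 2.
        ρ^root : ρ ^ᵣ suc D ≤ 1ℚ + ε
        ρ^root = ρ^-≤ {suc D} (ℕ.≤-reflexive (cong suc (ℕ.+-suc p q)))

        grid-mono : ∀ {c d} → c ℕ.≤ d → d ℕ.< K → r c ≤ r d
        grid-mono {zero} {d} _ d<K = subst (_≤ r d) (sym origin) (0≤grid d<K)
        grid-mono {suc c} {suc d} (ℕ.s≤s c≤d) d<K = subst₂ _≤_ (sym (powers c (ℕ.≤-trans c≤d d≤k₀))) (sym (powers d d≤k₀))
          (*-monoˡ (ℚ.<⇒≤ 0<s) (^-monoʳ {ρ} {c} {d} (ℚ.<⇒≤ 1<ρ) c≤d))
          where
          d≤k₀ : d ℕ.≤ k₀
          d≤k₀ = ℕ.<⇒≤ (ℕ.s≤s⁻¹ (subst (suc d ℕ.<_) size≡ d<K))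

        atItem≥0 : ∀ {h} → (∀ i j → 0ℚ ≤ h i j) → ∀ i j → 0ℚ ≤ atItem I h i j
        atItem≥0 {h} h≥0 i j with atItem-cases I i j
        ... | inj₁ (i′ , j′ , _ , _ , eq) = subst (0ℚ ≤_) (sym (eq h)) (h≥0 i′ j′)
        ... | inj₂ eq = ℚ.≤-reflexive (sym (eq h))

      module _ (X : Selection I) (feasible : Feasible I X) where
        private
          xv xw : ℕ → ℚ
          xv = spread (selected X v)
          xw = spread (selected X w)

          lv-decode : ∀ y → AtLevel D y → ∀ {g h} → Represents g h → g y ≡ spread h y
          lv-decode y at {g} rep with flat-decode y at
          ... | eq , row< = trans (cong g eq) (rep (rowOf y) (columnOf y) row< (column< y))

          above-least : ∀ y → AtLevel D y → 0ℚ < lv y → s ≤ lv y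
          above-least y at 0<lv with leafLevel at
          ... | L≤y , y<2L = subst (λ z → s ≤ lv z) y≡
            (least (y ℕ.∸ L) (ℕ.+-cancelˡ-< L _ L (subst (ℕ._< L ℕ.+ L) (sym y≡) y<2L)) (subst (λ z → 0ℚ < lv z) (sym y≡) 0<lv))
            where
            y≡ : L ℕ.+ (y ℕ.∸ L) ≡ y
            y≡ = ℕ.m+[n∸m]≡n L≤y

          leafwise : ∀ y → AtLevel D y → (xv y ≡ 0ℚ × 0ℚ ≤ xw y) ⊎ (xv y ≡ lv y × xw y ≡ lw y × s ≤ lv y)
          leafwise y at with atItem-cases I (rowOf y) (columnOf y) | lv-decode y at {lv} {v} lv-rep | lv-decode y at {lw} {w} lw-rep
          ... | inj₂ eq | _ | _ = inj₁ (eq (selected X v) , ℚ.≤-reflexive (sym (eq (selected X w))))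
          ... | inj₁ (i , j , _ , _ , eq) | lv≡ | lw≡ rewrite eq (selected X v) | eq (selected X w) | eq v | eq w with lookup (X i) j
          ...   | false = inj₁ (refl , ℚ.≤-refl)
          ...   | true with v i j ℚ.≟ 0ℚ
          ...     | yes v≡0 = inj₁ (v≡0 , w≥0 i j)
          ...     | no v≢0 = inj₂ (sym lv≡ , sym lw≡ , above-least y at (subst (0ℚ <_) (sym lv≡) (ℚ.≰⇒> (λ v≤0 → v≢0 (ℚ.≤-antisym v≤0 (v≥0 i j))))))

          xv≤lv : ∀ y → AtLevel D y → xv y ≤ lv y
          xv≤lv y at with leafwise y at
          ... | inj₁ (xv≡0 , _) = subst₂ _≤_ (sym xv≡0) (sym (lv-decode y at {lv} {v} lv-rep)) (atItem≥0 v≥0 _ _)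
          ... | inj₂ (xv≡lv , _) = ℚ.≤-reflexive xv≡lv

          within : ∀ x → InCategory x → at 0ℚ l (x ℕ.∸ M) ≤ tsum (suc q) x xv × tsum (suc q) x xv ≤ at 0ℚ u (x ℕ.∸ M)
          within x (M≤x , x<2M) = subst (λ z → at 0ℚ l i ≤ tsum (suc q) z xv × tsum (suc q) z xv ≤ at 0ℚ u i) x≡ (bounds (i ℕ.<? m))
            where
            i = x ℕ.∸ M
            x≡ : M ℕ.+ i ≡ x
            x≡ = ℕ.m+[n∸m]≡n M≤x
            i<M : i ℕ.< M
            i<M = ℕ.+-cancelˡ-< M i M (subst₂ ℕ._<_ (sym x≡) (cong (M ℕ.+_) (ℕ.+-identityʳ M)) (subst (ℕ._≤ 2 ℕ.* M) (ℕ.+-comm x 1) x<2M))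
            bounds : Dec (i ℕ.< m) → at 0ℚ l i ≤ tsum (suc q) (M ℕ.+ i) xv × tsum (suc q) (M ℕ.+ i) xv ≤ at 0ℚ u i
            -- In a padding category both bounds are 0 by the default of `at`, and the sum is 0.
            bounds (no i≮m) rewrite empty-category-sum {xv} (spread-represents (selected X v)) i (ℕ.≮⇒≥ i≮m) i<M =
              ℚ.≤-reflexive (at-≥ 0ℚ l (ℕ.≮⇒≥ i≮m)) , ℚ.≤-reflexive (sym (at-≥ 0ℚ u (ℕ.≮⇒≥ i≮m)))
            bounds (yes i<m) = subst (λ z → at 0ℚ l z ≤ tsum (suc q) (M ℕ.+ z) xv × tsum (suc q) (M ℕ.+ z) xv ≤ at 0ℚ u z) (Fin.toℕ-fromℕ< i<m)
              (subst₂ _≤_ (sym (at-toℕ 0ℚ l k)) (sym sum≡) (proj₁ (proj₁ feasible k)) ,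
               subst₂ _≤_ (sym sum≡) (sym (at-toℕ 0ℚ u k)) (proj₂ (proj₁ feasible k)))
              where
              k = fromℕ< i<m
              sum≡ = category-sum {xv} (spread-represents (selected X v)) k

          open Witness solved laws {p} {q} refl refl ρ^category xv xw (λ y → atItem≥0 (selected≥0 X v≥0) _ _) leafwise within

        -- The index c witnessing X is affordable, so the selected root index is at least c, and the
        -- grid is increasing.
        feasible-bound : root ℕ.< K × Affordable G tables root × totalValue I X ≤ (1ℚ + ε) * r root
        feasible-bound with witness D refl root-level (tsum-mono D root-level xv≤lv)
        ... | c , c<K , (_ , high) , ok-c , co-c with largest c c<K (ok-c , ℚ.≤-trans co-c weight≤)
          where
          weight≤ : tsum D 1 xw ≤ B
          weight≤ = ℚ.≤-trans (ℚ.≤-reflexive (total-sum {xw} (spread-represents (selected X w)))) (proj₂ feasible)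
        ...   | c≤ , root<K , aff = root<K , aff , (begin
          totalValue I X ≡⟨ total-sum {xv} (spread-represents (selected X v)) ⟨
          tsum D 1 xv ≤⟨ high ⟩
          ρ ^ᵣ suc D * r c ≤⟨ *-monoˡ (0≤grid c<K) ρ^root ⟩
          (1ℚ + ε) * r c ≤⟨ *-monoʳ (0≤+ 0≤1 0≤ε) (grid-mono c≤ root<K) ⟩
          (1ℚ + ε) * r root ∎)
          where open ℚ.≤-Reasoning

      module _ (afford : Affordable G tables root) (root<K : root ℕ.< K) where
        open Descent solved origin entries children (subst (λ c → 1 ℕ.≤ ok 1 c) (sym root≡) (proj₁ afford))

        private
          Y : Selection I
          Y = read ch

          out-represents : ∀ {g h} → Represents g h → Represents (λ y → keepIf (entries y) (g y)) (selected Y h)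
          out-represents {g} {h} rep i j i<M j<P with atItem-cases I i j | rep i j i<M j<P
          ... | inj₂ eq | g≡ rewrite eq (selected Y h) = trans (cong (keepIf (entries (flat i j))) (trans g≡ (eq h))) (keep0 (entries (flat i j)))
            where
            keep0 : ∀ k → keepIf k 0ℚ ≡ 0ℚ
            keep0 zero = refl
            keep0 (suc _) = refl
          ... | inj₁ (i′ , j′ , refl , refl , eq) | g≡ = begin
            keepIf (entries (flat i j)) (g (flat i j)) ≡⟨ cong₂ keepIf (sym (chosen≡ i j i<M j<P)) (trans g≡ (eq h)) ⟩
            keepIf (ch i j) (h i′ j′) ≡⟨ keep-if (ch i j) ⟩
            (if does (0 ℕ.<? ch i j) then h i′ j′ else 0ℚ) ≡⟨ cong (λ b → if b then h i′ j′ else 0ℚ) (lookup∘tabulate (λ j → does (0 ℕ.<? ch (toℕ i′) (toℕ j))) j′) ⟨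
            selected Y h i′ j′ ≡⟨ eq (selected Y h) ⟨
            atItem I (selected Y h) i j ∎
            where
            open ≡-Reasoning
            keep-if : ∀ k → keepIf k (h i′ j′) ≡ (if does (0 ℕ.<? k) then h i′ j′ else 0ℚ)
            keep-if zero = refl
            keep-if (suc _) = refl

          value-represents = out-represents {lv} {v} lv-rep
          weight-represents = out-represents {lw} {w} lw-rep

        output-weight : totalWeight I Y ≤ B
        output-weight = begin
          totalWeight I Y ≡⟨ total-sum {outWeight} weight-represents ⟨
          tsum D 1 outWeight ≡⟨ proj₂ (out-near D refl root-level) ⟨
          co 1 (entries 1) ≡⟨ cong (co 1) root≡ ⟩
          co 1 root ≤⟨ proj₂ afford ⟩
          B ∎
          where open ℚ.≤-Reasoning

        output-value : r root ≤ totalValue I Y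
        output-value = subst₂ _≤_ (cong r root≡) (total-sum {outValue} value-represents) (proj₁ (proj₁ (out-near D refl root-level)))

        output-category : ∀ k → (1ℚ - ε) * l k ≤ categoryValue I Y k × categoryValue I Y k ≤ (1ℚ + ε) * u k
        output-category k with out-near (suc q) {p} {M ℕ.+ toℕ k} refl (category-level (toℕ<M k))
        ... | (low , high) , _ =
          ℚ.≤-trans (≤-relax 0≤ε 0≤1-ε 0≤rx (subst (_≤ (1ℚ + ε) * rx) lo≡ (proj₁ bounds))) (subst (rx ≤_) V≡ low) ,
          (begin
            categoryValue I Y k ≡⟨ V≡ ⟨
            V ≤⟨ high ⟩
            ρ ^ᵣ suc (suc q) * rx ≤⟨ *-monoˡ 0≤rx ρ^category ⟩
            (1ℚ + ε) * rx ≤⟨ *-monoʳ (0≤+ 0≤1 0≤ε) (subst (rx ≤_) up≡ (proj₂ bounds)) ⟩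
            (1ℚ + ε) * u k ∎)
          where
          open ℚ.≤-Reasoning
          x = M ℕ.+ toℕ k
          rx = r (entries x)
          V = tsum (suc q) x outValue
          V≡ : V ≡ categoryValue I Y k
          V≡ = category-sum {outValue} value-represents k
          0≤V : 0ℚ ≤ V
          0≤V = subst (0ℚ ≤_) (sym V≡) (0≤∑ (selected Y v k) (selected≥0 Y v≥0 k))
          -- `entries x` is not known to lie below K, so the sign is obtained from 0 ≤ V ≤ ρ ^ (q +
          -- 2) · rx.
          0≤rx : 0ℚ ≤ rx
          0≤rx = *-cancelʳ (0<^ (suc (suc q)) 0<ρ) (subst₂ _≤_ (sym (ℚ.*-zeroˡ (ρ ^ᵣ suc (suc q)))) (ℚ.*-comm (ρ ^ᵣ suc (suc q)) rx) (ℚ.≤-trans 0≤V high))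
          index≡ : x ℕ.∸ M ≡ toℕ k
          index≡ = ℕ.m+n∸m≡n M (toℕ k)
          lo≡ : at 0ℚ l (x ℕ.∸ M) ≡ l k
          lo≡ = trans (cong (at 0ℚ l) index≡) (at-toℕ 0ℚ l k)
          up≡ : at 0ℚ u (x ℕ.∸ M) ≡ u k
          up≡ = trans (cong (at 0ℚ u) index≡) (at-toℕ 0ℚ u k)
          bounds : at 0ℚ l (x ℕ.∸ M) ≤ (1ℚ + ε) * rx × rx ≤ at 0ℚ u (x ℕ.∸ M)
          bounds = decidable-stable ((_ ℚ.≤? _) ×-dec (_ ℚ.≤? _))
            (λ ¬b → out-fits q {p} {x} refl (category-level (toℕ<M k)) (in-category k , ¬b))

        output-near-optimal : ∀ X → Feasible I X → (1ℚ - ε) * totalValue I X ≤ totalValue I Y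
        output-near-optimal X feasible = ℚ.≤-trans (≤-relax 0≤ε 0≤1-ε (0≤grid root<K) (proj₂ (proj₂ (feasible-bound X feasible)))) output-value

-- Running time

infix 4 _≲_·_

-- The unit u ≥ 1 is kept apart from the constant a, so that lower-order terms
-- can be absorbed into a.
record _≲_·_ (T a u : ℕ) : Set where
  constructor _,_
  field
    unit≥1 : 1 ℕ.≤ u
    bounded : T ℕ.≤ a ℕ.* u

-- The summand 12 + 2 · `costN e` adds the overhead 7 + `costN e` of a round to the overhead 5 +
-- `costN e` outside the rounds.
forTime-≲ : ∀ {e n N T a u} → T ≲ a · u → 1 ℕ.≤ N → n ℕ.≤ N → forTime e n T ≲ a ℕ.+ (12 ℕ.+ 2 ℕ.* costN e) · N ℕ.* u
forTime-≲ {e} {n} {N} {T} {a} {u} (1≤u , T≤) 1≤N n≤N = ℕ.*-mono-≤ 1≤N 1≤u , (begin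
  n ℕ.* (T ℕ.+ (7 ℕ.+ c)) ℕ.+ (5 ℕ.+ c) ≤⟨ ℕ.+-mono-≤ (ℕ.*-mono-≤ n≤N (ℕ.+-mono-≤ T≤ (k≤k*u (7 ℕ.+ c) 1≤u))) (k≤k*u (5 ℕ.+ c) (ℕ.*-mono-≤ 1≤N 1≤u)) ⟩
  N ℕ.* (a ℕ.* u ℕ.+ (7 ℕ.+ c) ℕ.* u) ℕ.+ (5 ℕ.+ c) ℕ.* (N ℕ.* u) ≡⟨ eq N a u c ⟩
  (a ℕ.+ (12 ℕ.+ 2 ℕ.* c)) ℕ.* (N ℕ.* u) ∎)
  where
  open ℕ.≤-Reasoning
  c = costN e
  k≤k*u : ∀ k {u} → 1 ℕ.≤ u → k ℕ.≤ k ℕ.* u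
  k≤k*u k 1≤u = ℕ.≤-trans (ℕ.≤-reflexive (sym (ℕ.*-identityʳ k))) (ℕ.*-monoʳ-≤ k 1≤u)
  eq : ∀ N a u c → N ℕ.* (a ℕ.* u ℕ.+ (7 ℕ.+ c) ℕ.* u) ℕ.+ (5 ℕ.+ c) ℕ.* (N ℕ.* u) ≡ (a ℕ.+ (12 ℕ.+ 2 ℕ.* c)) ℕ.* (N ℕ.* u)
  eq = ℕ-solve

+-≲ : ∀ k {T a u} → T ≲ a · u → k ℕ.+ T ≲ k ℕ.+ a · u
+-≲ k {T} {a} {u} (1≤u , T≤) = 1≤u , ℕ.≤-trans
  (ℕ.+-mono-≤ (ℕ.≤-trans (ℕ.≤-reflexive (sym (ℕ.*-identityʳ k))) (ℕ.*-monoʳ-≤ k 1≤u)) T≤)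
  (ℕ.≤-reflexive (sym (ℕ.*-distribʳ-+ u k a)))

add-≲ : ∀ {S T a b u} → S ≲ a · u → T ≲ b · u → S ℕ.+ T ≲ a ℕ.+ b · u
add-≲ {a = a} {b} {u} (1≤u , S≤) (_ , T≤) = 1≤u , ℕ.≤-trans (ℕ.+-mono-≤ S≤ T≤) (ℕ.≤-reflexive (sym (ℕ.*-distribʳ-+ u a b)))

≲-unit : ∀ {T a u v} → T ≲ a · u → u ℕ.≤ v → T ≲ a · v
≲-unit {a = a} (1≤u , T≤) u≤v = ℕ.≤-trans 1≤u u≤v , ℕ.≤-trans T≤ (ℕ.*-monoʳ-≤ a u≤v)

const-≲ : ∀ k → k ≲ k · 1
const-≲ k = ℕ.≤-refl , ℕ.≤-reflexive (sym (ℕ.*-identityʳ k))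

≲⇒≤ : ∀ b {T a u} → T ≲ a · u → {True (a ℕ.≤? b)} → T ℕ.≤ b ℕ.* u
≲⇒≤ b {u = u} (_ , T≤) {a≤b} = ℕ.≤-trans T≤ (ℕ.*-monoˡ-≤ u (toWitness a≤b))

n≤2^n : ∀ n → n ℕ.≤ 2 ℕ.^ n
n≤2^n zero = ℕ.z≤n
n≤2^n (suc n) = ℕ.+-mono-≤ (ℕ.m^n>0 2 n) (ℕ.≤-trans (n≤2^n n) (ℕ.≤-reflexive (sym (ℕ.+-identityʳ _))))

-- Written out in numbers alone, and associated like the phases of the program, so that the sum of
-- their bounds equals it by `refl`.
runTime : ℕ → ℕ → ℕ → ℕ → ℕ → ℕ
runTime m p q L K =
  forTime (! categories) m 15 ℕ.+ (
  (2 ℕ.+ (2 ℕ.+ (2 ℕ.+ ((p ℕ.* 12 ℕ.+ 4) ℕ.+ ((q ℕ.* 12 ℕ.+ 4) ℕ.+ 4))))) ℕ.+ (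
  forTime (! rows) (2 ℕ.^ p) (forTime (! columns) (2 ℕ.^ suc q) 22) ℕ.+ (
  (2 ℕ.+ (2 ℕ.+ forTime (! leaves) L 40)) ℕ.+ (
  (8 ℕ.+ (3 ℕ.+ (4 ℕ.+ (2 ℕ.+ ((K ℕ.∸ 1) ℕ.* 17 ℕ.+ 4))))) ℕ.+ (
  forTime (! leaves) L (4 ℕ.+ (4 ℕ.+ (4 ℕ.+ forTime (! gridSize) K 40))) ℕ.+ (
  forTime (! leaves ⊖ lit 1) (L ℕ.∸ 1) (6 ℕ.+ forTime (! gridSize) K (forTime (! gridSize) K (forTime (! gridSize) K 150))) ℕ.+ (
  (2 ℕ.+ forTime (! gridSize) K 20) ℕ.+ (
  (3 ℕ.+ forTime (! leaves ⊖ lit 1) (L ℕ.∸ 1) 23) ℕ.+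
  forTime (! rows) (2 ℕ.^ p) (forTime (! columns) (2 ℕ.^ suc q) 11)))))))))

runTime-≤ : ∀ {m p q L K} → m ℕ.≤ 2 ℕ.^ p → L ≡ 2 ℕ.^ p ℕ.* 2 ℕ.^ suc q → 1 ℕ.≤ K →
  runTime m p q L K ℕ.≤ 1000 ℕ.* (L ℕ.* (K ℕ.* (K ℕ.* (K ℕ.* 1))))
runTime-≤ {m} {p} {q} {L} {K} m≤ refl 1≤K = ≲⇒≤ 1000 (
  -- The product of leaves and cubed grid size dominates the unit of every phase; the constants sum
  -- to a numeral that is checked against 1000.
  add-≲ (≲-unit (forTime-≲ {e = ! categories} (const-≲ 15) 1≤M m≤) M≤W) (
  add-≲ (≲-unit (+-≲ 2 (+-≲ 2 (+-≲ 2 (add-≲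
    (add-≲ (≲-unit (times-≲ 12 1≤M p≤) M*1≤MP) (≲-unit (const-≲ 4) 1≤MP))
    (add-≲ (add-≲ (≲-unit (times-≲ 12 1≤P q≤) P*1≤MP) (≲-unit (const-≲ 4) 1≤MP)) (≲-unit (const-≲ 4) 1≤MP)))))) MP≤W) (
  add-≲ (≲-unit (forTime-≲ {e = ! rows} (forTime-≲ {e = ! columns} (const-≲ 22) 1≤P ℕ.≤-refl) 1≤M ℕ.≤-refl) MP1≤W) (
  add-≲ (≲-unit (+-≲ 2 (+-≲ 2 (forTime-≲ {e = ! leaves} (const-≲ 40) 1≤MP ℕ.≤-refl))) L1≤W) (
  add-≲ (≲-unit (+-≲ 8 (+-≲ 3 (+-≲ 4 (+-≲ 2 (add-≲ (times-≲ 17 1≤K (ℕ.m∸n≤m K 1)) (≲-unit (const-≲ 4) 1≤K1)))))) K≤W) (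
  add-≲ (≲-unit (forTime-≲ {e = ! leaves} (+-≲ 4 (+-≲ 4 (+-≲ 4 (forTime-≲ {e = ! gridSize} (const-≲ 40) 1≤K ℕ.≤-refl)))) 1≤MP ℕ.≤-refl) LK≤W) (
  add-≲ (forTime-≲ {e = ! leaves ⊖ lit 1} (+-≲ 6 (forTime-≲ {e = ! gridSize} (forTime-≲ {e = ! gridSize} (forTime-≲ {e = ! gridSize} (const-≲ 150)
    1≤K ℕ.≤-refl) 1≤K ℕ.≤-refl) 1≤K ℕ.≤-refl)) 1≤MP (ℕ.m∸n≤m L 1)) (
  add-≲ (≲-unit (+-≲ 2 (forTime-≲ {e = ! gridSize} (const-≲ 20) 1≤K ℕ.≤-refl)) K≤W) (
  add-≲ (≲-unit (+-≲ 3 (forTime-≲ {e = ! leaves ⊖ lit 1} (const-≲ 23) 1≤MP (ℕ.m∸n≤m L 1))) L1≤W)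
  (≲-unit (forTime-≲ {e = ! rows} (forTime-≲ {e = ! columns} (const-≲ 11) 1≤P ℕ.≤-refl) 1≤M ℕ.≤-refl) MP1≤W))))))))))
  where
  W = L ℕ.* (K ℕ.* (K ℕ.* (K ℕ.* 1)))
  1≤M = ℕ.m^n>0 2 p
  1≤P = ℕ.m^n>0 2 (suc q)
  1≤MP : 1 ℕ.≤ L
  1≤MP = ℕ.*-mono-≤ 1≤M 1≤P
  p≤ = n≤2^n p
  q≤ : q ℕ.≤ 2 ℕ.^ suc q
  q≤ = ℕ.≤-trans (ℕ.n≤1+n q) (n≤2^n (suc q))
  1≤K1 : 1 ℕ.≤ K ℕ.* 1
  1≤K1 = ℕ.*-mono-≤ 1≤K (ℕ.≤-refl {1})
  up : ∀ {k u v} → 1 ℕ.≤ k → u ℕ.≤ v → u ℕ.≤ k ℕ.* v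
  up {k} {u} {v} 1≤k u≤v = ℕ.≤-trans u≤v (ℕ.≤-trans (ℕ.≤-reflexive (sym (ℕ.*-identityˡ v))) (ℕ.*-monoˡ-≤ v 1≤k))
  1≤K³ : 1 ℕ.≤ K ℕ.* (K ℕ.* (K ℕ.* 1))
  1≤K³ = up 1≤K (up 1≤K 1≤K1)
  L1≤W : L ℕ.* 1 ℕ.≤ W
  L1≤W = ℕ.*-monoʳ-≤ L 1≤K³
  MP≤W : L ℕ.≤ W
  MP≤W = ℕ.≤-trans (ℕ.≤-reflexive (sym (ℕ.*-identityʳ L))) L1≤W
  MP1≤W : 2 ℕ.^ p ℕ.* (2 ℕ.^ suc q ℕ.* 1) ℕ.≤ W
  MP1≤W = ℕ.≤-trans (ℕ.≤-reflexive (cong (2 ℕ.^ p ℕ.*_) (ℕ.*-identityʳ _))) MP≤W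
  M*1≤MP : 2 ℕ.^ p ℕ.* 1 ℕ.≤ L
  M*1≤MP = ℕ.*-monoʳ-≤ (2 ℕ.^ p) 1≤P
  P*1≤MP : 2 ℕ.^ suc q ℕ.* 1 ℕ.≤ L
  P*1≤MP = up 1≤M (ℕ.≤-reflexive (ℕ.*-identityʳ _))
  M≤W : 2 ℕ.^ p ℕ.* 1 ℕ.≤ W
  M≤W = ℕ.≤-trans M*1≤MP MP≤W
  K≤W : K ℕ.* 1 ℕ.≤ W
  K≤W = up 1≤MP (up 1≤K (up 1≤K ℕ.≤-refl))
  LK≤W : L ℕ.* (K ℕ.* 1) ℕ.≤ W
  LK≤W = ℕ.*-monoʳ-≤ L (up 1≤K (up 1≤K ℕ.≤-refl))
  times-≲ : ∀ {n N} c → 1 ℕ.≤ N → n ℕ.≤ N → n ℕ.* c ≲ c · N ℕ.* 1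
  times-≲ {n} {N} c 1≤N n≤N = ℕ.*-mono-≤ 1≤N ℕ.≤-refl ,
    ℕ.≤-trans (ℕ.*-monoˡ-≤ c n≤N) (ℕ.≤-reflexive (trans (ℕ.*-comm N c) (cong (c ℕ.*_) (sym (ℕ.*-identityʳ N)))))

-- The change of base is b ≤ c ^ j, so that log_c x ≤ j · log_b x.
log-lower : ∀ {b c x α} j k → 1ℚ ≤ b → 1ℚ < c → b ≤ c ^ᵣ j → c ^ᵣ k ≤ x → Log[ b ] x ≤ α → fromℕ k ≤ fromℕ j * α
log-lower {b} {c} {x} {α} j k 1≤b 1<c b≤ ≤x (0≤α , log) =
  *-cancelʳ (0<fromℕ d) (begin
    fromℕ k * fromℕ d ≡⟨ ℚ.*-comm (fromℕ k) (fromℕ d) ⟩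
    fromℕ d * fromℕ k ≡⟨ fromℕ-* d k ⟨
    fromℕ (d ℕ.* k) ≤⟨ fromℕ-mono {d ℕ.* k} {n ℕ.* j} exponents ⟩
    fromℕ (n ℕ.* j) ≡⟨ fromℕ-* n j ⟩
    fromℕ n * fromℕ j ≡⟨ cong (_* fromℕ j) (*-↧ₙ 0≤α) ⟨
    α * fromℕ d * fromℕ j ≡⟨ rearrange α (fromℕ d) (fromℕ j) ⟩
    fromℕ j * α * fromℕ d ∎)
  where
  open ℚ.≤-Reasoning
  d = ↧ₙ α
  n = ∣ ↥ α ∣
  0≤c : 0ℚ ≤ c
  0≤c = ℚ.<⇒≤ (ℚ.<-trans 0<1 1<c)
  rearrange : ∀ a d j → a * d * j ≡ j * a * d
  rearrange = solve-∀ ℚ-ring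
  exponents : d ℕ.* k ℕ.≤ n ℕ.* j
  exponents = ^-cancelʳ (d ℕ.* k) (n ℕ.* j) 1<c (begin
    c ^ᵣ (d ℕ.* k) ≡⟨ ^-^ c k d ⟨
    (c ^ᵣ k) ^ᵣ d ≤⟨ ^-monoˡ d (0≤^ k 0≤c) ≤x ⟩
    x ^ᵣ d ≤⟨ log ⟩
    b ^ᵣ n ≤⟨ ^-monoˡ n (ℚ.≤-trans 0≤1 1≤b) b≤ ⟩
    (c ^ᵣ j) ^ᵣ n ≡⟨ ^-^ c j n ⟩
    c ^ᵣ (n ℕ.* j) ∎)

fromℕ-^ : ∀ b k → fromℕ (b ℕ.^ k) ≡ fromℕ b ^ᵣ k
fromℕ-^ b zero = refl
fromℕ-^ b (suc k) = trans (fromℕ-* b (b ℕ.^ k)) (cong (fromℕ b *_) (fromℕ-^ b k))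

∑-≤ : ∀ {n} (f : Fin n → ℚ) (c : Fin n → ℕ) {x} → (∀ i → f i ≤ fromℕ (c i) * x) → ∑ f ≤ fromℕ (foldr ℕ._+_ 0 c) * x
∑-≤ {zero} f c {x} _ = ℚ.≤-reflexive (sym (ℚ.*-zeroˡ x))
∑-≤ {suc n} f c {x} le = begin
  f Fin.zero + ∑ (f ∘ Fin.suc) ≤⟨ ℚ.+-mono-≤ (le Fin.zero) (∑-≤ (f ∘ Fin.suc) (c ∘ Fin.suc) (le ∘ Fin.suc)) ⟩
  fromℕ (c Fin.zero) * x + fromℕ rest * x ≡⟨ ℚ.*-distribʳ-+ x (fromℕ (c Fin.zero)) (fromℕ rest) ⟨
  (fromℕ (c Fin.zero) + fromℕ rest) * x ≡⟨ cong (_* x) (fromℕ-+ (c Fin.zero) rest) ⟨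
  fromℕ (c Fin.zero ℕ.+ rest) * x ∎
  where
  open ℚ.≤-Reasoning
  rest = foldr ℕ._+_ 0 (c ∘ Fin.suc)

∑-≤-const : ∀ {n} (f : Fin n → ℚ) {x} → (∀ i → f i ≤ x) → ∑ f ≤ fromℕ n * x
∑-≤-const {zero} f {x} _ = ℚ.≤-reflexive (sym (ℚ.*-zeroˡ x))
∑-≤-const {suc n} f {x} le = begin
  f Fin.zero + ∑ (f ∘ Fin.suc) ≤⟨ ℚ.+-mono-≤ (le Fin.zero) (∑-≤-const (f ∘ Fin.suc) (le ∘ Fin.suc)) ⟩
  x + fromℕ n * x ≡⟨ cong (_+ fromℕ n * x) (ℚ.*-identityˡ x) ⟨
  1ℚ * x + fromℕ n * x ≡⟨ ℚ.*-distribʳ-+ x 1ℚ (fromℕ n) ⟨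
  (1ℚ + fromℕ n) * x ≡⟨ cong (_* x) (fromℕ-suc n) ⟨
  fromℕ (suc n) * x ∎
  where open ℚ.≤-Reasoning

-- The factor n pays for the cube of the number of levels inside a category.
log-cubed : ∀ q → (4 ℕ.+ q) ℕ.^ 3 ℕ.≤ 64 ℕ.* 2 ℕ.^ q
log-cubed zero = ℕ.≤-refl
log-cubed (suc q) = begin
  (5 ℕ.+ q) ℕ.^ 3 ≤⟨ ℕ.m≤m+n _ _ ⟩
  -- The added polynomial is 2 (4 + q)³ - (5 + q)³, whose coefficients are non-negative.
  (5 ℕ.+ q) ℕ.^ 3 ℕ.+ (3 ℕ.+ 21 ℕ.* q ℕ.+ 9 ℕ.* (q ℕ.* q) ℕ.+ q ℕ.* (q ℕ.* q)) ≡⟨ eq q ⟩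
  2 ℕ.* (4 ℕ.+ q) ℕ.^ 3 ≤⟨ ℕ.*-monoʳ-≤ 2 (log-cubed q) ⟩
  2 ℕ.* (64 ℕ.* 2 ℕ.^ q) ≡⟨ trans (sym (ℕ.*-assoc 2 64 (2 ℕ.^ q))) (ℕ.*-assoc 64 2 (2 ℕ.^ q)) ⟩
  64 ℕ.* 2 ℕ.^ suc q ∎
  where
  open ℕ.≤-Reasoning
  eq : ∀ q → (5 ℕ.+ q) ℕ.* ((5 ℕ.+ q) ℕ.* ((5 ℕ.+ q) ℕ.* 1)) ℕ.+ (3 ℕ.+ 21 ℕ.* q ℕ.+ 9 ℕ.* (q ℕ.* q) ℕ.+ q ℕ.* (q ℕ.* q)) ≡ 2 ℕ.* ((4 ℕ.+ q) ℕ.* ((4 ℕ.+ q) ℕ.* ((4 ℕ.+ q) ℕ.* 1)))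
  eq = ℕ-solve

module _ {m n p q L K : ℕ} {α β : ℚ} (1≤α : 1ℚ ≤ α) (1≤β : 1ℚ ≤ β)
  (L≤ : L ℕ.≤ 4 ℕ.* (m ℕ.* n)) (2^q≤n : 2 ℕ.^ q ℕ.≤ n)
  (p≤ : fromℕ p ≤ fromℕ 2 * α) (K≤ : fromℕ K ≤ fromℕ 4 * fromℕ (2 ℕ.+ p ℕ.+ q) * β) where
  private
    0≤α : 0ℚ ≤ α
    0≤α = ℚ.≤-trans 0≤1 1≤α
    0≤β : 0ℚ ≤ β
    0≤β = ℚ.≤-trans 0≤1 1≤β

    x≤x*α : ∀ {x} → 0ℚ ≤ x → x ≤ x * α
    x≤x*α {x} 0≤x = subst (_≤ x * α) (ℚ.*-identityʳ x) (*-monoʳ 0≤x 1≤α)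

    -- As 1 ≤ α, the sum of logarithms is bounded by a product: α factors out, and the rest, 4 + q,
    -- is left to be paid by a factor n.
    levels≤ : fromℕ (2 ℕ.+ p ℕ.+ q) ≤ fromℕ (4 ℕ.+ q) * α
    levels≤ = begin
      fromℕ (2 ℕ.+ p ℕ.+ q) ≡⟨ cong fromℕ (ℕ.+-assoc 2 p q) ⟩
      fromℕ (2 ℕ.+ (p ℕ.+ q)) ≡⟨ trans (fromℕ-+ 2 (p ℕ.+ q)) (cong (fromℕ 2 +_) (fromℕ-+ p q)) ⟩
      fromℕ 2 + (fromℕ p + fromℕ q) ≤⟨ ℚ.+-mono-≤ (x≤x*α (0≤fromℕ 2)) (ℚ.+-mono-≤ p≤ (x≤x*α (0≤fromℕ q))) ⟩
      fromℕ 2 * α + (fromℕ 2 * α + fromℕ q * α) ≡⟨ collect (fromℕ 2) (fromℕ q) α ⟩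
      (fromℕ 2 + (fromℕ 2 + fromℕ q)) * α ≡⟨ cong (_* α) (trans (fromℕ-+ 2 (2 ℕ.+ q)) (cong (fromℕ 2 +_) (fromℕ-+ 2 q))) ⟨
      fromℕ (4 ℕ.+ q) * α ∎
      where
      open ℚ.≤-Reasoning
      collect : ∀ t q a → t * a + (t * a + q * a) ≡ (t + (t + q)) * a
      collect = solve-∀ ℚ-ring

    gridSize≤ : fromℕ K ≤ fromℕ (4 ℕ.* (4 ℕ.+ q)) * (α * β)
    gridSize≤ = begin
      fromℕ K ≤⟨ K≤ ⟩
      fromℕ 4 * fromℕ (2 ℕ.+ p ℕ.+ q) * β ≤⟨ *-monoˡ 0≤β (*-monoʳ (0≤fromℕ 4) levels≤) ⟩
      fromℕ 4 * (fromℕ (4 ℕ.+ q) * α) * β ≡⟨ assoc (fromℕ 4) (fromℕ (4 ℕ.+ q)) α β ⟩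
      fromℕ 4 * fromℕ (4 ℕ.+ q) * (α * β) ≡⟨ cong (_* (α * β)) (fromℕ-* 4 (4 ℕ.+ q)) ⟨
      fromℕ (4 ℕ.* (4 ℕ.+ q)) * (α * β) ∎
      where
      open ℚ.≤-Reasoning
      assoc : ∀ a b c d → a * (b * c) * d ≡ a * b * (c * d)
      assoc = solve-∀ ℚ-ring

  steps-≤ : fromℕ (L ℕ.* K ℕ.^ 3) ≤ fromℕ 16384 * (fromℕ (n ℕ.^ 2 ℕ.* m) * α ^ᵣ 3 * β ^ᵣ 3)
  steps-≤ = begin
    fromℕ (L ℕ.* K ℕ.^ 3) ≡⟨ trans (fromℕ-* L (K ℕ.^ 3)) (cong (fromℕ L *_) (fromℕ-^ K 3)) ⟩
    fromℕ L * fromℕ K ^ᵣ 3 ≤⟨ *-monoʳ (0≤fromℕ L) (^-monoˡ 3 (0≤fromℕ K) gridSize≤) ⟩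
    fromℕ L * (fromℕ k * (α * β)) ^ᵣ 3 ≡⟨ cubes (fromℕ L) (fromℕ k) α β ⟩
    fromℕ L * fromℕ k ^ᵣ 3 * (α ^ᵣ 3 * β ^ᵣ 3) ≡⟨ cong (_* (α ^ᵣ 3 * β ^ᵣ 3)) (trans (cong (fromℕ L *_) (sym (fromℕ-^ k 3))) (sym (fromℕ-* L (k ℕ.^ 3)))) ⟩
    fromℕ (L ℕ.* k ℕ.^ 3) * (α ^ᵣ 3 * β ^ᵣ 3) ≤⟨ *-monoˡ (0≤* (0≤^ 3 0≤α) (0≤^ 3 0≤β)) (fromℕ-mono {L ℕ.* k ℕ.^ 3} {16384 ℕ.* (n ℕ.^ 2 ℕ.* m)} naturals) ⟩
    fromℕ (16384 ℕ.* (n ℕ.^ 2 ℕ.* m)) * (α ^ᵣ 3 * β ^ᵣ 3) ≡⟨ cong (_* (α ^ᵣ 3 * β ^ᵣ 3)) (fromℕ-* 16384 (n ℕ.^ 2 ℕ.* m)) ⟩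
    fromℕ 16384 * fromℕ (n ℕ.^ 2 ℕ.* m) * (α ^ᵣ 3 * β ^ᵣ 3) ≡⟨ assoc (fromℕ 16384) (fromℕ (n ℕ.^ 2 ℕ.* m)) (α ^ᵣ 3) (β ^ᵣ 3) ⟩
    fromℕ 16384 * (fromℕ (n ℕ.^ 2 ℕ.* m) * α ^ᵣ 3 * β ^ᵣ 3) ∎
    where
    open ℚ.≤-Reasoning
    k = 4 ℕ.* (4 ℕ.+ q)
    assoc : ∀ a b c d → a * b * (c * d) ≡ a * (b * c * d)
    assoc = solve-∀ ℚ-ring
    cubes′ : ∀ l k a b → l * ((k * (a * b)) * ((k * (a * b)) * ((k * (a * b)) * 1ℚ))) ≡ l * (k * (k * (k * 1ℚ))) * (a * (a * (a * 1ℚ)) * (b * (b * (b * 1ℚ))))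
    cubes′ = solve-∀ ℚ-ring
    cubes : ∀ l k a b → l * (k * (a * b)) ^ᵣ 3 ≡ l * k ^ᵣ 3 * (a ^ᵣ 3 * b ^ᵣ 3)
    cubes = cubes′
    -- 16384 = 4 · 64 · 64: padding of the tree, the cube of the 4 in k, and the constant of
    -- `log-cubed`.
    naturals : L ℕ.* k ℕ.^ 3 ℕ.≤ 16384 ℕ.* (n ℕ.^ 2 ℕ.* m)
    naturals = ℕ.≤-trans (ℕ.*-mono-≤ L≤ (ℕ.≤-trans (ℕ.≤-reflexive (cube (4 ℕ.+ q)))
        (ℕ.*-monoʳ-≤ 64 (ℕ.≤-trans (log-cubed q) (ℕ.*-monoʳ-≤ 64 2^q≤n)))))
      (ℕ.≤-reflexive (collect m n))
      where
      cube : ∀ r → (4 ℕ.* r) ℕ.* ((4 ℕ.* r) ℕ.* ((4 ℕ.* r) ℕ.* 1)) ≡ 64 ℕ.* (r ℕ.* (r ℕ.* (r ℕ.* 1)))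
      cube = ℕ-solve
      collect : ∀ m n → 4 ℕ.* (m ℕ.* n) ℕ.* (64 ℕ.* (64 ℕ.* n)) ≡ 16384 ℕ.* (n ℕ.* (n ℕ.* 1) ℕ.* m)
      collect = ℕ-solve

≤-foldr-⊔ : ∀ {n} (f : Fin n → ℕ) i → f i ℕ.≤ foldr ℕ._⊔_ 0 f
≤-foldr-⊔ f Fin.zero = ℕ.m≤m⊔n _ _
≤-foldr-⊔ f (Fin.suc i) = ℕ.≤-trans (≤-foldr-⊔ (f ∘ Fin.suc) i) (ℕ.m≤n⊔m (f Fin.zero) _)

scale : ∀ a b {t W X Y} → t ℕ.≤ a ℕ.* W → fromℕ W ≤ fromℕ b * X → X ≤ Y → fromℕ t ≤ fromℕ (a ℕ.* b) * Y
scale a b {t} {W} {X} {Y} t≤ W≤ X≤Y = begin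
  fromℕ t ≤⟨ fromℕ-mono {t} {a ℕ.* W} t≤ ⟩
  fromℕ (a ℕ.* W) ≡⟨ fromℕ-* a W ⟩
  fromℕ a * fromℕ W ≤⟨ *-monoʳ (0≤fromℕ a) (ℚ.≤-trans W≤ (*-monoʳ (0≤fromℕ b) X≤Y)) ⟩
  fromℕ a * (fromℕ b * Y) ≡⟨ ℚ.*-assoc (fromℕ a) (fromℕ b) Y ⟨
  fromℕ a * fromℕ b * Y ≡⟨ cong (_* Y) (fromℕ-* a b) ⟨
  fromℕ (a ℕ.* b) * Y ∎
  where open ℚ.≤-Reasoning

-- Abstract, because normalising fromℕ of a large literal is slow.
abstract
  constant : ℕ
  constant = 1000 ℕ.* 16384

  scale-constant : ∀ {t W X Y} → t ℕ.≤ 1000 ℕ.* W → fromℕ W ≤ fromℕ 16384 * X → X ≤ Y → fromℕ t ≤ fromℕ constant * Y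
  scale-constant {t} {W} {X} {Y} = scale 1000 16384 {t} {W} {X} {Y}

module Analysis (I : Instance) {ε : ℚ} (0<ε : 0ℚ < ε) (ε≤1 : ε ≤ 1ℚ) where
  open Instance I

  m≥1 : 1 ℕ.≤ m
  m≥1 = ℕ.≤-trans (ℕ.s≤s ℕ.z≤n) (Fin.toℕ<n (proj₁ positive))

  n≥1 : 1 ℕ.≤ maxSize I
  n≥1 = ℕ.≤-trans (ℕ.≤-trans (ℕ.s≤s ℕ.z≤n) (Fin.toℕ<n (proj₁ (proj₂ positive)))) (≤-foldr-⊔ size (proj₁ positive))

  allValues : ℚ
  allValues = ∑ (λ i → ∑ (v i))

  timeBound : ∀ {p q k s ρ t} →
    (∀ j → j ℕ.< p → ¬ m ℕ.≤ 2 ℕ.^ j) → m ℕ.≤ 2 ℕ.^ p → 2 ℕ.^ q ℕ.≤ maxSize I →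
    1ℚ < ρ → 1ℚ + ε ≤ ρ ^ᵣ (2 ℕ.* (2 ℕ.+ p ℕ.+ q)) → PositiveValue I s →
    (∀ j → j ℕ.< k → ¬ allValues < ρ ^ᵣ j * s) →
    t ℕ.≤ runTime m p q (2 ℕ.^ p ℕ.* 2 ℕ.^ suc q) (suc k) →
    TimeBound constant ε I t
  timeBound {p} {q} {k} {s} {ρ} {t} p-min m≤ 2^q≤n 1<ρ base s-value k-min t≤ vmin vmax (((i , j , vij≡) , 0<vmin) , minimum) (vmax-value , maximum) α β logα logβ = ℚ.≤-trans (fromℕ-mono {t} {runTime m p q (2 ℕ.^ p ℕ.* 2 ℕ.^ suc q) (suc k)} t≤) $ scale-constant {t = runTime m p q L′ K′} {W = W} {X = X} {Y = X /₀ ε} (runTime-≤ {m} {p} {q} {L′} {K′} m≤ refl (ℕ.s≤s ℕ.z≤n))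
      (steps-≤ {m} {maxSize I} {p} {q} {L′} {K′} 1≤α 1≤β L≤ 2^q≤n p≤ K≤)
      -- For ε ≤ 1, division by ε only enlarges the bound.
      (*≤⇒≤/₀ {X} {ε} 0<ε (ℚ.≤-trans (*-monoʳ 0≤X ε≤1) (ℚ.≤-reflexive (ℚ.*-identityʳ X))))
    where
    open ℚ.≤-Reasoning
    L′ = 2 ℕ.^ p ℕ.* 2 ℕ.^ suc q
    K′ = suc k
    W = L′ ℕ.* (K′ ℕ.* (K′ ℕ.* (K′ ℕ.* 1)))
    E = 2 ℕ.+ p ℕ.+ q
    X = fromℕ (maxSize I ℕ.^ 2 ℕ.* m) * α ^ᵣ 3 * β ^ᵣ 3
    N = numItems I ℕ.⊔ 2
    ratio′ = fromℕ N * vmax /₀ vmin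

    1<1+ε : 1ℚ < 1ℚ + ε
    1<1+ε = subst (_< 1ℚ + ε) (ℚ.+-identityʳ 1ℚ) (ℚ.+-monoʳ-< 1ℚ 0<ε)
    1<2 : 1ℚ < fromℕ 2
    1<2 = subst (1ℚ <_) (sym (fromℕ-+ 1 1)) (subst (_< 1ℚ + 1ℚ) (ℚ.+-identityʳ 1ℚ) (ℚ.+-monoʳ-< 1ℚ 0<1))
    vmin≤vmax : vmin ≤ vmax
    vmin≤vmax = maximum vmin (i , j , vij≡)
    0≤vmax : 0ℚ ≤ vmax
    0≤vmax = ℚ.≤-trans (ℚ.<⇒≤ 0<vmin) vmin≤vmax

    1≤α : 1ℚ ≤ α
    1≤α = subst (1ℚ ≤_) (ℚ.*-identityˡ α) (log-lower {fromℕ 2} {fromℕ 2} {fromℕ (m ℕ.⊔ 2)} {α} 1 1 (ℚ.<⇒≤ 1<2) 1<2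
      (ℚ.≤-reflexive (sym (ℚ.*-identityʳ (fromℕ 2))))
      (ℚ.≤-trans (ℚ.≤-reflexive (ℚ.*-identityʳ (fromℕ 2))) (fromℕ-mono {2} {m ℕ.⊔ 2} (ℕ.m≤n⊔m m 2))) logα)

    -- Minimality of p gives 2 ^ (p - 1) < m, hence p ≤ 1 + α ≤ 2 α.
    p≤ : fromℕ p ≤ fromℕ 2 * α
    p≤ = go p p-min
      where
      go : ∀ p → (∀ j → j ℕ.< p → ¬ m ℕ.≤ 2 ℕ.^ j) → fromℕ p ≤ fromℕ 2 * α
      go zero _ = 0≤* (0≤fromℕ 2) (ℚ.≤-trans 0≤1 1≤α)
      go (suc p) below = begin
        fromℕ (suc p) ≡⟨ fromℕ-suc p ⟩
        1ℚ + fromℕ p ≤⟨ ℚ.+-mono-≤ 1≤α (log-lower {fromℕ 2} {fromℕ 2} {fromℕ (m ℕ.⊔ 2)} {α} 1 p (ℚ.<⇒≤ 1<2) 1<2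
            (ℚ.≤-reflexive (sym (ℚ.*-identityʳ (fromℕ 2))))
            (ℚ.≤-trans (ℚ.≤-reflexive (sym (fromℕ-^ 2 p)))
               (fromℕ-mono {2 ℕ.^ p} {m ℕ.⊔ 2} (ℕ.≤-trans (ℕ.<⇒≤ (ℕ.≰⇒> (below p (ℕ.n<1+n p)))) (ℕ.m≤m⊔n m 2)))) logα) ⟩
        α + fromℕ 1 * α ≡⟨ cong (_+ fromℕ 1 * α) (ℚ.*-identityˡ α) ⟨
        fromℕ 1 * α + fromℕ 1 * α ≡⟨ ℚ.*-distribʳ-+ α (fromℕ 1) (fromℕ 1) ⟨
        (fromℕ 1 + fromℕ 1) * α ≡⟨ cong (_* α) (fromℕ-+ 1 1) ⟨
        fromℕ 2 * α ∎

    2≤ratio : fromℕ 2 ≤ ratio′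
    2≤ratio = *≤⇒≤/₀ 0<vmin (*-mono-≤ (0≤fromℕ 2) (ℚ.<⇒≤ 0<vmin) (fromℕ-mono {2} {N} (ℕ.m≤n⊔m (numItems I) 2)) vmin≤vmax)

    1+ε≤2 : 1ℚ + ε ≤ fromℕ 2
    1+ε≤2 = ℚ.≤-trans (ℚ.+-monoʳ-≤ 1ℚ ε≤1) (ℚ.≤-reflexive (sym (fromℕ-+ 1 1)))

    -- The argument of the logarithm is at least 2 because of N ⊔ 2 and vmin ≤ vmax, while the base
    -- 1 + ε is at most 2.
    1≤β : 1ℚ ≤ β
    1≤β = subst (1ℚ ≤_) (ℚ.*-identityˡ β) (log-lower {1ℚ + ε} {1ℚ + ε} {ratio′} {β} 1 1 (ℚ.<⇒≤ 1<1+ε) 1<1+ε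
      (ℚ.≤-reflexive (sym (ℚ.*-identityʳ (1ℚ + ε))))
      (ℚ.≤-trans (ℚ.≤-reflexive (ℚ.*-identityʳ (1ℚ + ε))) (ℚ.≤-trans 1+ε≤2 2≤ratio)) logβ)

    0≤X : 0ℚ ≤ X
    0≤X = 0≤* (0≤* (0≤fromℕ (maxSize I ℕ.^ 2 ℕ.* m)) (0≤^ 3 (ℚ.≤-trans 0≤1 1≤α))) (0≤^ 3 (ℚ.≤-trans 0≤1 1≤β))

    allValues≤ : allValues ≤ fromℕ N * vmax
    allValues≤ = ℚ.≤-trans (∑-≤ (λ i → ∑ (v i)) size (λ i → ∑-≤-const (v i) (λ j → maximum (v i j) (i , j , refl))))
      (*-monoˡ 0≤vmax (fromℕ-mono {numItems I} {N} (ℕ.m≤m⊔n (numItems I) 2)))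

    0<ρ : 0ℚ < ρ
    0<ρ = ℚ.<-trans 0<1 1<ρ

    -- Below k the power ρ ^ j · s has not passed the total value, so ρ ^ j ≤ N vmax / vmin; passing
    -- from base ρ to base 1 + ε costs the factor 2E.
    powers≤ : ∀ j → j ℕ.< k → fromℕ j ≤ fromℕ (2 ℕ.* E) * β
    powers≤ j j<k = log-lower {1ℚ + ε} {ρ} {ratio′} {β} (2 ℕ.* E) j (ℚ.<⇒≤ 1<1+ε) 1<ρ base
      (*≤⇒≤/₀ 0<vmin (begin
        ρ ^ᵣ j * vmin ≤⟨ *-monoʳ (0≤^ j (ℚ.<⇒≤ 0<ρ)) (minimum s s-value) ⟩
        ρ ^ᵣ j * s ≤⟨ ℚ.≮⇒≥ (k-min j j<k) ⟩
        allValues ≤⟨ allValues≤ ⟩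
        fromℕ N * vmax ∎)) logβ

    2≤2Eβ : fromℕ 2 ≤ fromℕ (2 ℕ.* E) * β
    2≤2Eβ = ℚ.≤-trans (ℚ.≤-trans (fromℕ-mono {2} {2 ℕ.* E} (ℕ.*-monoʳ-≤ 2 {1} {E} (ℕ.s≤s ℕ.z≤n))) (ℚ.≤-reflexive (sym (ℚ.*-identityʳ (fromℕ (2 ℕ.* E))))))
      (*-monoʳ (0≤fromℕ (2 ℕ.* E)) 1≤β)

    -- The last exponent controlled is k - 1; the remaining 2 of K = k + 1 costs a second 2Eβ.
    K≤ : fromℕ K′ ≤ fromℕ 4 * fromℕ E * β
    K≤ = begin
      fromℕ (suc k) ≤⟨ fromℕ-mono {suc k} {2 ℕ.+ (k ℕ.∸ 1)} (ℕ.s≤s (k≤ k)) ⟩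
      fromℕ (2 ℕ.+ (k ℕ.∸ 1)) ≡⟨ fromℕ-+ 2 (k ℕ.∸ 1) ⟩
      fromℕ 2 + fromℕ (k ℕ.∸ 1) ≤⟨ ℚ.+-mono-≤ 2≤2Eβ (pred≤ k powers≤) ⟩
      fromℕ (2 ℕ.* E) * β + fromℕ (2 ℕ.* E) * β ≡⟨ ℚ.*-distribʳ-+ β (fromℕ (2 ℕ.* E)) (fromℕ (2 ℕ.* E)) ⟨
      (fromℕ (2 ℕ.* E) + fromℕ (2 ℕ.* E)) * β ≡⟨ cong (_* β) (fromℕ-+ (2 ℕ.* E) (2 ℕ.* E)) ⟨
      fromℕ (2 ℕ.* E ℕ.+ 2 ℕ.* E) * β ≡⟨ cong (λ z → fromℕ z * β) (ℕ.*-distribʳ-+ E 2 2) ⟨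
      fromℕ (4 ℕ.* E) * β ≡⟨ cong (_* β) (fromℕ-* 4 E) ⟩
      fromℕ 4 * fromℕ E * β ∎
      where
      k≤ : ∀ k → k ℕ.≤ suc (k ℕ.∸ 1)
      k≤ zero = ℕ.z≤n
      k≤ (suc k) = ℕ.≤-refl
      pred≤ : ∀ k → (∀ j → j ℕ.< k → fromℕ j ≤ fromℕ (2 ℕ.* E) * β) → fromℕ (k ℕ.∸ 1) ≤ fromℕ (2 ℕ.* E) * β
      pred≤ zero _ = ℚ.≤-trans (fromℕ-mono {0} {2} ℕ.z≤n) 2≤2Eβ
      pred≤ (suc k) h = h k (ℕ.n<1+n k)

    L≤ : L′ ℕ.≤ 4 ℕ.* (m ℕ.* maxSize I)
    L≤ = ℕ.≤-trans (ℕ.*-mono-≤ (2^p≤ p p-min) (ℕ.*-monoʳ-≤ 2 2^q≤n))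
      (ℕ.≤-reflexive (trans (ℕ.*-assoc 2 m (2 ℕ.* maxSize I)) (trans (cong (2 ℕ.*_) (swap m (maxSize I))) (sym (ℕ.*-assoc 2 2 (m ℕ.* maxSize I))))))
      where
      swap : ∀ m n → m ℕ.* (2 ℕ.* n) ≡ 2 ℕ.* (m ℕ.* n)
      swap m n = trans (sym (ℕ.*-assoc m 2 n)) (trans (cong (ℕ._* n) (ℕ.*-comm m 2)) (ℕ.*-assoc 2 m n))
      2^p≤ : ∀ p → (∀ j → j ℕ.< p → ¬ m ℕ.≤ 2 ℕ.^ j) → 2 ℕ.^ p ℕ.≤ 2 ℕ.* m
      2^p≤ zero _ = ℕ.≤-trans m≥1 (ℕ.m≤m+n m (m ℕ.+ 0))
      2^p≤ (suc p) below = ℕ.*-monoʳ-≤ 2 (ℕ.<⇒≤ (ℕ.≰⇒> (below p (ℕ.n<1+n p))))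

-- The algorithm on an instance

-- The bound T depends on the exponents q and k₀, which are known only after the
-- first phases; hence it is handed on to the postcondition.
Timed : Cmd → Store → (Store → ℕ → Set) → Set
Timed c σ R = ∃[ T ] Exec c σ (λ τ → R τ T) T

timed-seq : ∀ {c d σ P S} {R : Store → ℕ → Set} → Exec c σ P S →
  (∀ τ → P τ → Timed d τ (λ υ T → R υ (S ℕ.+ T))) → Timed (c ⨾ d) σ R
timed-seq {S = S} (τ , s , r , p , s≤S) f with f τ p
... | T , υ , t , r′ , rest , t≤T = S ℕ.+ T , υ , s ℕ.+ t , run-seq r r′ , rest , ℕ.+-mono-≤ s≤S t≤T

-- ρ ^ E ≤ 1 + ε because (1 - ε / 2) (1 + ε) ≥ 1 for 0 ≤ ε ≤ 1.
module Ratio {ε : ℚ} (0<ε : 0ℚ < ε) (ε≤1 : ε ≤ 1ℚ) (E : ℕ) (1≤E : 1 ℕ.≤ E) where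

  step ratio′ : ℚ
  step = ε /₀ fromℕ (2 ℕ.* E)
  ratio′ = 1ℚ + step

  0<2E : 0ℚ < fromℕ (2 ℕ.* E)
  0<2E = ℚ.<-≤-trans (0<fromℕ 1) (fromℕ-mono {1} {2 ℕ.* E} (ℕ.≤-trans 1≤E (ℕ.m≤m+n E (E ℕ.+ 0))))

  0<step : 0ℚ < step
  0<step = 0</₀ 0<ε 0<2E

  1<ratio : 1ℚ < ratio′
  1<ratio = subst (_< ratio′) (ℚ.+-identityʳ 1ℚ) (ℚ.+-monoʳ-< 1ℚ 0<step)

  steps : fromℕ (2 ℕ.* E) * step ≡ ε
  steps = trans (ℚ.*-comm (fromℕ (2 ℕ.* E)) step) (/₀-*-cancel ε 0<2E)

  1+ε≤ratio^ : 1ℚ + ε ≤ ratio′ ^ᵣ (2 ℕ.* E)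
  1+ε≤ratio^ = subst (λ z → 1ℚ + z ≤ ratio′ ^ᵣ (2 ℕ.* E)) steps (bernoulli (2 ℕ.* E) (ℚ.<⇒≤ 0<step))

  ratio^≤1+ε : ratio′ ^ᵣ E ≤ 1ℚ + ε
  ratio^≤1+ε = begin
    y ≡⟨ ℚ.*-identityʳ y ⟨
    -- With x = ε / 2, (1 - x) (1 + 2x) = 1 + x (1 - 2x) ≥ 1.
    y * 1ℚ ≤⟨ *-monoʳ 0≤y (x≤x+y (0≤* 0≤x (subst (0ℚ ≤_) (cong (λ z → 1ℚ - z) ε≡) 0≤1-ε))) ⟩
    y * (1ℚ + x * (1ℚ - (x + x))) ≡⟨ expand y x ⟩
    y * (1ℚ - x) * (1ℚ + (x + x)) ≤⟨ *-monoˡ (0≤+ 0≤1 (0≤+ 0≤x 0≤x)) (bernoulli′ E (ℚ.<⇒≤ 0<step)) ⟩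
    1ℚ * (1ℚ + (x + x)) ≡⟨ ℚ.*-identityˡ (1ℚ + (x + x)) ⟩
    1ℚ + (x + x) ≡⟨ cong (1ℚ +_) ε≡ ⟨
    1ℚ + ε ∎
    where
    open ℚ.≤-Reasoning
    y = ratio′ ^ᵣ E
    x = fromℕ E * step
    0≤x : 0ℚ ≤ x
    0≤x = 0≤* (0≤fromℕ E) (ℚ.<⇒≤ 0<step)
    0≤y : 0ℚ ≤ y
    0≤y = 0≤^ E (ℚ.<⇒≤ (ℚ.<-trans 0<1 1<ratio))
    0≤1-ε : 0ℚ ≤ 1ℚ - ε
    0≤1-ε = subst (_≤ 1ℚ - ε) (ℚ.+-inverseʳ ε) (ℚ.+-monoˡ-≤ (- ε) ε≤1)
    ε≡ : ε ≡ x + x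
    ε≡ = trans (sym steps) (trans (cong (_* step) (trans (cong fromℕ (cong (E ℕ.+_) (ℕ.+-identityʳ E))) (fromℕ-+ E E))) (ℚ.*-distribʳ-+ step (fromℕ E) (fromℕ E)))
    expand : ∀ y x → y * (1ℚ + x * (1ℚ - (x + x))) ≡ y * (1ℚ - x) * (1ℚ + (x + x))
    expand = solve-∀ ℚ-ring

-- By Bernoulli the powers grow at least linearly, with increment δ s. Hence the loop building the
-- grid ends.
powers-unbounded : ∀ {δ s} tot → 0ℚ < δ → 0ℚ < s → ∃[ k ] (tot < (1ℚ + δ) ^ᵣ k * s)
powers-unbounded {δ} {s} tot 0<δ 0<s with archimedean (tot /₀ (δ * s))
... | k , ≤k = k , (begin-strict
  tot ≡⟨ /₀-*-cancel tot (0<* 0<δ 0<s) ⟨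
  tot /₀ (δ * s) * (δ * s) ≤⟨ *-monoˡ (ℚ.<⇒≤ (0<* 0<δ 0<s)) ≤k ⟩
  fromℕ k * (δ * s) <⟨ subst (_< s + fromℕ k * (δ * s)) (ℚ.+-identityˡ _) (ℚ.+-monoˡ-< (fromℕ k * (δ * s)) 0<s) ⟩
  s + fromℕ k * (δ * s) ≡⟨ factor s (fromℕ k) δ ⟩
  (1ℚ + fromℕ k * δ) * s ≤⟨ *-monoˡ (ℚ.<⇒≤ 0<s) (bernoulli k (ℚ.<⇒≤ 0<δ)) ⟩
  (1ℚ + δ) ^ᵣ k * s ∎)
  where
  open ℚ.≤-Reasoning
  factor : ∀ s k δ → s + k * (δ * s) ≡ (1ℚ + k * δ) * s
  factor = solve-∀ ℚ-ring

module _ (I : Instance) {ε : ℚ} (0<ε : 0ℚ < ε) (ε≤1 : ε ≤ 1ℚ) (X : Selection I) (feasible : Feasible I X) where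
  open Instance I
  open Analysis I 0<ε ε≤1

  record Good (τ : Store) (T : ℕ) : Set where
    constructor mkGood
    field
      near-optimal : (1ℚ - ε) * totalValue I X ≤ totalValue I (output I τ)
      fair : ∀ k → (1ℚ - ε) * l k ≤ categoryValue I (output I τ) k × categoryValue I (output I τ) k ≤ (1ℚ + ε) * u k
      light : totalWeight I (output I τ) ≤ B
      fast : TimeBound constant ε I T

  module _ (p q : ℕ) (m≤ : m ℕ.≤ 2 ℕ.^ p) (p-min : ∀ j → j ℕ.< p → ¬ m ℕ.≤ 2 ℕ.^ j)
    (size≤ : ∀ i → size i ℕ.≤ 2 ℕ.^ suc q) (2^q≤n : 2 ℕ.^ q ℕ.≤ maxSize I) where

    private
      E = 2 ℕ.+ p ℕ.+ q
      D = p ℕ.+ suc q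
      L = 2 ℕ.^ p ℕ.* 2 ℕ.^ suc q

    open Layout I p (suc q) m≤ size≤ using (M; P; flat; Represents; MP≡; flat-decode; flat-atLevel; total-sum; rowOf; columnOf; column<)
    open Ratio 0<ε ε≤1 E (ℕ.s≤s ℕ.z≤n)

    0≤1-ε : 0ℚ ≤ 1ℚ - ε
    0≤1-ε = subst (_≤ 1ℚ - ε) (ℚ.+-inverseʳ ε) (ℚ.+-monoˡ-≤ (- ε) ε≤1)

    -- `f` adds the time spent before this phase, so that the bound for the whole run can be
    -- attached to the final state.
    timed-solve : ∀ {σ s k₀} lv lw ρ r → Represents lv v → Represents lw w → LeastPositive L (λ k → lv (L ℕ.+ k)) s → 0ℚ < s →
      tsum D 1 lv < ratio′ ^ᵣ k₀ * s → (∀ j → j ℕ.< k₀ → ¬ tsum D 1 lv < ratio′ ^ᵣ j * s) →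
      Gridded (mkLeaves (shapeFor I p q) lv lw) ε s (tsum D 1 lv) k₀ k₀ (mkGrid (mkLeaves (shapeFor I p q) lv lw) ρ (suc k₀) r) →
      gridOf σ ≡ mkGrid (mkLeaves (shapeFor I p q) lv lw) ρ (suc k₀) r → Fresh σ →
      ∀ (f : ℕ → ℕ) → TimeBound constant ε I (f (solveTime ε (mkGrid (mkLeaves (shapeFor I p q) lv lw) ρ (suc k₀) r))) →
      Timed (solve ε) σ (λ τ T → Good τ (f T))
    timed-solve {σ} {s} {k₀} lv lw ρ r lv-rep lw-rep lp 0<s top k-min (mkGridded _ refl _ origin powers) g fresh _ fast =
      _ , exec-weaken (exec-solve ε _ g fresh) (λ {τ} outcome → good {τ} outcome (feasible-bound lv-rep lw-rep laws below ratio^≤1+ε outcome X feasible)) ℕ.≤-refl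
      where
      open Correctness I {ε} (ℚ.<⇒≤ 0<ε) 0≤1-ε p q m≤ size≤ lv lw ρ (suc k₀) r
        using (G; feasible-bound; output-weight; output-category; output-near-optimal)
      laws : GridLaws G s (tsum D 1 lv) k₀
      laws = record { size≡ = refl ; origin = origin ; powers = powers ; 1<ρ = 1<ratio ; 0<s = 0<s ; top = top }
      below : ∀ k → k ℕ.< L → 0ℚ < lv (L ℕ.+ k) → s ≤ lv (L ℕ.+ k)
      below k k<L 0<lv = proj₂ (LeastPositive.below lp k k<L 0<lv)
      good : ∀ {τ} (outcome : Outcome ε G (λ i j → nat τ chosen (i ∷ j ∷ []))) →
        Outcome.root outcome ℕ.< suc k₀ × Affordable G (Outcome.tables outcome) (Outcome.root outcome) ×
          totalValue I X ≤ (1ℚ + ε) * r (Outcome.root outcome) → Good τ _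
      good {τ} outcome (root<K , afford , _) =
        mkGood (output-near-optimal lv-rep lw-rep laws below ratio^≤1+ε outcome afford root<K X feasible)
          (output-category lv-rep lw-rep laws below ratio^≤1+ε outcome afford root<K)
          (output-weight lv-rep lw-rep laws below ratio^≤1+ε outcome afford root<K)
          fast

    -- The item assumed to have positive value makes s positive; s is then the value of an actual
    -- item, padding leaves having value 0.
    loaded-positive : ∀ {lv s} → Represents lv v → LeastPositive L (λ k → lv (L ℕ.+ k)) s → PositiveValue I s
    loaded-positive {lv} {s} rep (mkLeast _ attained below) = value-of (attained 0<s) , 0<s
      where
      leafIndex≥ : ∀ {y} → AtLevel D y → L ℕ.+ (y ℕ.∸ L) ≡ y × y ℕ.∸ L ℕ.< L
      leafIndex≥ {y} (≤y , y<) = eq , ℕ.+-cancelˡ-< L _ L (subst₂ ℕ._<_ (sym eq) (trans (cong (2 ℕ.*_) MP≡) (cong (L ℕ.+_) (ℕ.+-identityʳ L))) y<)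
        where
        eq : L ℕ.+ (y ℕ.∸ L) ≡ y
        eq = ℕ.m+[n∸m]≡n (subst (ℕ._≤ y) MP≡ ≤y)
      0<s : 0ℚ < s
      0<s = proj₁ (below (flat (toℕ i) (toℕ j) ℕ.∸ L) (proj₂ index)
        (subst (0ℚ <_) (sym (trans (cong lv (proj₁ index)) (trans (rep (toℕ i) (toℕ j) i<M j<P) (atItem-toℕ I v i j)))) (proj₂ (proj₂ positive))))
        where
        i = proj₁ positive
        j = proj₁ (proj₂ positive)
        i<M = ℕ.<-≤-trans (Fin.toℕ<n i) m≤
        j<P = ℕ.<-≤-trans (Fin.toℕ<n j) (size≤ i)
        index = leafIndex≥ (flat-atLevel i<M j<P)
      value-of : ∃[ k ] (k ℕ.< L × lv (L ℕ.+ k) ≡ s) → Value I s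
      value-of (k , k<L , lv≡s) with flat-decode (L ℕ.+ k) level
        where
        level : AtLevel D (L ℕ.+ k)
        level = subst (ℕ._≤ L ℕ.+ k) (sym MP≡) (ℕ.m≤m+n L k) ,
          subst (L ℕ.+ k ℕ.<_) (sym (trans (cong (2 ℕ.*_) MP≡) (cong (L ℕ.+_) (ℕ.+-identityʳ L)))) (ℕ.+-monoʳ-< L k<L)
      ... | eq , row< with atItem-cases I (rowOf (L ℕ.+ k)) (columnOf (L ℕ.+ k)) | trans (cong lv eq) (rep _ _ row< (column< (L ℕ.+ k)))
      ...   | inj₁ (i , j , _ , _ , eq′) | lv≡ = i , j , trans (sym (eq′ v)) (trans (sym lv≡) lv≡s)
      ...   | inj₂ none | lv≡ = ⊥-elim (ℚ.<-irrefl (sym (trans (sym lv≡s) (trans lv≡ (none v)))) 0<s)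

    timed-afterLoad : ∀ {σ V} → leavesOf σ ≡ V → Loaded (shapeFor I p q) (λ i j → i ℕ.< 2 ℕ.^ p) V → Fresh σ →
      ∀ (f : ℕ → ℕ) → (∀ lv lw s tot k₀ ρ r → let V = mkLeaves (shapeFor I p q) lv lw in
        f (scanTime V ℕ.+ (gridTime V ε s tot k₀ ℕ.+ solveTime ε (mkGrid V ρ (suc k₀) r))) ≡ runTime m p q L (suc k₀)) →
      Timed (scan ⨾ makeGrid ε ⨾ solve ε) σ (λ τ T → Good τ (f T))
    timed-afterLoad {σ} {mkLeaves _ lv lw} v≡ (mkLoaded refl loaded) fresh f time≡ =
      timed-seq (exec-scan V v≡ fresh) λ { σ₁ (mkScanned v₁ tot≡ lp , fresh₁) → afterScan σ₁ v₁ (trans tot≡ total≡) lp fresh₁ }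
      where
      V : Leaves
      V = mkLeaves (shapeFor I p q) lv lw
      lv-rep : Represents lv v
      lv-rep i j i<M j<P = proj₁ (loaded i j j<P i<M)
      lw-rep : Represents lw w
      lw-rep i j i<M j<P = proj₂ (loaded i j j<P i<M)
      tot = tsum D 1 lv
      total≡ : rsum L (λ k → lv (L ℕ.+ k)) ≡ tot
      total≡ = begin
        rsum L (λ k → lv (L ℕ.+ k)) ≡⟨ cong (λ n → rsum n (λ k → lv (n ℕ.+ k))) MP≡ ⟨
        rsum (2 ℕ.^ D) (λ k → lv (2 ℕ.^ D ℕ.+ k)) ≡⟨ rsum-cong (2 ℕ.^ D) (λ k _ → cong (λ z → lv (z ℕ.+ k)) (ℕ.*-identityˡ (2 ℕ.^ D))) ⟨
        rsum (2 ℕ.^ D) (λ k → lv (1 ℕ.* 2 ℕ.^ D ℕ.+ k)) ≡⟨ tsum-rsum D 1 lv ⟨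
        tot ∎
        where open ≡-Reasoning
      afterScan : ∀ σ₁ → leavesOf σ₁ ≡ V → rat σ₁ total [] ≡ tot → LeastPositive L (λ k → lv (L ℕ.+ k)) (rat σ₁ least []) → Fresh σ₁ →
        Timed (makeGrid ε ⨾ solve ε) σ₁ (λ τ T → Good τ (f (scanTime V ℕ.+ T)))
      afterScan σ₁ v₁ tot≡ lp fresh₁ = afterMinimal (minimal (λ j → tot ℚ.<? ratio′ ^ᵣ j * s) {proj₁ unbounded} (proj₂ unbounded))
        where
        s = rat σ₁ least []
        s-value = loaded-positive {lv} lv-rep lp
        0<s = proj₂ s-value
        unbounded = powers-unbounded {step} tot 0<step 0<s
        afterGrid : ∀ {k₀} σ₂ G → tot < ratio′ ^ᵣ k₀ * s → (∀ j → j ℕ.< k₀ → ¬ tot < ratio′ ^ᵣ j * s) →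
          gridOf σ₂ ≡ G → Gridded V ε s tot k₀ k₀ G → Fresh σ₂ →
          Timed (solve ε) σ₂ (λ τ T → Good τ (f (scanTime V ℕ.+ (gridTime V ε s tot k₀ ℕ.+ T))))
        afterGrid {k₀} σ₂ (mkGrid _ ρ _ r) top k-min g gridded@(mkGridded refl refl refl _ _) fresh₂ =
          timed-solve lv lw ρ r lv-rep lw-rep lp 0<s top k-min gridded g fresh₂ (λ T → f (scanTime V ℕ.+ (gridTime V ε s tot k₀ ℕ.+ T)))
            (timeBound {p} {q} {k₀} {s} {ratio′} p-min m≤ 2^q≤n 1<ratio 1+ε≤ratio^ s-value
              (λ j j< → subst (λ z → ¬ z < ratio′ ^ᵣ j * s) (total-sum {lv} lv-rep) (k-min j j<))
              (ℕ.≤-reflexive (time≡ lv lw s tot k₀ ρ r)))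
        afterMinimal : (∃[ k₀ ] (tot < ratio′ ^ᵣ k₀ * s × (∀ j → j ℕ.< k₀ → ¬ tot < ratio′ ^ᵣ j * s))) →
          Timed (makeGrid ε ⨾ solve ε) σ₁ (λ τ T → Good τ (f (scanTime V ℕ.+ T)))
        afterMinimal (k₀ , top , k-min) =
          timed-seq (exec-makeGrid V ε s tot k₀ v₁ fresh₁ tot≡ refl top k-min)
            λ { σ₂ (gridded , fresh₂) → afterGrid σ₂ (gridOf σ₂) top k-min refl gridded fresh₂ }

  -- The exponent p depends on m and is fixed before the run; q depends on the measured `breadth`
  -- and can be chosen only after the first phase.
  timed-algorithm : Timed (algorithm ε) (input I) Good
  timed-algorithm = afterRows (minimal (λ k → m ℕ.≤? 2 ℕ.^ k) {m} (n≤2^n m))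
    where
    In = inputs (input I)
    bounded : ∀ i → i ℕ.< m → at 0 size i ℕ.≤ maxSize I
    bounded i i<m = subst (λ z → at 0 size z ℕ.≤ maxSize I) (Fin.toℕ-fromℕ< i<m)
      (ℕ.≤-trans (ℕ.≤-reflexive (at-toℕ 0 size (fromℕ< i<m))) (≤-foldr-⊔ size (fromℕ< i<m)))
    Rows : ℕ → Set
    Rows p = m ℕ.≤ 2 ℕ.^ p × (∀ j → j ℕ.< p → ¬ m ℕ.≤ 2 ℕ.^ j)
    Columns : ℕ → ℕ → Set
    Columns n q = n ℕ.≤ 2 ℕ.^ suc q × (∀ j → j ℕ.< q → ¬ n ℕ.≤ 2 ℕ.^ suc j)
    afterColumns : ∀ {p} → Rows p → ∀ σ₁ → inputs σ₁ ≡ In → (∀ i → i ℕ.< m → at 0 size i ℕ.≤ nat σ₁ breadth []) → nat σ₁ breadth [] ℕ.≤ maxSize I → Fresh σ₁ →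
      ∃[ q ] Columns (nat σ₁ breadth []) q →
      Timed (shape ⨾ load ⨾ scan ⨾ makeGrid ε ⨾ solve ε) σ₁ (λ τ T → Good τ (forTime (! categories) m 15 ℕ.+ T))
    afterColumns {p} (m≤ , p-min) σ₁ i₁ sizes≤ ≤n fresh₁ (q , n≤ , q-min) =
      timed-seq (exec-shape In {p = p} {q} {σ₁} i₁ fresh₁ refl m≤ p-min n≤ q-min) λ { σ₂ (s₂ , fresh₂) →
      timed-seq (exec-load (shapeFor I p q) {σ₂} s₂ fresh₂) λ { σ₃ (loaded , fresh₃) →
      timed-afterLoad p q m≤ p-min size≤ 2^q≤n refl loaded fresh₃
        (λ T → forTime (! categories) m 15 ℕ.+ (shapeTime In p q ℕ.+ (loadTime (shapeFor I p q) ℕ.+ T))) (λ _ _ _ _ _ _ _ → refl) } }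
      where
      size≤ : ∀ i → size i ℕ.≤ 2 ℕ.^ suc q
      size≤ i = ℕ.≤-trans (ℕ.≤-trans (ℕ.≤-reflexive (sym (at-toℕ 0 size i))) (sizes≤ (toℕ i) (Fin.toℕ<n i))) n≤
      2^q≤n : 2 ℕ.^ q ℕ.≤ maxSize I
      2^q≤n = go q q-min
        where
        go : ∀ q → (∀ j → j ℕ.< q → ¬ nat σ₁ breadth [] ℕ.≤ 2 ℕ.^ suc j) → 2 ℕ.^ q ℕ.≤ maxSize I
        go zero _ = n≥1
        go (suc q) below = ℕ.≤-trans (ℕ.<⇒≤ (ℕ.≰⇒> (below q (ℕ.n<1+n q)))) ≤n
    afterRows : ∃[ p ] Rows p → Timed (algorithm ε) (input I) Good
    afterRows (p , rows≤) =
      timed-seq (exec-measure In {maxSize I} {input I} refl (λ _ _ → refl) refl bounded)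
        λ { σ₁ (mkMeasured i₁ sizes≤ ≤n , fresh₁) → afterColumns rows≤ σ₁ i₁ sizes≤ ≤n fresh₁
              (minimal (λ k → nat σ₁ breadth [] ℕ.≤? 2 ℕ.^ suc k) {nat σ₁ breadth []}
                (ℕ.≤-trans (n≤2^n (nat σ₁ breadth [])) (ℕ.m≤m+n (2 ℕ.^ nat σ₁ breadth []) _))) }

-- Both ranges of ε combined

theorem3p4 : ∃[ C ] ∀ (ε : ℚ) → 0ℚ < ε →
    ∃[ algorithm ] ∀ (I : Instance) (opt : ℚ) → IsOptimalValue I opt →
    ∃[ τ ] ∃[ t ]
    ( Run algorithm (input I) τ t
    × (1ℚ - ε) * opt ≤ totalValue I (output I τ)
    × (∀ k → (1ℚ - ε) * Instance.l I k ≤ categoryValue I (output I τ) k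
    × categoryValue I (output I τ) k ≤ (1ℚ + ε) * Instance.u I k)
    × totalWeight I (output I τ) ≤ Instance.B I
    × TimeBound C ε I t )
theorem3p4 = constant , solver
  where
  Solves : ℚ → Cmd → Instance → ℚ → Set
  Solves ε c I opt = ∃[ τ ] ∃[ t ]
    ( Run c (input I) τ t
    × (1ℚ - ε) * opt ≤ totalValue I (output I τ)
    × (∀ k → (1ℚ - ε) * Instance.l I k ≤ categoryValue I (output I τ) k
    × categoryValue I (output I τ) k ≤ (1ℚ + ε) * Instance.u I k)
    × totalWeight I (output I τ) ≤ Instance.B I
    × TimeBound constant ε I t )

  small : ∀ {ε} → 0ℚ < ε → ε ≤ 1ℚ → ∀ I opt → IsOptimalValue I opt → Solves ε (algorithm ε) I opt
  -- The optimum is attained by some X, and `refl` replaces `opt` by its value; X enters the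
  -- analysis but not the program.
  small {ε} 0<ε ε≤1 I _ ((X , feasible , refl) , _) = solves (timed-algorithm I 0<ε ε≤1 X feasible)
    where
    solves : Timed (algorithm ε) (input I) (Good I 0<ε ε≤1 X feasible) → Solves ε (algorithm ε) I (totalValue I X)
    solves (T , τ , t , run , mkGood near-optimal fair light fast , t≤T) =
      τ , t , run , near-optimal , fair , light , λ vmin vmax isMin isMax α β logα logβ →
        ℚ.≤-trans (fromℕ-mono {t} {T} t≤T) (fast vmin vmax isMin isMax α β logα logβ)

  -- If ε > 1, the lower bounds are vacuous and the time bound may be less than 1.
  large : ∀ {ε} → 0ℚ < ε → ¬ ε ≤ 1ℚ → ∀ I opt → IsOptimalValue I opt → Solves ε skip I opt
  large {ε} 0<ε ε≰1 I opt ((X , feasible , refl) , _) =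
    input I , 0 , run-skip ,
    ℚ.≤-trans (negative* (0≤∑ _ (λ i → 0≤∑ _ (selected≥0 I X v≥0 i)))) (0≤∑ _ (λ i → 0≤∑ _ (selected≥0 I (output I (input I)) v≥0 i))) ,
    (λ k → ℚ.≤-trans (negative* (l≥0 k)) (0≤∑ _ (selected≥0 I (output I (input I)) v≥0 k)) ,
           ℚ.≤-trans (ℚ.≤-reflexive (empty v k)) (0≤* 0≤1+ε (ℚ.≤-trans (l≥0 k) (l≤u k)))) ,
    ℚ.≤-trans (ℚ.≤-reflexive (∑-0 _ (empty w))) (ℚ.≤-trans (0≤∑ _ (λ i → 0≤∑ _ (selected≥0 I X w≥0 i))) (proj₂ feasible)) ,
    λ vmin vmax isMin isMax α β (0≤α , _) (0≤β , _) →
      0≤* (0≤fromℕ constant) (0≤/₀ (0≤* (0≤* (0≤fromℕ (maxSize I ℕ.^ 2 ℕ.* m)) (0≤^ 3 0≤α)) (0≤^ 3 0≤β)) 0<ε)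
    where
    open Instance I
    0≤1+ε : 0ℚ ≤ 1ℚ + ε
    0≤1+ε = 0≤+ 0≤1 (ℚ.<⇒≤ 0<ε)
    1-ε≤0 : 1ℚ - ε ≤ 0ℚ
    1-ε≤0 = subst (1ℚ - ε ≤_) (ℚ.+-inverseʳ ε) (ℚ.+-monoˡ-≤ (- ε) (ℚ.<⇒≤ (ℚ.≰⇒> ε≰1)))
    negative* : ∀ {x} → 0ℚ ≤ x → (1ℚ - ε) * x ≤ 0ℚ
    negative* {x} 0≤x = subst ((1ℚ - ε) * x ≤_) (ℚ.*-zeroˡ x) (*-monoˡ 0≤x 1-ε≤0)
    ∑-0 : ∀ {n} (f : Fin n → ℚ) → (∀ i → f i ≡ 0ℚ) → ∑ f ≡ 0ℚ
    ∑-0 {zero} f _ = refl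
    ∑-0 {suc n} f eq = cong₂ _+_ (eq Fin.zero) (∑-0 (f ∘ Fin.suc) (eq ∘ Fin.suc))
    empty : ∀ h k → sumOver I h (output I (input I)) k ≡ 0ℚ
    empty h k = ∑-0 _ (λ j → cong (λ b → if b then h k j else 0ℚ) (lookup∘tabulate (λ _ → false) j))

  byCases : ∀ {ε} → 0ℚ < ε → Dec (ε ≤ 1ℚ) → ∃[ c ] ∀ I opt → IsOptimalValue I opt → Solves ε c I opt
  byCases {ε} 0<ε (yes ε≤1) = algorithm ε , small 0<ε ε≤1
  byCases {ε} 0<ε (no ε≰1) = skip , large 0<ε ε≰1

  solver : ∀ ε → 0ℚ < ε → ∃[ c ] ∀ I opt → IsOptimalValue I opt → Solves ε c I opt
  solver ε 0<ε = byCases 0<ε (ε ℚ.≤? 1ℚ)
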